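{- Let $q$ be a prime power and $m\ge 1$. Let $\mathrm{U}_m(q)\le \mathrm{GL}_m(q^2)$ be the unitary group, i.e. the isometry group of a non-degenerate unitary (Hermitian) form on $V=\mathbb{F}_{q^2}^m$, and let $\mathrm{AU}_m(q)=V\rtimes \mathrm{U}_m(q)$ act on $V$ via $u\mapsto ua+v$ for $a\in\mathrm{U}_m(q)$, $v\in V$. Then the proportion of derangements in $\mathrm{AU}_m(q)$ (in this action on $V$) is $$\frac{1}{q+1}\left(1-\frac{1}{(-q)^{m(m+3)/2}}\right).$$
   Context: A derangement of a permutation group is an element with no fixed points. The proportion of derangements in a finite permutation group $G$ is $|\{g\in G: g \text{ is a derangement}\}|/|G|$. -}

module Defs where

open import Level using (Level; _⊔_)
open import Data.Nat using (ℕ; zero; suc)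
open import Data.Fin using (Fin)
open import Data.Bool using (Bool; true; false; not; _∧_)
open import Data.List using (List; []; _∷_; map; concatMap; length)
open import Data.List.Relation.Unary.Any using (Any)
open import Data.List.Relation.Unary.AllPairs using (AllPairs)
open import Data.Product using (_×_; _,_; Σ)
open import Data.Vec.Functional using (Vector; foldr)
import Data.Vec.Functional as VF
open import Relation.Nullary using (¬_; Dec)
open import Relation.Nullary.Decidable using (does)
open import Relation.Unary using ()
open import Algebra.Bundles using (CommutativeRing)

record FiniteField c ℓ : Set (Level.suc (c ⊔ ℓ)) where
  field
    cring : CommutativeRing c ℓ
  open CommutativeRing cring public
  field
    _≟_      : (x y : Carrier) → Dec (x ≈ y)
    1≉0      : ¬ (1# ≈ 0#)
    inverse  : (x : Carrier) → ¬ (x ≈ 0#) → Σ Carrier (λ y → (x * y) ≈ 1#)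
    elements : List Carrier
    complete : (x : Carrier) → Any (x ≈_) elements
    distinct : AllPairs (λ x y → ¬ (x ≈ y)) elements

  card : ℕ
  card = length elements

  pow : Carrier → ℕ → Carrier
  pow x zero    = 1#
  pow x (suc n) = x * pow x n

allᵇ : ∀ {a} {A : Set a} → (A → Bool) → List A → Bool
allᵇ p []       = true
allᵇ p (x ∷ xs) = p x ∧ allᵇ p xs

anyᵇ : ∀ {a} {A : Set a} → (A → Bool) → List A → Bool
anyᵇ p xs = not (allᵇ (λ x → not (p x)) xs)

filterᵇ : ∀ {a} {A : Set a} → (A → Bool) → List A → List A
filterᵇ p []       = []
filterᵇ p (x ∷ xs) with p x
... | true  = x ∷ filterᵇ p xs
... | false = filterᵇ p xs

allFuns : ∀ {a} {A : Set a} → List A → (n : ℕ) → List (Fin n → A)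
allFuns xs zero    = (λ ()) ∷ []
allFuns xs (suc n) = concatMap (λ x → map (λ f → x VF.∷ f) (allFuns xs n)) xs

-- Linear algebra over a finite field K with the involution σ(x) = x^q
-- (here q is a parameter; K will have q² elements).

module Unitary {c ℓ} (K : FiniteField c ℓ) (q : ℕ) where
  open FiniteField K

  Vec : ℕ → Set c
  Vec m = Fin m → Carrier

  Mat : ℕ → Set c
  Mat m = Fin m → Fin m → Carrier

  σ : Carrier → Carrier
  σ x = pow x q

  Σᵢ : ∀ {m} → (Fin m → Carrier) → Carrier
  Σᵢ f = foldr _+_ 0# f

  _·_ : ∀ {m} → Vec m → Mat m → Vec m
  (u · A) j = Σᵢ (λ i → u i * A i j)

  _⊕_ : ∀ {m} → Vec m → Vec m → Vec m
  (u ⊕ v) i = u i + v i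

  _⊗_ : ∀ {m} → Mat m → Mat m → Mat m
  (A ⊗ B) i k = Σᵢ (λ j → A i j * B j k)

  I : ∀ {m} → Mat m
  I i j with does (Data.Fin._≟_ i j)
  ... | true  = 1#
  ... | false = 0#

  form : ∀ {m} → Mat m → Vec m → Vec m → Carrier
  form H u w = Σᵢ (λ i → Σᵢ (λ j → u i * (H i j * σ (w j))))

  eqᵇ : Carrier → Carrier → Bool
  eqᵇ x y = does (x ≟ y)

  allFin : ∀ {m} → (Fin m → Bool) → Bool
  allFin {m} p = foldr _∧_ true p

  vecEqᵇ : ∀ {m} → Vec m → Vec m → Bool
  vecEqᵇ u w = allFin (λ i → eqᵇ (u i) (w i))

  matEqᵇ : ∀ {m} → Mat m → Mat m → Bool
  matEqᵇ A B = allFin (λ i → allFin (λ j → eqᵇ (A i j) (B i j)))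

  allVecs : (m : ℕ) → List (Vec m)
  allVecs m = allFuns elements m

  allMats : (m : ℕ) → List (Mat m)
  allMats m = allFuns (allFuns elements m) m

  Hermitian : ∀ {m} → Mat m → Set ℓ
  Hermitian H = ∀ i j → H j i ≈ σ (H i j)

  NonDegenerate : ∀ {m} → Mat m → Set (c ⊔ ℓ)
  NonDegenerate {m} H = (u : Vec m) → (∀ w → form H u w ≈ 0#) → ∀ i → u i ≈ 0#

  isInvertibleᵇ : ∀ {m} → Mat m → Bool
  isInvertibleᵇ {m} A = anyᵇ (λ B → matEqᵇ (A ⊗ B) I ∧ matEqᵇ (B ⊗ A) I) (allMats m)

  isIsometryᵇ : ∀ {m} → Mat m → Mat m → Bool
  isIsometryᵇ {m} H A =
    allᵇ (λ u → allᵇ (λ w → eqᵇ (form H (u · A) (w · A)) (form H u w)) (allVecs m)) (allVecs m)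

  unitaryGroup : ∀ {m} → Mat m → List (Mat m)
  unitaryGroup {m} H = filterᵇ (λ A → isInvertibleᵇ A ∧ isIsometryᵇ H A) (allMats m)

  -- AU_m(q) = V ⋊ U_m(q): pairs (a, v) acting by u ↦ u a + v
  affineGroup : ∀ {m} → Mat m → List (Mat m × Vec m)
  affineGroup {m} H = concatMap (λ A → map (λ v → A , v) (allVecs m)) (unitaryGroup H)

  isDerangementᵇ : ∀ {m} → Mat m × Vec m → Bool
  isDerangementᵇ {m} (A , v) = allᵇ (λ u → not (vecEqᵇ ((u · A) ⊕ v) u)) (allVecs m)

  derangements : ∀ {m} → Mat m → List (Mat m × Vec m)
  derangements H = filterᵇ isDerangementᵇ (affineGroup H)

-- For an isometry g of the Hermitian space V let I be the orthogonal complement of Fix g, which is also the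
-- image of 1 − g.  The affine map x ↦ g x + v has a fixed point exactly when v ∈ I, so the number of
-- non-derangements is T = Σ |I|, summed over U(V), and T is computed by induction on m from three facts.
--  * For a subspace F let C(F) be the number of its vectors of norm 1.  Poisson summation for the norm gives
--    |F| (|F^⊥| − q C(F^⊥)) = (−q)^m (|F| − q C(F)).
--  * A vector r of norm 1 lies in I for exactly the proportion q/(q+1) of all g: of the q + 1 isometries g s,
--    where s multiplies r by a scalar of norm 1 and fixes its complement, just one has a fixed vector that
--    is not orthogonal to r.
--  * U(V) is transitive on the vectors w of norm 1, and the stabiliser of w is the unitary group of the
--    complement of w, with the same I.
-- Applying the first fact to Fix g and summing over g, the second evaluates Σ C(I), and the third together
-- with the induction hypothesis evaluates Σ C(Fix g) |I|.

module Submission where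

open import Defs
open import Level using (Level; _⊔_)
open import Algebra.Bundles using (CommutativeMonoid; CommutativeRing; RawRing)
import Algebra.Solver.Ring as RingSolver
open import Algebra.Solver.Ring.AlmostCommutativeRing using (fromCommutativeRing; _-Raw-AlmostCommutative⟶_)
open import Data.Bool using (Bool; true; false; not; _∧_; if_then_else_)
open import Data.Empty using (⊥-elim)
open import Data.Fin using (Fin; zero; suc; toℕ; fromℕ; inject₁)
import Data.Fin as Fin
open import Data.Fin.Permutation using (permutation)
import Data.Fin.Properties as FinP
open import Data.Integer using (ℤ; 0ℤ; 1ℤ)
import Data.Integer as ℤ
import Data.Integer.Properties as ℤP
open import Data.Integer.Tactic.RingSolver using (solve-∀)
open import Data.List using (List; []; _∷_; _++_; map; concatMap; length; lookup)
open import Data.List.Membership.Propositional.Properties using (∈-lookup)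
import Data.List.Properties as ListP
open import Data.List.Relation.Unary.All as All using (All; []; _∷_)
import Data.List.Relation.Unary.All.Properties as AllP
open import Data.List.Relation.Unary.AllPairs as AllPairs using (AllPairs; []; _∷_)
import Data.List.Relation.Unary.AllPairs.Properties as AllPairsP
open import Data.List.Relation.Unary.Any as Any using (Any; here; there; index)
import Data.List.Relation.Unary.Any.Properties as AnyP
open import Data.Maybe using (Maybe; just; nothing)
open import Data.Nat as ℕ using (ℕ; zero; suc; s≤s; z≤n; _∸_; _!; _≥_)
open import Data.Nat.Divisibility using (_∣_; divides; m∣m*n; ∣⇒≤; ∣1⇒≡1)
open import Data.Nat.DivMod using (m/n*n≡m; m*n/n≡m)
open import Data.Nat.Primality using (Prime; euclidsLemma; prime⇒nonZero; prime⇒nonTrivial; ¬prime[1])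
import Data.Nat.Properties as ℕP
import Data.Nat.Tactic.RingSolver as ℕSolver
open import Data.Product using (_×_; _,_; proj₁; proj₂; ∃; Σ)
open import Data.Sum using (inj₁; inj₂)
import Data.Vec.Functional as VF
open import Function using (_∘_; id)
open import Relation.Binary.PropositionalEquality as ≡ using (_≡_; cong; cong₂; subst; subst₂; module ≡-Reasoning)
import Relation.Binary.Reasoning.Setoid as SetoidReasoning
open import Relation.Nullary using (¬_; Dec; yes; no; does)
open import Relation.Nullary.Decidable using (_×-dec_; _→-dec_; ¬?)

-- Norm 1 suffices because in every subspace all nonzero norm values are equally frequent: |F| and
-- C(F) determine the whole distribution of norms. This is where the q of the Poisson formula comes
-- from: F has |F| - (q - 1) C(F) vectors of norm 0, and subtracting the C(F) vectors of norm 1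
-- leaves |F| - q C(F). Complex characters are avoided, since the integer function `χ` already
-- cancels where a character would. The Poisson formula for Fix g is multiplied by |I|: as |Fix g|
-- |I| = |V|, the varying factor becomes a constant and the formula can be summed over g. The
-- induction leaves coordinates, because the complement of w has no preferred basis. It runs over
-- abstract spaces, known by their size (q²)^m, their form and their full isometry group; matrices
-- enter only when the result is applied. The step to dimension m contributes the factor (-q)(-q)^m
-- to the denominator, and the exponents m + 1 add up to m(m + 3)/2. Every identity is kept in the
-- integers, cleared of denominators.

module IntegerSums where

  -- Integer sums over finite index sets, and counting by indicators.

  open import Data.Integer using (-_; _+_; _*_; _-_)
  open ≡ using (refl; sym; trans)
  import Algebra.Properties.Semiring.Sum ℤP.+-*-semiring as Sum

  -- Abstract, so that the number of summands can be inferred by unification.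
  abstract
    sum : ∀ {n} → (Fin n → ℤ) → ℤ
    sum = Sum.sum

    sum-empty : (f : Fin 0 → ℤ) → sum f ≡ 0ℤ
    sum-empty f = refl

    sum-suc : ∀ {n} (f : Fin (suc n) → ℤ) → sum f ≡ f zero + sum (f ∘ suc)
    sum-suc f = refl

    sum-cong : ∀ {n} {f g : Fin n → ℤ} → (∀ i → f i ≡ g i) → sum f ≡ sum g
    sum-cong = Sum.sum-cong-≗

    *-distribˡ-sum : ∀ {n} x (f : Fin n → ℤ) → x * sum f ≡ sum (λ i → x * f i)
    *-distribˡ-sum = Sum.*-distribˡ-sum

    *-distribʳ-sum : ∀ {n} x (f : Fin n → ℤ) → sum f * x ≡ sum (λ i → f i * x)
    *-distribʳ-sum = Sum.*-distribʳ-sum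

    sum-+ : ∀ {n} (f g : Fin n → ℤ) → sum (λ i → f i + g i) ≡ sum f + sum g
    sum-+ = Sum.∑-distrib-+

    sum-comm : ∀ {m n} (f : Fin m → Fin n → ℤ) →
               sum (λ i → sum (λ j → f i j)) ≡ sum (λ j → sum (λ i → f i j))
    sum-comm = Sum.∑-comm

  ⟦_⟧ : ∀ {a} {P : Set a} → Dec P → ℤ
  ⟦ d ⟧ = if does d then 1ℤ else 0ℤ

  ⟦yes⟧ : ∀ {a} {P : Set a} (d : Dec P) → P → ⟦ d ⟧ ≡ 1ℤ
  ⟦yes⟧ (yes _) _ = refl
  ⟦yes⟧ (no ¬p) p = ⊥-elim (¬p p)

  ⟦no⟧ : ∀ {a} {P : Set a} (d : Dec P) → ¬ P → ⟦ d ⟧ ≡ 0ℤ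
  ⟦no⟧ (yes p) ¬p = ⊥-elim (¬p p)
  ⟦no⟧ (no _) _ = refl

  ⟦cong⟧ : ∀ {a b} {P : Set a} {R : Set b} (d : Dec P) (e : Dec R) → (P → R) → (R → P) → ⟦ d ⟧ ≡ ⟦ e ⟧
  ⟦cong⟧ (yes p) e f g = sym (⟦yes⟧ e (f p))
  ⟦cong⟧ (no ¬p) e f g = sym (⟦no⟧ e (¬p ∘ g))

  ⟦×⟧ : ∀ {a b} {P : Set a} {R : Set b} (d : Dec P) (e : Dec R) → ⟦ d ×-dec e ⟧ ≡ ⟦ d ⟧ * ⟦ e ⟧
  ⟦×⟧ (yes _) (yes _) = refl
  ⟦×⟧ (yes _) (no _)  = refl
  ⟦×⟧ (no _)  (yes _) = refl
  ⟦×⟧ (no _)  (no _)  = refl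

  ⟦¬⟧ : ∀ {a} {P : Set a} (d : Dec P) → ⟦ ¬? d ⟧ ≡ 1ℤ - ⟦ d ⟧
  ⟦¬⟧ (yes _) = refl
  ⟦¬⟧ (no _)  = refl

  ⟦⟧*-cong : ∀ {a} {P : Set a} (d : Dec P) {x y : ℤ} → (P → x ≡ y) → ⟦ d ⟧ * x ≡ ⟦ d ⟧ * y
  ⟦⟧*-cong (yes p) e = cong (1ℤ *_) (e p)
  ⟦⟧*-cong (no _)  e = refl

  count : ∀ {n a} {P : Fin n → Set a} → (∀ i → Dec (P i)) → ℤ
  count d = sum (λ i → ⟦ d i ⟧)

  sum-zero : ∀ {n} (f : Fin n → ℤ) → (∀ i → f i ≡ 0ℤ) → sum f ≡ 0ℤ
  sum-zero {zero}  f e = sum-empty f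
  sum-zero {suc n} f e = trans (sum-suc f) (cong₂ _+_ (e zero) (sum-zero (f ∘ suc) (e ∘ suc)))

  sum-const : ∀ n (x : ℤ) → sum {n} (λ _ → x) ≡ ℤ.+ n * x
  sum-const zero    x = trans (sum-empty _) (sym (ℤP.*-zeroˡ x))
  sum-const (suc n) x = trans (sum-suc _) (trans (cong (x +_) (sum-const n x)) (sym (ℤP.suc-* (ℤ.+ n) x)))

  sum-neg : ∀ {n} (f : Fin n → ℤ) → sum (λ i → - f i) ≡ - sum f
  sum-neg f = begin
    sum (λ i → - f i)        ≡⟨ sum-cong (λ i → sym (ℤP.-1*i≡-i (f i))) ⟩
    sum (λ i → ℤ.-1ℤ * f i)  ≡⟨ *-distribˡ-sum ℤ.-1ℤ f ⟨
    ℤ.-1ℤ * sum f            ≡⟨ ℤP.-1*i≡-i (sum f) ⟩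
    - sum f                  ∎
    where open ≡-Reasoning

  sum-minus : ∀ {n} (f g : Fin n → ℤ) → sum (λ i → f i - g i) ≡ sum f - sum g
  sum-minus f g = trans (sum-+ f (λ i → - g i)) (cong (sum f +_) (sum-neg g))

  sum-δ : ∀ {n} (a : Fin n) (f : Fin n → ℤ) → sum (λ i → ⟦ i Fin.≟ a ⟧ * f i) ≡ f a
  sum-δ {suc n} zero f = trans (sum-suc _) (trans (cong₂ _+_ (ℤP.*-identityˡ (f zero)) (sum-zero _ (λ i → refl)))
                               (ℤP.+-identityʳ (f zero)))
  sum-δ {suc n} (suc a) f = trans (sum-suc _) (trans (ℤP.+-identityˡ _) (sum-δ a (f ∘ suc)))

  -- Both sides are the sum of f over the pairs of the (partial) bijection φ, ψ.
  sum-reindex : ∀ {m n a b} {P : Fin m → Set a} {R : Fin n → Set b}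
    (p : ∀ x → Dec (P x)) (r : ∀ y → Dec (R y)) (φ : Fin m → Fin n) (ψ : Fin n → Fin m) →
    (∀ x → P x → R (φ x)) → (∀ y → R y → P (ψ y)) →
    (∀ x → P x → ψ (φ x) ≡ x) → (∀ y → R y → φ (ψ y) ≡ y) →
    (f : Fin n → ℤ) → sum (λ x → ⟦ p x ⟧ * f (φ x)) ≡ sum (λ y → ⟦ r y ⟧ * f y)
  sum-reindex {m} {n} p r φ ψ pr rp ψφ φψ f = begin
    sum (λ x → ⟦ p x ⟧ * f (φ x))
      ≡⟨ sum-cong (λ x → trans (cong (⟦ p x ⟧ *_) (sym (sum-δ (φ x) f))) (*-distribˡ-sum ⟦ p x ⟧ _)) ⟩
    sum (λ x → sum (λ y → ⟦ p x ⟧ * (⟦ y Fin.≟ φ x ⟧ * f y)))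
      ≡⟨ sum-comm _ ⟩
    sum (λ y → sum (λ x → ⟦ p x ⟧ * (⟦ y Fin.≟ φ x ⟧ * f y)))
      ≡⟨ sum-cong (λ y → sum-cong (λ x → swap x y)) ⟩
    sum (λ y → sum (λ x → ⟦ r y ⟧ * (⟦ x Fin.≟ ψ y ⟧ * f y)))
      ≡⟨ sum-cong (λ y → trans (sym (*-distribˡ-sum ⟦ r y ⟧ _)) (cong (⟦ r y ⟧ *_) (sum-δ (ψ y) (λ _ → f y)))) ⟩
    sum (λ y → ⟦ r y ⟧ * f y) ∎
    where
    open ≡-Reasoning
    swap : ∀ x y → ⟦ p x ⟧ * (⟦ y Fin.≟ φ x ⟧ * f y) ≡ ⟦ r y ⟧ * (⟦ x Fin.≟ ψ y ⟧ * f y)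
    swap x y = begin
      ⟦ p x ⟧ * (⟦ y Fin.≟ φ x ⟧ * f y)  ≡⟨ ℤP.*-assoc ⟦ p x ⟧ ⟦ y Fin.≟ φ x ⟧ (f y) ⟨
      ⟦ p x ⟧ * ⟦ y Fin.≟ φ x ⟧ * f y    ≡⟨ cong (_* f y) (⟦×⟧ (p x) (y Fin.≟ φ x)) ⟨
      ⟦ p x ×-dec (y Fin.≟ φ x) ⟧ * f y  ≡⟨ cong (_* f y) (⟦cong⟧ (p x ×-dec (y Fin.≟ φ x)) (r y ×-dec (x Fin.≟ ψ y))
                                               (λ { (px , refl) → pr x px , sym (ψφ x px) })
                                               (λ { (ry , refl) → rp y ry , sym (φψ y ry) })) ⟩
      ⟦ r y ×-dec (x Fin.≟ ψ y) ⟧ * f y  ≡⟨ cong (_* f y) (⟦×⟧ (r y) (x Fin.≟ ψ y)) ⟩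
      ⟦ r y ⟧ * ⟦ x Fin.≟ ψ y ⟧ * f y    ≡⟨ ℤP.*-assoc ⟦ r y ⟧ ⟦ x Fin.≟ ψ y ⟧ (f y) ⟩
      ⟦ r y ⟧ * (⟦ x Fin.≟ ψ y ⟧ * f y)  ∎

  count-bij : ∀ {m n a b} {P : Fin m → Set a} {R : Fin n → Set b}
    (p : ∀ x → Dec (P x)) (r : ∀ y → Dec (R y)) (φ : Fin m → Fin n) (ψ : Fin n → Fin m) →
    (∀ x → P x → R (φ x)) → (∀ y → R y → P (ψ y)) →
    (∀ x → P x → ψ (φ x) ≡ x) → (∀ y → R y → φ (ψ y) ≡ y) →
    count p ≡ count r
  count-bij p r φ ψ pr rp ψφ φψ =
    trans (sum-cong (λ x → sym (ℤP.*-identityʳ ⟦ p x ⟧)))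
      (trans (sum-reindex p r φ ψ pr rp ψφ φψ (λ _ → 1ℤ)) (sum-cong (λ y → ℤP.*-identityʳ ⟦ r y ⟧)))

  sum-bij : ∀ {m n} (φ : Fin m → Fin n) (ψ : Fin n → Fin m) →
    (∀ x → ψ (φ x) ≡ x) → (∀ y → φ (ψ y) ≡ y) → (f : Fin n → ℤ) → sum (f ∘ φ) ≡ sum f
  sum-bij φ ψ ψφ φψ f = trans (sum-cong (λ x → sym (ℤP.*-identityˡ (f (φ x)))))
    (trans (sum-reindex {P = λ _ → _≡_ {A = ℕ} 0 0} {R = λ _ → _≡_ {A = ℕ} 0 0} (λ _ → yes refl) (λ _ → yes refl) φ ψ (λ _ _ → refl) (λ _ _ → refl)
             (λ x _ → ψφ x) (λ y _ → φψ y) f)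
           (sum-cong (λ y → ℤP.*-identityˡ (f y))))

  sum-mono : ∀ {n} (f g : Fin n → ℤ) → (∀ i → f i ℤ.≤ g i) → sum f ℤ.≤ sum g
  sum-mono {zero}  f g h = ℤP.≤-reflexive (trans (sum-empty f) (sym (sum-empty g)))
  sum-mono {suc n} f g h = subst₂ ℤ._≤_ (sym (sum-suc f)) (sym (sum-suc g))
    (ℤP.+-mono-≤ (h zero) (sum-mono (f ∘ suc) (g ∘ suc) (h ∘ suc)))

  +-cancelʳ-≤ : ∀ k {i j} → i + k ℤ.≤ j + k → i ℤ.≤ j
  +-cancelʳ-≤ k {i} {j} h = subst₂ ℤ._≤_ (undo i k) (undo j k) (ℤP.+-monoˡ-≤ (- k) h)
    where
    undo : ∀ i k → i + k + - k ≡ i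
    undo = solve-∀

  -- One strict inequality would make the totals differ. This serves as a rigidity principle: upper
  -- bounds that add up exactly are equalities, and an inclusion between finite sets of the same
  -- size is an equality.
  sum-≤-≡ : ∀ {n} (f g : Fin n → ℤ) → (∀ i → f i ℤ.≤ g i) → sum g ℤ.≤ sum f → ∀ i → f i ≡ g i
  sum-≤-≡ {suc n} f g h e₀ i = go i
    where
    e = subst₂ ℤ._≤_ (sum-suc g) (sum-suc f) e₀
    head-≡ : f zero ≡ g zero
    head-≡ = ℤP.≤-antisym (h zero)
      (+-cancelʳ-≤ (sum (g ∘ suc))
        (ℤP.≤-trans e (ℤP.+-monoʳ-≤ (f zero) (sum-mono (f ∘ suc) (g ∘ suc) (h ∘ suc)))))
    go : ∀ i → f i ≡ g i
    go zero    = head-≡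
    go (suc i) = sum-≤-≡ (f ∘ suc) (g ∘ suc) (h ∘ suc)
      (+-cancelʳ-≤ (f zero) (subst₂ ℤ._≤_ (trans (cong (_+ sum (g ∘ suc)) (sym head-≡)) (ℤP.+-comm (f zero) _)) (ℤP.+-comm (f zero) _) e)) i

  ⟦⟧≥0 : ∀ {a} {P : Set a} (d : Dec P) → 0ℤ ℤ.≤ ⟦ d ⟧
  ⟦⟧≥0 (yes _) = ℤ.+≤+ ℕ.z≤n
  ⟦⟧≥0 (no _)  = ℤP.≤-refl

  ⟦⟧-mono : ∀ {a b} {P : Set a} {R : Set b} (d : Dec P) (e : Dec R) → (P → R) → ⟦ d ⟧ ℤ.≤ ⟦ e ⟧
  ⟦⟧-mono (yes p) e f = ℤP.≤-reflexive (sym (⟦yes⟧ e (f p)))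
  ⟦⟧-mono (no _)  e f = ⟦⟧≥0 e

  -- Presents a decidable subset of `Fin n` as a `Fin` of its own, so that the complement of a unit
  -- vector and its stabiliser can again be the vectors and the group of a `Space`. `sum-emb`
  -- carries sums across.
  record Enumeration {n a} {P : Fin n → Set a} (d : ∀ x → Dec (P x)) : Set a where
    field
      size     : ℕ
      emb      : Fin size → Fin n
      emb∈     : ∀ i → P (emb i)
      idx      : ∀ x → P x → Fin size
      emb-idx  : ∀ x p → emb (idx x p) ≡ x
      emb-inj  : ∀ {i j} → emb i ≡ emb j → i ≡ j
      sum-emb  : ∀ f → sum (f ∘ emb) ≡ sum (λ x → ⟦ d x ⟧ * f x)

  enumeration : ∀ {n a} {P : Fin n → Set a} (d : ∀ x → Dec (P x)) → Enumeration d
  enumeration {zero} d = record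
    { size = 0
    ; emb = λ ()
    ; emb∈ = λ ()
    ; idx = λ ()
    ; emb-idx = λ ()
    ; emb-inj = λ { {()} }
    ; sum-emb = λ f → trans (sum-empty _) (sym (sum-empty _))
    }
  enumeration {suc n} {P = P} d with d zero | enumeration (d ∘ suc) | (λ f → sum-suc (λ x → ⟦ d x ⟧ * f x))
  ... | yes p | rest | split = record
    { size = suc (E.size)
    ; emb = emb′
    ; emb∈ = λ { zero → p ; (suc i) → E.emb∈ i }
    ; idx = λ { zero _ → zero ; (suc x) px → suc (E.idx x px) }
    ; emb-idx = λ { zero _ → refl ; (suc x) px → cong suc (E.emb-idx x px) }
    ; emb-inj = inj
    ; sum-emb = λ f → trans (sum-suc _) (trans (cong₂ _+_ (sym (ℤP.*-identityˡ (f zero))) (E.sum-emb (f ∘ suc))) (sym (split f)))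
    }
    where
    module E = Enumeration rest
    emb′ : Fin (suc E.size) → Fin (suc n)
    emb′ zero    = zero
    emb′ (suc i) = suc (E.emb i)
    inj : ∀ {i j} → emb′ i ≡ emb′ j → i ≡ j
    inj {zero}  {zero}  e = refl
    inj {suc i} {suc j} e = cong suc (E.emb-inj (FinP.suc-injective e))
  ... | no ¬p | rest | split = record
    { size = E.size
    ; emb = suc ∘ E.emb
    ; emb∈ = E.emb∈
    ; idx = λ { zero p → ⊥-elim (¬p p) ; (suc x) px → E.idx x px }
    ; emb-idx = λ { zero p → ⊥-elim (¬p p) ; (suc x) px → cong suc (E.emb-idx x px) }
    ; emb-inj = λ e → E.emb-inj (FinP.suc-injective e)
    ; sum-emb = λ f → trans (E.sum-emb (f ∘ suc)) (trans (sym (ℤP.+-identityˡ _)) (sym (split f)))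
    }
    where module E = Enumeration rest

  abstract
    -- Opaque, so that the recursion is never unfolded in the types of complements; the fields of
    -- the record say all that is used.
    enumerate : ∀ {n a} {P : Fin n → Set a} (d : ∀ x → Dec (P x)) → Enumeration d
    enumerate = enumeration

-- A ring solver with integer coefficients for an abstract commutative ring.

module RingNormalisation {c ℓ : Level} (R : CommutativeRing c ℓ) where

  open CommutativeRing R
  open import Algebra.Properties.Semiring.Mult semiring using (×-homo-+; ×1-homo-*; ×-congˡ) renaming (_×_ to _×ₙ_)
  open import Algebra.Properties.Ring ring using (-‿distribˡ-*; -‿distribʳ-*; -0#≈0#; -‿involutive)
  open import Algebra.Properties.AbelianGroup +-abelianGroup using (⁻¹-∙-comm)
  open import Algebra.Solver.CommutativeMonoid +-commutativeMonoid using (_⊕_; _⊜_) renaming (solve to solve+)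
  open SetoidReasoning setoid

  reduce : ℕ → ℕ → ℕ × ℕ
  reduce (suc a) (suc b) = reduce a b
  reduce a       b       = a , b

  -- Integer coefficients as reduced formal differences: over an abstract ring the solver can only
  -- cancel terms whose coefficients compute.
  Difference : RawRing _ _
  Difference = record
    { Carrier = ℕ × ℕ
    ; _≈_ = _≡_
    ; _+_ = λ { (a , b) (c , d) → reduce (a ℕ.+ c) (b ℕ.+ d) }
    ; _*_ = λ { (a , b) (c , d) → reduce (a ℕ.* c ℕ.+ b ℕ.* d) (a ℕ.* d ℕ.+ b ℕ.* c) }
    ; -_  = λ { (a , b) → b , a }
    ; 0#  = 0 , 0
    ; 1#  = 1 , 0
    }

  ι : ℕ → Carrier
  ι n = n ×ₙ 1#

  -- Special cases, so that the constants 0# and 1# are literally values of coefficients.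
  ⟦_⟧ᵈ : ℕ × ℕ → Carrier
  ⟦ 0 , 0 ⟧ᵈ = 0#
  ⟦ 1 , 0 ⟧ᵈ = 1#
  ⟦ a , b ⟧ᵈ = ι a - ι b

  ⟦⟧ᵈ≈ : ∀ a b → ⟦ a , b ⟧ᵈ ≈ ι a - ι b
  ⟦⟧ᵈ≈ 0             0       = sym (-‿inverseʳ 0#)
  ⟦⟧ᵈ≈ 1             0       = sym (trans (+-congˡ -0#≈0#) (trans (+-identityʳ _) (+-identityʳ 1#)))
  ⟦⟧ᵈ≈ (suc (suc _)) 0       = refl
  ⟦⟧ᵈ≈ 0             (suc _) = refl
  ⟦⟧ᵈ≈ 1             (suc _) = refl
  ⟦⟧ᵈ≈ (suc (suc _)) (suc _) = refl

  ⟦reduce⟧ : ∀ a b → ⟦ reduce a b ⟧ᵈ ≈ ι a - ι b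
  ⟦reduce⟧ zero    b       = ⟦⟧ᵈ≈ 0 b
  ⟦reduce⟧ (suc a) zero    = ⟦⟧ᵈ≈ (suc a) 0
  ⟦reduce⟧ (suc a) (suc b) = begin
    ⟦ reduce a b ⟧ᵈ            ≈⟨ ⟦reduce⟧ a b ⟩
    ι a - ι b                  ≈⟨ +-identityˡ _ ⟨
    0# + (ι a - ι b)           ≈⟨ +-congʳ (-‿inverseʳ 1#) ⟨
    (1# - 1#) + (ι a - ι b)    ≈⟨ solve+ 4 (λ x y z w → (x ⊕ y) ⊕ (z ⊕ w) ⊜ (x ⊕ z) ⊕ (y ⊕ w)) refl 1# (- 1#) (ι a) (- ι b) ⟩
    (1# + ι a) + (- 1# - ι b)  ≈⟨ +-congˡ (⁻¹-∙-comm 1# (ι b)) ⟩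
    (1# + ι a) - (1# + ι b)    ∎

  ι-*+* : ∀ a b c d → ι (a ℕ.* b ℕ.+ c ℕ.* d) ≈ ι a * ι b + ι c * ι d
  ι-*+* a b c d = trans (×-homo-+ 1# (a ℕ.* b) (c ℕ.* d)) (+-cong (×1-homo-* a b) (×1-homo-* c d))

  difference-* : ∀ x y z w → (x * z + y * w) - (x * w + y * z) ≈ (x - y) * (z - w)
  difference-* x y z w = sym (begin
    (x - y) * (z - w)
      ≈⟨ distribʳ (z - w) x (- y) ⟩
    x * (z - w) + - y * (z - w)
      ≈⟨ +-cong (distribˡ x z (- w)) (distribˡ (- y) z (- w)) ⟩
    (x * z + x * - w) + (- y * z + - y * - w)
      ≈⟨ +-cong (+-congˡ (sym (-‿distribʳ-* x w)))
                (+-cong (sym (-‿distribˡ-* y z))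
                  (trans (sym (-‿distribˡ-* y (- w))) (trans (-‿cong (sym (-‿distribʳ-* y w))) (-‿involutive _)))) ⟩
    (x * z + - (x * w)) + (- (y * z) + y * w)
      ≈⟨ solve+ 4 (λ a b c d → (a ⊕ b) ⊕ (c ⊕ d) ⊜ (a ⊕ d) ⊕ (b ⊕ c)) refl (x * z) (- (x * w)) (- (y * z)) (y * w) ⟩
    (x * z + y * w) + (- (x * w) + - (y * z))
      ≈⟨ +-congˡ (⁻¹-∙-comm (x * w) (y * z)) ⟩
    (x * z + y * w) - (x * w + y * z) ∎)

  difference⟶R : Difference -Raw-AlmostCommutative⟶ fromCommutativeRing R
  difference⟶R = record
    { ⟦_⟧    = ⟦_⟧ᵈ
    ; +-homo = λ { (a , b) (c , d) → begin
        ⟦ reduce (a ℕ.+ c) (b ℕ.+ d) ⟧ᵈ  ≈⟨ ⟦reduce⟧ (a ℕ.+ c) (b ℕ.+ d) ⟩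
        ι (a ℕ.+ c) - ι (b ℕ.+ d)        ≈⟨ +-cong (×-homo-+ 1# a c) (-‿cong (×-homo-+ 1# b d)) ⟩
        (ι a + ι c) - (ι b + ι d)        ≈⟨ +-congˡ (⁻¹-∙-comm (ι b) (ι d)) ⟨
        (ι a + ι c) + (- ι b + - ι d)    ≈⟨ solve+ 4 (λ x y z w → (x ⊕ y) ⊕ (z ⊕ w) ⊜ (x ⊕ z) ⊕ (y ⊕ w)) refl (ι a) (ι c) (- ι b) (- ι d) ⟩
        (ι a - ι b) + (ι c - ι d)        ≈⟨ +-cong (⟦⟧ᵈ≈ a b) (⟦⟧ᵈ≈ c d) ⟨
        ⟦ a , b ⟧ᵈ + ⟦ c , d ⟧ᵈ          ∎ }
    ; *-homo = λ { (a , b) (c , d) → begin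
        ⟦ reduce (a ℕ.* c ℕ.+ b ℕ.* d) (a ℕ.* d ℕ.+ b ℕ.* c) ⟧ᵈ  ≈⟨ ⟦reduce⟧ (a ℕ.* c ℕ.+ b ℕ.* d) (a ℕ.* d ℕ.+ b ℕ.* c) ⟩
        ι (a ℕ.* c ℕ.+ b ℕ.* d) - ι (a ℕ.* d ℕ.+ b ℕ.* c)        ≈⟨ +-cong (ι-*+* a c b d) (-‿cong (ι-*+* a d b c)) ⟩
        (ι a * ι c + ι b * ι d) - (ι a * ι d + ι b * ι c)        ≈⟨ difference-* (ι a) (ι b) (ι c) (ι d) ⟩
        (ι a - ι b) * (ι c - ι d)                                ≈⟨ *-cong (⟦⟧ᵈ≈ a b) (⟦⟧ᵈ≈ c d) ⟨
        ⟦ a , b ⟧ᵈ * ⟦ c , d ⟧ᵈ                                  ∎ }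
    ; -‿homo = λ { (a , b) → begin
        ⟦ b , a ⟧ᵈ       ≈⟨ ⟦⟧ᵈ≈ b a ⟩
        ι b - ι a        ≈⟨ +-comm (ι b) (- ι a) ⟩
        - ι a + ι b      ≈⟨ +-congˡ (-‿involutive (ι b)) ⟨
        - ι a + - - ι b  ≈⟨ ⁻¹-∙-comm (ι a) (- ι b) ⟩
        - (ι a - ι b)    ≈⟨ -‿cong (⟦⟧ᵈ≈ a b) ⟨
        - ⟦ a , b ⟧ᵈ     ∎ }
    ; 0-homo = refl
    ; 1-homo = refl
    }

  _≟ᵈ_ : ∀ x y → Maybe (⟦ x ⟧ᵈ ≈ ⟦ y ⟧ᵈ)
  (a , b) ≟ᵈ (c , d) with a ℕ.+ d ℕ.≟ c ℕ.+ b
  ... | no _ = nothing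
  ... | yes e = just (begin
      ⟦ a , b ⟧ᵈ                   ≈⟨ ⟦⟧ᵈ≈ a b ⟩
      ι a - ι b                    ≈⟨ +-identityʳ _ ⟨
      (ι a - ι b) + 0#             ≈⟨ +-congˡ (-‿inverseʳ (ι d)) ⟨
      (ι a - ι b) + (ι d - ι d)    ≈⟨ rearrange (ι a) (ι d) (- ι b) (- ι d) ⟩
      (ι a + ι d) + (- ι b - ι d)  ≈⟨ +-congʳ (trans (sym (×-homo-+ 1# a d)) (trans (×-congˡ e) (×-homo-+ 1# c b))) ⟩
      (ι c + ι b) + (- ι b - ι d)  ≈⟨ solve+ 4 (λ x y z w → (x ⊕ y) ⊕ (z ⊕ w) ⊜ (x ⊕ w) ⊕ (y ⊕ z)) refl (ι c) (ι b) (- ι b) (- ι d) ⟩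
      (ι c - ι d) + (ι b - ι b)    ≈⟨ +-congˡ (-‿inverseʳ (ι b)) ⟩
      (ι c - ι d) + 0#             ≈⟨ +-identityʳ _ ⟩
      ι c - ι d                    ≈⟨ ⟦⟧ᵈ≈ c d ⟨
      ⟦ c , d ⟧ᵈ                   ∎)
    where
    rearrange = solve+ 4 (λ x y z w → (x ⊕ z) ⊕ (y ⊕ w) ⊜ (x ⊕ y) ⊕ (z ⊕ w)) refl

  open RingSolver Difference (fromCommutativeRing R) difference⟶R _≟ᵈ_ public
    using (Polynomial; solve; con; _:+_; _:*_; :-_; _:-_; _:=_)

  one : ∀ {n} → Polynomial n
  one = con (1 , 0)

-- Additivity of the Frobenius power in characteristic p.

module FreshmansDream {c ℓ : Level} (R : CommutativeRing c ℓ) where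

  open import Data.Nat.Combinatorics using (_C_; nCn≡1; nCk≡n!/k![n-k]!; k![n∸k]!∣n!)

  prime∤! : ∀ {p} → Prime p → ∀ j → j ℕ.< p → ¬ p ∣ j !
  prime∤! isPrime zero j<p p∣ = ¬prime[1] (subst Prime (∣1⇒≡1 p∣) isPrime)
  prime∤! isPrime (suc j) j<p p∣ with euclidsLemma (suc j) (j !) isPrime p∣
  ... | inj₁ p∣j+1 = ℕP.<⇒≱ j<p (∣⇒≤ p∣j+1)
  ... | inj₂ p∣j! = prime∤! isPrime j (ℕP.<-trans (ℕP.n<1+n j) j<p) p∣j!

  -- p divides p! = (p C k) k! (p - k)!, but neither of the two factorials, whose factors are all
  -- smaller than p.
  prime∣C : ∀ {p} → Prime p → ∀ k → 0 ℕ.< k → k ℕ.< p → p ∣ p C k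
  prime∣C {suc p-1} isPrime k 0<k k<p
    with euclidsLemma (p C k) (k ! ℕ.* (p ∸ k) !) isPrime (subst (p ∣_) (≡.sym C*) (m∣m*n (p-1 !)))
    where
    p = suc p-1
    instance nz = k ℕP.!* (p ∸ k) !≢0
    C* : (p C k) ℕ.* (k ! ℕ.* (p ∸ k) !) ≡ p !
    C* = ≡.trans (cong (ℕ._* (k ! ℕ.* (p ∸ k) !)) (nCk≡n!/k![n-k]! (ℕP.<⇒≤ k<p))) (m/n*n≡m (k![n∸k]!∣n! (ℕP.<⇒≤ k<p)))
  ... | inj₁ p∣C = p∣C
  ... | inj₂ p∣k![p-k]! with euclidsLemma (k !) ((suc p-1 ∸ k) !) isPrime p∣k![p-k]!
  ... | inj₁ p∣k! = ⊥-elim (prime∤! isPrime k k<p p∣k!)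
  ... | inj₂ p∣[p-k]! = ⊥-elim (prime∤! isPrime (suc p-1 ∸ k) (ℕP.∸-monoʳ-< {suc p-1} {k} {0} 0<k (ℕP.<⇒≤ k<p)) p∣[p-k]!)

  open CommutativeRing R hiding (zero)
  open import Algebra.Properties.Semiring.Mult semiring using (×-assocˡ; ×-homo-1; ×-congʳ; ×-congˡ; ×-assoc-*) renaming (_×_ to _×ₙ_)
  open import Algebra.Properties.CommutativeSemiring.Exp commutativeSemiring
  open import Algebra.Properties.CommutativeSemiring.Binomial commutativeSemiring using (binomialTerm; theorem)
  open import Algebra.Properties.Semiring.Sum semiring using (sum; sum-init-last; sum-cong-≋; sum-replicate-zero)
  open SetoidReasoning setoid

  module _ {p : ℕ} (isPrime : Prime p) (p×1 : p ×ₙ 1# ≈ 0#) where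

    multiple×≈0 : ∀ {n} → p ∣ n → ∀ x → n ×ₙ x ≈ 0#
    multiple×≈0 (divides m ≡.refl) x = begin
      (m ℕ.* p) ×ₙ x        ≈⟨ ×-assocˡ x m p ⟨
      m ×ₙ (p ×ₙ x)         ≈⟨ ×-congʳ m (×-congʳ p (*-identityˡ x)) ⟨
      m ×ₙ (p ×ₙ (1# * x))  ≈⟨ ×-congʳ m (×-assoc-* p 1# x) ⟨
      m ×ₙ ((p ×ₙ 1#) * x)  ≈⟨ ×-congʳ m (trans (*-congʳ p×1) (zeroˡ x)) ⟩
      m ×ₙ 0#               ≈⟨ ×0 m ⟩
      0#                    ∎
      where
      ×0 : ∀ m → m ×ₙ 0# ≈ 0#
      ×0 zero = refl
      ×0 (suc m) = trans (+-identityˡ _) (×0 m)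

    freshman : ∀ x y → (x + y) ^ p ≈ x ^ p + y ^ p
    -- The exponent is generalised to an `n` equal to `p`, so that matching exposes the successor
    -- needed to split off the last binomial term.
    freshman x y = go p ≡.refl
      where
      go : ∀ n → p ≡ n → (x + y) ^ n ≈ x ^ n + y ^ n
      go zero e = ⊥-elim (ℕ.≢-nonZero⁻¹ p {{prime⇒nonZero isPrime}} e)
      go (suc n) ≡.refl = begin
        (x + y) ^ suc n               ≈⟨ theorem (suc n) x y ⟩
        t zero + sum (t ∘ suc)        ≈⟨ +-congˡ (sum-init-last (t ∘ suc)) ⟩
        t zero + (sum (t ∘ suc ∘ inject₁) + t (fromℕ (suc n)))
          ≈⟨ +-cong (trans (×-homo-1 _) (*-identityˡ _)) (+-cong (trans (sum-cong-≋ middle) (sum-replicate-zero n)) top) ⟩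
        y ^ suc n + (0# + x ^ suc n)  ≈⟨ +-congˡ (+-identityˡ _) ⟩
        y ^ suc n + x ^ suc n         ≈⟨ +-comm _ _ ⟩
        x ^ suc n + y ^ suc n         ∎
        where
        t = binomialTerm x y (suc n)
        middle : ∀ i → t (suc (inject₁ i)) ≈ 0#
        middle i = multiple×≈0 (prime∣C isPrime (suc (toℕ (inject₁ i))) (s≤s z≤n)
          (s≤s (subst (ℕ._< n) (≡.sym (FinP.toℕ-inject₁ i)) (FinP.toℕ<n i)))) _
        top : t (fromℕ (suc n)) ≈ x ^ suc n
        top = begin
          (suc n C toℕ (fromℕ (suc n))) ×ₙ (x ^ toℕ (fromℕ (suc n)) * y ^ (suc n ∸ toℕ (fromℕ (suc n))))
            ≡⟨ cong (λ k → (suc n C k) ×ₙ (x ^ k * y ^ (suc n ∸ k))) (FinP.toℕ-fromℕ (suc n)) ⟩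
          (suc n C suc n) ×ₙ (x ^ suc n * y ^ (suc n ∸ suc n))
            ≡⟨ ≡.cong₂ (λ k l → k ×ₙ (x ^ suc n * y ^ l)) (nCn≡1 (suc n)) (ℕP.n∸n≡0 (suc n)) ⟩
          1 ×ₙ (x ^ suc n * 1#)
            ≈⟨ trans (×-homo-1 _) (*-identityʳ _) ⟩
          x ^ suc n ∎

    freshman-iterated : ∀ k x y → (x + y) ^ (p ℕ.^ k) ≈ x ^ (p ℕ.^ k) + y ^ (p ℕ.^ k)
    freshman-iterated zero x y = trans (*-identityʳ _) (sym (+-cong (*-identityʳ x) (*-identityʳ y)))
    freshman-iterated (suc k) x y = begin
      (x + y) ^ (p ℕ.* p ℕ.^ k)                  ≈⟨ ^-assocʳ (x + y) p (p ℕ.^ k) ⟨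
      ((x + y) ^ p) ^ (p ℕ.^ k)                  ≈⟨ ^-congˡ (p ℕ.^ k) (freshman x y) ⟩
      (x ^ p + y ^ p) ^ (p ℕ.^ k)                ≈⟨ freshman-iterated k (x ^ p) (y ^ p) ⟩
      (x ^ p) ^ (p ℕ.^ k) + (y ^ p) ^ (p ℕ.^ k)  ≈⟨ +-cong (^-assocʳ x p (p ℕ.^ k)) (^-assocʳ y p (p ℕ.^ k)) ⟩
      x ^ (p ℕ.* p ℕ.^ k) + y ^ (p ℕ.* p ℕ.^ k)  ∎

-- From Boolean tests and lists to propositions and indexed sums.

module ListCounting where

  open IntegerSums
  open ≡ using (refl; sym; trans)

  ∧⇒ : ∀ {x y} → x ∧ y ≡ true → x ≡ true × y ≡ true
  ∧⇒ {true} {true} _ = refl , refl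

  true≢false : ¬ true ≡ false
  true≢false ()

  does⇒ : ∀ {a} {P : Set a} (d : Dec P) → does d ≡ true → P
  does⇒ (yes p) _ = p

  ⇒does : ∀ {a} {P : Set a} (d : Dec P) → P → does d ≡ true
  ⇒does (yes _) _ = refl
  ⇒does (no ¬p) p = ⊥-elim (¬p p)

  ⇒∧ : ∀ {x y} → x ≡ true → y ≡ true → x ∧ y ≡ true
  ⇒∧ refl refl = refl

  foldr-∧⇒ : ∀ {n} (p : Fin n → Bool) → VF.foldr _∧_ true p ≡ true → ∀ i → p i ≡ true
  foldr-∧⇒ p e zero    = proj₁ (∧⇒ e)
  foldr-∧⇒ p e (suc i) = foldr-∧⇒ (p ∘ suc) (proj₂ (∧⇒ {p zero} e)) i

  ⇒foldr-∧ : ∀ {n} (p : Fin n → Bool) → (∀ i → p i ≡ true) → VF.foldr _∧_ true p ≡ true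
  ⇒foldr-∧ {zero}  p e = refl
  ⇒foldr-∧ {suc n} p e = ⇒∧ (e zero) (⇒foldr-∧ (p ∘ suc) (e ∘ suc))

  module _ {a} {A : Set a} where

    allᵇ⇒ : ∀ (p : A → Bool) xs → allᵇ p xs ≡ true → All (λ x → p x ≡ true) xs
    allᵇ⇒ p [] e = []
    allᵇ⇒ p (x ∷ xs) e = proj₁ (∧⇒ e) ∷ allᵇ⇒ p xs (proj₂ (∧⇒ {p x} e))

    ⇒allᵇ : ∀ (p : A → Bool) xs → (∀ x → p x ≡ true) → allᵇ p xs ≡ true
    ⇒allᵇ p [] e = refl
    ⇒allᵇ p (x ∷ xs) e = ⇒∧ (e x) (⇒allᵇ p xs e)

    anyᵇ⇒ : ∀ (p : A → Bool) xs → anyᵇ p xs ≡ true → ∃ λ x → p x ≡ true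
    anyᵇ⇒ p (x ∷ xs) e with p x in eq
    ... | true = x , eq
    ... | false = anyᵇ⇒ p xs e

    ⇒anyᵇ : ∀ (p : A → Bool) xs → Any (λ x → p x ≡ true) xs → anyᵇ p xs ≡ true
    ⇒anyᵇ p (x ∷ xs) (here e) rewrite e = refl
    ⇒anyᵇ p (x ∷ xs) (there h) with p x
    ... | true = refl
    ... | false = ⇒anyᵇ p xs h

    filterᵇ-true : ∀ (p : A → Bool) xs → All (λ x → p x ≡ true) (filterᵇ p xs)
    filterᵇ-true p [] = []
    filterᵇ-true p (x ∷ xs) with p x in eq
    ... | true = eq ∷ filterᵇ-true p xs
    ... | false = filterᵇ-true p xs

    filterᵇ-all : ∀ {r} {Q : A → Set r} (p : A → Bool) xs → All Q xs → All Q (filterᵇ p xs)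
    filterᵇ-all p [] [] = []
    filterᵇ-all p (x ∷ xs) (q ∷ qs) with p x
    ... | true = q ∷ filterᵇ-all p xs qs
    ... | false = filterᵇ-all p xs qs

    filterᵇ-any : ∀ {r} {Q : A → Set r} (p : A → Bool) xs → (∀ x → Q x → p x ≡ true) → Any Q xs → Any Q (filterᵇ p xs)
    filterᵇ-any p (x ∷ xs) imp (here q) rewrite imp x q = here q
    filterᵇ-any p (x ∷ xs) imp (there h) with p x
    ... | true = there (filterᵇ-any p xs imp h)
    ... | false = filterᵇ-any p xs imp h

    filterᵇ-pairs : ∀ {r} {R : A → A → Set r} (p : A → Bool) xs → AllPairs R xs → AllPairs R (filterᵇ p xs)
    filterᵇ-pairs p [] [] = []
    filterᵇ-pairs p (x ∷ xs) (r ∷ rs) with p x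
    ... | true = filterᵇ-all p xs r ∷ filterᵇ-pairs p xs rs
    ... | false = filterᵇ-pairs p xs rs

    sumList : (A → ℤ) → List A → ℤ
    sumList f [] = 0ℤ
    sumList f (x ∷ xs) = f x ℤ.+ sumList f xs

    sumList≡sum : ∀ f xs → sumList f xs ≡ sum (λ i → f (lookup xs i))
    sumList≡sum f [] = sym (sum-empty _)
    sumList≡sum f (x ∷ xs) = trans (cong (λ z → f x ℤ.+ z) (sumList≡sum f xs)) (sym (sum-suc _))

    sumList-++ : ∀ f xs ys → sumList f (xs ++ ys) ≡ sumList f xs ℤ.+ sumList f ys
    sumList-++ f [] ys = sym (ℤP.+-identityˡ _)
    sumList-++ f (x ∷ xs) ys = trans (cong (λ z → f x ℤ.+ z) (sumList-++ f xs ys)) (sym (ℤP.+-assoc (f x) _ _))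

    length-filterᵇ : ∀ (p : A → Bool) xs → ℤ.+ length (filterᵇ p xs) ≡ sumList (λ x → if p x then 1ℤ else 0ℤ) xs
    length-filterᵇ p [] = refl
    length-filterᵇ p (x ∷ xs) with p x
    ... | true = cong (λ z → 1ℤ ℤ.+ z) (length-filterᵇ p xs)
    ... | false = trans (length-filterᵇ p xs) (sym (ℤP.+-identityˡ _))

  lookup-injective : ∀ {a r} {A : Set a} {_~_ : A → A → Set r} → (∀ {x y} → x ~ y → y ~ x) →
    ∀ {xs : List A} → AllPairs (λ x y → ¬ (x ~ y)) xs → ∀ i j → lookup xs i ~ lookup xs j → i ≡ j
  lookup-injective s (px ∷ pxs) zero zero e = refl
  lookup-injective s (px ∷ pxs) zero (suc j) e = ⊥-elim (All.lookup px (∈-lookup j) e)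
  lookup-injective s (px ∷ pxs) (suc i) zero e = ⊥-elim (All.lookup px (∈-lookup i) (s e))
  lookup-injective s (px ∷ pxs) (suc i) (suc j) e = cong suc (lookup-injective s pxs i j e)

  sumList-map : ∀ {a b} {A : Set a} {B : Set b} (f : B → ℤ) (h : A → B) xs → sumList f (map h xs) ≡ sumList (f ∘ h) xs
  sumList-map f h [] = refl
  sumList-map f h (x ∷ xs) = cong (λ z → f (h x) ℤ.+ z) (sumList-map f h xs)

  sumList-concatMap : ∀ {a b} {A : Set a} {B : Set b} (f : B → ℤ) (h : A → List B) xs →
                      sumList f (concatMap h xs) ≡ sumList (λ x → sumList f (h x)) xs
  sumList-concatMap f h [] = refl
  sumList-concatMap f h (x ∷ xs) = trans (sumList-++ f (h x) _) (cong (λ z → sumList f (h x) ℤ.+ z) (sumList-concatMap f h xs))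

  length-concatMap : ∀ {a b} {A : Set a} {B : Set b} (h : A → List B) n xs → (∀ x → length (h x) ≡ n) →
                     length (concatMap h xs) ≡ length xs ℕ.* n
  length-concatMap h n [] e = refl
  length-concatMap h n (x ∷ xs) e = trans (ListP.length-++ (h x)) (cong₂ ℕ._+_ (e x) (length-concatMap h n xs e))

  length-allFuns : ∀ {a} {A : Set a} (xs : List A) n → length (allFuns xs n) ≡ length xs ℕ.^ n
  length-allFuns xs zero    = refl
  length-allFuns xs (suc n) = length-concatMap _ (length xs ℕ.^ n) xs
    (λ x → trans (ListP.length-map _ (allFuns xs n)) (length-allFuns xs n))

  module _ {a r} {A : Set a} {_~_ : A → A → Set r} where

    Pointwise : ∀ {n} → (Fin n → A) → (Fin n → A) → Set r
    Pointwise f g = ∀ i → f i ~ g i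

    -- The relation is arbitrary, so a first application (to `_≈_`) covers vectors and a second one
    -- (to pointwise equality of rows) covers matrices. The same holds for `allFuns-distinct`.
    allFuns-complete : ∀ {xs} → (∀ x → Any (x ~_) xs) → ∀ n (f : Fin n → A) → Any (Pointwise f) (allFuns xs n)
    allFuns-complete comp zero f = here λ ()
    allFuns-complete comp (suc n) f = AnyP.concatMap⁺ _ (Any.map
      (λ {x} fx → AnyP.map⁺ (Any.map (λ fg → λ { zero → fx ; (suc i) → fg i }) (allFuns-complete comp n (f ∘ suc))))
      (comp (f zero)))

    allFuns-distinct : ∀ {xs} → AllPairs (λ x y → ¬ (x ~ y)) xs → ∀ n → AllPairs (λ f g → ¬ Pointwise f g) (allFuns xs n)
    allFuns-distinct dist zero = [] ∷ []
    allFuns-distinct {xs} dist (suc n) = AllPairsP.concat⁺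
      (AllP.map⁺ (All.tabulate λ _ → AllPairsP.map⁺ (AllPairs.map (λ ne e → ne (e ∘ suc)) (allFuns-distinct dist n))))
      (AllPairsP.map⁺ (AllPairs.map (λ ne → AllP.map⁺ (All.tabulate λ _ → AllP.map⁺ (All.tabulate λ _ e → ne (e zero)))) dist))

-- Arithmetic in a finite field, conjugations, and the substitute for a character.

module FieldArithmetic {c ℓ : Level} (K : FiniteField c ℓ) where

  open IntegerSums
  open ListCounting using (lookup-injective)
  open FiniteField K hiding (zero)
  open RingNormalisation cring

  module ≈-Reasoning = SetoidReasoning setoid

  +-cancel : ∀ {x y} → x + y ≈ 0# → x ≈ - y
  +-cancel {x} {y} e = trans (solve 2 (λ x y → x := (x :+ y) :- y) refl x y) (trans (+-congʳ e) (+-identityˡ _))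

  -≈0 : ∀ {x y} → x - y ≈ 0# → x ≈ y
  -≈0 {x} {y} e = trans (solve 2 (λ x y → x := (x :- y) :+ y) refl x y) (trans (+-congʳ e) (+-identityˡ _))

  ≈⇒-≈0 : ∀ {x y} → x ≈ y → x - y ≈ 0#
  ≈⇒-≈0 {x} {y} e = trans (+-congʳ e) (-‿inverseʳ y)

  *≈0⇒ : ∀ {x y} → ¬ x ≈ 0# → x * y ≈ 0# → y ≈ 0#
  *≈0⇒ {x} {y} nz e with inverse x nz
  ... | x⁻¹ , inv = begin
    y              ≈⟨ *-identityˡ y ⟨
    1# * y         ≈⟨ *-congʳ inv ⟨
    (x * x⁻¹) * y  ≈⟨ solve 3 (λ x i y → (x :* i) :* y := i :* (x :* y)) refl x x⁻¹ y ⟩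
    x⁻¹ * (x * y)  ≈⟨ *-congˡ e ⟩
    x⁻¹ * 0#       ≈⟨ zeroʳ _ ⟩
    0#             ∎
    where open ≈-Reasoning

  *-≉0 : ∀ {x y} → ¬ x ≈ 0# → ¬ y ≈ 0# → ¬ x * y ≈ 0#
  *-≉0 nx ny e = ny (*≈0⇒ nx e)

  *-cancelˡ-≉0 : ∀ {x y z} → ¬ x ≈ 0# → x * y ≈ x * z → y ≈ z
  *-cancelˡ-≉0 {x} {y} {z} nz e = -≈0 (*≈0⇒ nz
    (trans (solve 3 (λ x y z → x :* (y :- z) := x :* y :- x :* z) refl x y z) (≈⇒-≈0 e)))

  scalar : Fin card → Carrier
  scalar = lookup elements

  scalar-index : Carrier → Fin card
  scalar-index x = index (complete x)

  scalar-scalar-index : ∀ x → scalar (scalar-index x) ≈ x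
  scalar-scalar-index x = sym (AnyP.lookup-index (complete x))

  scalar-injective : ∀ {i j} → scalar i ≈ scalar j → i ≡ j
  scalar-injective {i} {j} = lookup-injective sym distinct i j

  -- Everything that the geometry uses of x ↦ x^q on the field with q² elements: an involutive
  -- automorphism, an element `τ` of trace 1, and q + 1 solutions of the norm equation over each
  -- nonzero fixed element.
  record Conjugation (q : ℕ) : Set (c ⊔ ℓ) where
    field
      σ      : Carrier → Carrier
      σ-cong : ∀ {x y} → x ≈ y → σ x ≈ σ y
      σ-+    : ∀ x y → σ (x + y) ≈ σ x + σ y
      σ-*    : ∀ x y → σ (x * y) ≈ σ x * σ y
      σ-0    : σ 0# ≈ 0#
      σ-1    : σ 1# ≈ 1#
      σσ     : ∀ x → σ (σ x) ≈ x
      τ      : Carrier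
      τ+στ   : τ + σ τ ≈ 1#
      norm-fibre : ∀ b → σ b ≈ b → ¬ b ≈ 0# → count (λ i → (scalar i * σ (scalar i)) ≟ b) ≡ ℤ.+ suc q
      card≡  : card ≡ q ℕ.* q

    σ-neg : ∀ x → σ (- x) ≈ - σ x
    σ-neg x = +-cancel (trans (sym (σ-+ (- x) x)) (trans (σ-cong (-‿inverseˡ x)) σ-0))

    σ-≉0 : ∀ {x} → ¬ x ≈ 0# → ¬ σ x ≈ 0#
    σ-≉0 {x} nz e = nz (trans (sym (σσ x)) (trans (σ-cong e) σ-0))

  -- 0 and 1 are told apart by χ, whose values on a coset of a nonzero additive functional sum to 0;
  -- it plays the role of a nontrivial additive character.
  χ : Carrier → ℤ
  χ a = ⟦ a ≟ 0# ⟧ ℤ.- ⟦ a ≟ 1# ⟧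

  ⟦≟⟧-cong : ∀ {x x' y y'} → x ≈ x' → y ≈ y' → ⟦ x ≟ y ⟧ ≡ ⟦ x' ≟ y' ⟧
  ⟦≟⟧-cong {x} {x'} {y} {y'} e f = ⟦cong⟧ (x ≟ y) (x' ≟ y')
    (λ h → trans (sym e) (trans h f)) (λ h → trans e (trans h (sym f)))

  χ-cong : ∀ {a b} → a ≈ b → χ a ≡ χ b
  χ-cong e = cong₂ ℤ._-_ (⟦≟⟧-cong e refl) (⟦≟⟧-cong e refl)

  χ0 : χ 0# ≡ 1ℤ
  χ0 = cong₂ ℤ._-_ (⟦yes⟧ (0# ≟ 0#) refl) (⟦no⟧ (0# ≟ 1#) (1≉0 ∘ sym))

-- The q-th power map on the field with q² elements is a conjugation.

module FiniteFields {c ℓ : Level} (K : FiniteField c ℓ) where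

  open IntegerSums
  open FiniteField K hiding (zero)
  open RingNormalisation cring
  open FieldArithmetic K
  open import Algebra.Properties.CommutativeSemiring.Exp commutativeSemiring
  open import Algebra.Properties.Semiring.Mult semiring using (×1-homo-*) renaming (_×_ to _×ₙ_)
  import Algebra.Properties.CommutativeMonoid.Sum as MonoidSum

  private
    module Add = MonoidSum +-commutativeMonoid
    module Mul = MonoidSum *-commutativeMonoid

    -- `f` permutes the scalars, with inverse `g`. The monoid is arbitrary because the addition is
    -- needed for `card×1≈0` and the multiplication for `fermat`.
    sum-scalars : ∀ {a b} (M : CommutativeMonoid a b) → let module M = CommutativeMonoid M in
      (t : Carrier → M.Carrier) → (∀ {x y} → x ≈ y → t x M.≈ t y) →
      (f g : Carrier → Carrier) → (∀ {x y} → x ≈ y → f x ≈ f y) → (∀ {x y} → x ≈ y → g x ≈ g y) →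
      (∀ x → f (g x) ≈ x) → (∀ x → g (f x) ≈ x) →
      MonoidSum.sum M (t ∘ scalar) M.≈ MonoidSum.sum M (t ∘ f ∘ scalar)
    sum-scalars M t t-cong f g f-cong g-cong fg gf = M.trans (MonoidSum.sum-permute M (t ∘ scalar)
        (permutation (λ i → scalar-index (f (scalar i))) (λ i → scalar-index (g (scalar i))) (inverse′ f g f-cong fg) (inverse′ g f g-cong gf)))
        (MonoidSum.sum-cong-≋ M {x = λ i → t (scalar (scalar-index (f (scalar i))))} {y = t ∘ f ∘ scalar} (λ i → t-cong (scalar-scalar-index _)))
      where
      module M = CommutativeMonoid M
      inverse′ : ∀ f g → (∀ {x y} → x ≈ y → f x ≈ f y) → (∀ x → f (g x) ≈ x) → ∀ i →
                 scalar-index (f (scalar (scalar-index (g (scalar i))))) ≡ i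
      inverse′ f g f-cong fg i = scalar-injective (trans (scalar-scalar-index _) (trans (f-cong (scalar-scalar-index _)) (fg _)))

    product-cong : ∀ {n} (f g : Fin n → Carrier) → (∀ i → f i ≈ g i) → Mul.sum f ≈ Mul.sum g
    product-cong f g e = Mul.sum-cong-≋ {x = f} {y = g} e

    product-≉0 : ∀ {n} (f : Fin n → Carrier) → (∀ i → ¬ f i ≈ 0#) → ¬ Mul.sum f ≈ 0#
    product-≉0 {zero} f nz = 1≉0
    product-≉0 {suc n} f nz = *-≉0 (nz zero) (product-≉0 (f ∘ suc) (nz ∘ suc))

    product-δ : ∀ {n} (a : Fin n) (f : Fin n → Carrier) x → f a ≈ x → (∀ i → ¬ i ≡ a → f i ≈ 1#) → Mul.sum f ≈ x
    product-δ {suc n} zero f x fa f1 = trans (*-cong fa (trans (product-cong _ (λ _ → 1#) (λ i → f1 (suc i) λ ())) (ones n))) (*-identityʳ x)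
      where
      ones : ∀ n → Mul.sum {n} (λ _ → 1#) ≈ 1#
      ones = Mul.sum-replicate-zero
    product-δ {suc n} (suc a) f x fa f1 = trans (*-congʳ (f1 zero λ ()))
      (trans (*-identityˡ _) (product-δ a (f ∘ suc) x fa (λ i i≢a → f1 (suc i) (i≢a ∘ FinP.suc-injective))))

  -- Adding 1 permutes the field, so the sum of all elements equals itself plus `card` copies of 1.
  card×1≈0 : card ×ₙ 1# ≈ 0#
  card×1≈0 = begin
    card ×ₙ 1#                                   ≈⟨ solve 2 (λ s c → c := (s :+ c) :- s) refl total _ ⟩
    (total + card ×ₙ 1#) - total                 ≈⟨ +-congʳ (+-congˡ (Add.sum-replicate card)) ⟨
    (total + Add.sum {card} (λ _ → 1#)) - total  ≈⟨ +-congʳ (Add.∑-distrib-+ scalar (λ _ → 1#)) ⟨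
    Add.sum (λ i → scalar i + 1#) - total        ≈⟨ ≈⇒-≈0 (sym (sum-scalars +-commutativeMonoid id id (_+ 1#) (_- 1#) +-congʳ +-congʳ
                                                             (solve 1 (λ x → (x :- one) :+ one := x) refl) (solve 1 (λ x → (x :+ one) :- one := x) refl))) ⟩
    0#                                           ∎
    where
    open ≈-Reasoning
    total = Add.sum scalar

  unless-0 : Carrier → Carrier → Carrier
  unless-0 x y with y ≟ 0#
  ... | yes _ = 1#
  ... | no _ = x

  unless-0-cong : ∀ {x x' y y'} → x ≈ x' → y ≈ y' → unless-0 x y ≈ unless-0 x' y'
  unless-0-cong {y = y} {y'} ex ey with y ≟ 0# | y' ≟ 0#
  ... | yes _ | yes _ = refl
  ... | no _  | no _  = ex
  ... | yes z | no nz = ⊥-elim (nz (trans (sym ey) z))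
  ... | no nz | yes z = ⊥-elim (nz (trans ey z))

  -- The product of the nonzero elements is unchanged when each is multiplied by x; the factor 1#
  -- in place of the zero element is compensated by at-0.
  fermat : ∀ x → x ^ card ≈ x
  fermat x with x ≟ 0#
  ... | yes x0 = trans (^-congˡ card x0) (trans (0^ card (scalar-index 0#)) (sym x0))
    where
    0^ : ∀ n → Fin n → 0# ^ n ≈ 0#
    0^ (suc n) _ = zeroˡ _
  ... | no x≉0 = begin
    x ^ card                      ≈⟨ Mul.sum-replicate card ⟨
    Mul.sum {card} (λ _ → x)      ≈⟨ product-cong (λ _ → x) (λ i → k i * at-0 i) (λ i → sym (split i)) ⟩
    Mul.sum (λ i → k i * at-0 i)  ≈⟨ Mul.∑-distrib-+ k at-0 ⟩
    Mul.sum k * Mul.sum at-0      ≈⟨ *-cong Πk≈1 (product-δ (scalar-index 0#) at-0 x at-0-0 at-0-1) ⟩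
    1# * x                        ≈⟨ *-identityˡ x ⟩
    x                             ∎
    where
    open ≈-Reasoning
    x⁻¹ = proj₁ (inverse x x≉0)
    h k at-0 : Fin card → Carrier
    h i = unless-0 (scalar i) (scalar i)
    k i = unless-0 x (scalar i)
    at-0 i with scalar i ≟ 0#
    ... | yes _ = x
    ... | no _ = 1#
    split : ∀ i → k i * at-0 i ≈ x
    split i with scalar i ≟ 0#
    ... | yes _ = *-identityˡ x
    ... | no _ = *-identityʳ x
    at-0-0 : at-0 (scalar-index 0#) ≈ x
    at-0-0 with scalar (scalar-index 0#) ≟ 0#
    ... | yes _ = refl
    ... | no nz = ⊥-elim (nz (scalar-scalar-index 0#))
    at-0-1 : ∀ i → ¬ i ≡ scalar-index 0# → at-0 i ≈ 1#
    at-0-1 i ne with scalar i ≟ 0#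
    ... | yes z = ⊥-elim (ne (scalar-injective (trans z (sym (scalar-scalar-index 0#)))))
    ... | no _ = refl
    h≉0 : ∀ i → ¬ h i ≈ 0#
    h≉0 i with scalar i ≟ 0#
    ... | yes _ = 1≉0
    ... | no nz = nz
    scaled : ∀ y → unless-0 (x * y) (x * y) ≈ unless-0 x y * unless-0 y y
    scaled y with y ≟ 0# | (x * y) ≟ 0#
    ... | yes _ | yes _ = sym (*-identityˡ 1#)
    ... | no _  | no _  = refl
    ... | yes z | no nz = ⊥-elim (nz (trans (*-congˡ z) (zeroʳ x)))
    ... | no nz | yes z = ⊥-elim (nz (*≈0⇒ x≉0 z))
    cancel-x : ∀ y → x * (x⁻¹ * y) ≈ y
    cancel-x y = trans (sym (*-assoc _ _ _)) (trans (*-congʳ (proj₂ (inverse x x≉0))) (*-identityˡ y))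
    cancel-x′ : ∀ y → x⁻¹ * (x * y) ≈ y
    cancel-x′ y = trans (sym (*-assoc _ _ _)) (trans (*-congʳ (trans (*-comm _ x) (proj₂ (inverse x x≉0)))) (*-identityˡ y))
    Πk≈1 : Mul.sum k ≈ 1#
    Πk≈1 = *-cancelˡ-≉0 (product-≉0 h h≉0) (begin
      Mul.sum h * Mul.sum k      ≈⟨ *-comm _ _ ⟩
      Mul.sum k * Mul.sum h      ≈⟨ Mul.∑-distrib-+ k h ⟨
      Mul.sum (λ i → k i * h i)  ≈⟨ product-cong (λ i → unless-0 (x * scalar i) (x * scalar i)) (λ i → k i * h i) (λ i → scaled (scalar i)) ⟨
      Mul.sum (λ i → unless-0 (x * scalar i) (x * scalar i))
        ≈⟨ sum-scalars *-commutativeMonoid (λ y → unless-0 y y) (λ e → unless-0-cong e e) (x *_) (x⁻¹ *_) *-congˡ *-congˡ cancel-x cancel-x′ ⟨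
      Mul.sum h                  ≈⟨ *-identityʳ _ ⟨
      Mul.sum h * 1#             ∎)

  -- A polynomial function together with a Horner scheme for it; the leading coefficient 1 is what
  -- excludes the zero polynomial in the bound on roots.
  data Monic : ℕ → (Carrier → Carrier) → Set (c ⊔ ℓ) where
    const : ∀ {f} → (∀ x → f x ≈ 1#) → Monic 0 f
    horner : ∀ {n f g} a → Monic n g → (∀ x → f x ≈ a + x * g x) → Monic (suc n) f

  -- The shape f + k g with deg g one less than deg f is the one that synthetic division produces in
  -- `monic-quotient`.
  monic-+ : ∀ {n f g} k → Monic (suc n) f → Monic n g → Monic (suc n) (λ x → f x + k * g x)
  monic-+ k (horner a mf ef) (const eg) = horner (a + k) mf λ x →
    trans (+-cong (ef x) (trans (*-congˡ (eg x)) (*-identityʳ k)))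
      (solve 4 (λ a x f k → (a :+ x :* f) :+ k := (a :+ k) :+ x :* f) refl a x _ k)
  monic-+ k (horner a mf ef) (horner b mg eg) = horner (a + k * b) (monic-+ k mf mg) λ x →
    trans (+-cong (ef x) (*-congˡ (eg x)))
      (solve 6 (λ a x f k b g → (a :+ x :* f) :+ k :* (b :+ x :* g) := (a :+ k :* b) :+ x :* (f :+ k :* g)) refl a x _ k b _)

  -- Synthetic division: if f(x) = a + x g(x) and h is the quotient of g by x - r, then g + r h is
  -- the quotient of f.
  monic-quotient : ∀ {n f} → Monic (suc n) f → ∀ r → Σ (Carrier → Carrier) λ g → Monic n g × (∀ x → f x ≈ f r + (x - r) * g x)
  monic-quotient (horner {f = f} {g} a (const eg) ef) r = (λ _ → 1#) , const (λ _ → refl) , λ x → trans (ef x)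
    (trans (+-congˡ (*-congˡ (eg x))) (trans (solve 3 (λ a x r → a :+ x :* one := (a :+ r :* one) :+ (x :- r) :* one) refl a x r)
      (+-congʳ (sym (trans (ef r) (+-congˡ (*-congˡ (eg r))))))))
  monic-quotient (horner {f = f} {g} a mg@(horner _ _ _) ef) r with monic-quotient mg r
  ... | h , mh , eh = (λ x → g x + r * h x) , monic-+ r mg mh , λ x → begin
    f x                                        ≈⟨ ef x ⟩
    a + x * g x                                ≈⟨ solve 4 (λ a x g r → a :+ x :* g := (a :+ (x :- r) :* g) :+ r :* g) refl a x (g x) r ⟩
    (a + (x - r) * g x) + r * g x              ≈⟨ +-congˡ (*-congˡ (eh x)) ⟩
    (a + (x - r) * g x) + r * (g r + (x - r) * h x)
      ≈⟨ solve 6 (λ a x r g G h → (a :+ (x :- r) :* g) :+ r :* (G :+ (x :- r) :* h) := (a :+ r :* G) :+ (x :- r) :* (g :+ r :* h)) refl a x r (g x) (g r) (h x) ⟩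
    (a + r * g r) + (x - r) * (g x + r * h x)  ≈⟨ +-congʳ (ef r) ⟨
    f r + (x - r) * (g x + r * h x)            ∎
    where open ≈-Reasoning

  -- Once a root is divided out, every other root is a root of the quotient, since a field has no
  -- zero divisors.
  #roots≤ : ∀ {n f} → Monic n f → count (λ i → f (scalar i) ≟ 0#) ℤ.≤ ℤ.+ n
  #roots≤ {f = f} (const e) = ℤP.≤-reflexive (sum-zero _ (λ i → ⟦no⟧ (f (scalar i) ≟ 0#) (λ z → 1≉0 (trans (sym (e _)) z))))
  #roots≤ {suc n} {f} mf with FinP.any? (λ i → f (scalar i) ≟ 0#)
  ... | no none = ℤP.≤-trans (ℤP.≤-reflexive (sum-zero _ (λ i → ⟦no⟧ (f (scalar i) ≟ 0#) (λ z → none (i , z))))) (ℤ.+≤+ ℕ.z≤n)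
  ... | yes (j , fj) with monic-quotient mf (scalar j)
  ... | g , mg , eg = ℤP.≤-trans (sum-mono _ _ root) (ℤP.≤-trans
        (ℤP.≤-reflexive (≡.trans (sum-+ _ _) (cong (ℤ._+ count (λ i → g (scalar i) ≟ 0#))
           (≡.trans (sum-cong (λ i → ≡.sym (ℤP.*-identityʳ ⟦ i Fin.≟ j ⟧))) (sum-δ j (λ _ → 1ℤ))))))
        (ℤP.+-monoʳ-≤ 1ℤ (#roots≤ mg)))
    where
    root : ∀ i → ⟦ f (scalar i) ≟ 0# ⟧ ℤ.≤ ⟦ i Fin.≟ j ⟧ ℤ.+ ⟦ g (scalar i) ≟ 0# ⟧
    root i with i Fin.≟ j
    ... | yes _ = ℤP.≤-trans (⟦⟧-mono (f (scalar i) ≟ 0#) (yes ≡.refl) (λ _ → ≡.refl {x = 0})) (ℤP.+-monoʳ-≤ 1ℤ (⟦⟧≥0 (g (scalar i) ≟ 0#)))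
    ... | no i≢j = ℤP.≤-trans (⟦⟧-mono (f (scalar i) ≟ 0#) (g (scalar i) ≟ 0#) (λ fi →
             *≈0⇒ (λ e → i≢j (scalar-injective (-≈0 e)))
               (trans (sym (trans (eg (scalar i)) (trans (+-congʳ fj) (+-identityˡ _)))) fi)))
             (ℤP.≤-reflexive (≡.sym (ℤP.+-identityˡ _)))

  monic-power : ∀ n → Monic n (_^ n)
  monic-power zero    = const (λ _ → refl)
  monic-power (suc n) = horner 0# (monic-power n) (λ x → sym (+-identityˡ _))

  monic-power- : ∀ n b → Monic (suc n) (λ x → x ^ suc n - b)
  monic-power- n b = horner (- b) (monic-power n) (λ x → +-comm _ _)

  #powers≤ : ∀ n b → count (λ i → (scalar i ^ suc n) ≟ b) ℤ.≤ ℤ.+ suc n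
  #powers≤ n b = ℤP.≤-trans (ℤP.≤-reflexive (sum-cong (λ i → ⟦cong⟧ ((scalar i ^ suc n) ≟ b) ((scalar i ^ suc n - b) ≟ 0#) ≈⇒-≈0 -≈0)))
    (#roots≤ (monic-power- n b))

  pow≡^ : ∀ x n → pow x n ≡ x ^ n
  pow≡^ x zero    = ≡.refl
  pow≡^ x (suc n) = cong (x *_) (pow≡^ x n)

  1^ : ∀ n → 1# ^ n ≈ 1#
  1^ zero = refl
  1^ (suc n) = trans (*-identityˡ _) (1^ n)

  ^-≉0 : ∀ {x} n → ¬ x ≈ 0# → ¬ x ^ n ≈ 0#
  ^-≉0 zero nz = 1≉0
  ^-≉0 (suc n) nz = *-≉0 nz (^-≉0 n nz)

  ×1-^ : ∀ m n → (m ℕ.^ n) ×ₙ 1# ≈ (m ×ₙ 1#) ^ n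
  ×1-^ m zero = +-identityʳ 1#
  ×1-^ m (suc n) = trans (×1-homo-* m (m ℕ.^ n)) (*-congˡ (×1-^ m n))

  -- The power (p · 1)^n is `card` · 1 = 0, and a field has no nonzero nilpotent element.
  characteristic : ∀ {p n} → card ≡ p ℕ.^ n → p ×ₙ 1# ≈ 0#
  characteristic {p} {n} e with (p ×ₙ 1#) ≟ 0#
  ... | yes z = z
  ... | no nz = ⊥-elim (^-≉0 n nz (trans (sym (×1-^ p n)) (trans (reflexive (cong (_×ₙ 1#) (≡.sym e))) card×1≈0)))

  -- Writing q as `suc (suc s)` makes q - 1 = `suc s` available without subtraction.
  module QuadraticPower (s : ℕ) (card≡q² : card ≡ suc (suc s) ℕ.* suc (suc s))
                        (^-+ : ∀ x y → (x + y) ^ suc (suc s) ≈ x ^ suc (suc s) + y ^ suc (suc s)) where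

    q : ℕ
    q = suc (suc s)

    ^q^q : ∀ x → (x ^ q) ^ q ≈ x
    ^q^q x = trans (^-assocʳ x q q) (trans (reflexive (cong (x ^_) (≡.sym card≡q²))) (fermat x))

    norm trace : Carrier → Carrier
    norm x = x * x ^ q
    trace x = x + x ^ q

    norm-≉0 : ∀ {x} → ¬ x ≈ 0# → ¬ norm x ≈ 0#
    norm-≉0 nz = *-≉0 nz (^-≉0 q nz)

    norm^q : ∀ x → norm x ^ q ≈ norm x
    norm^q x = trans (^-distrib-* x (x ^ q) q) (trans (*-congˡ (^q^q x)) (*-comm _ _))

    trace^q : ∀ x → trace x ^ q ≈ trace x
    trace^q x = trans (^-+ x (x ^ q)) (trans (+-congˡ (^q^q x)) (+-comm _ _))

    FixedUnit : Carrier → Set ℓ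
    FixedUnit b = (b ^ q ≈ b) × ¬ b ≈ 0#

    fixed-unit? : ∀ b → Dec (FixedUnit b)
    fixed-unit? b = ((b ^ q) ≟ b) ×-dec ¬? (b ≟ 0#)

    -- Cancelling x in x^q = x makes a fixed unit a root of x^(q - 1) = 1.
    #fixed-units≤ : count (λ i → fixed-unit? (scalar i)) ℤ.≤ ℤ.+ suc s
    #fixed-units≤ = ℤP.≤-trans (sum-mono _ _ (λ i → ⟦⟧-mono (fixed-unit? (scalar i)) ((scalar i ^ suc s) ≟ 1#)
        (λ (e , nz) → *-cancelˡ-≉0 nz (trans e (sym (*-identityʳ _)))))) (#powers≤ s 1#)

    #norm-fibre : Carrier → ℤ
    #norm-fibre b = count (λ i → norm (scalar i) ≟ b)

    -- `norm x` unfolds to `x ^ suc q`, so a fibre consists of roots of a monic polynomial of degree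
    -- q + 1.
    #norm-fibre≤ : ∀ b → #norm-fibre b ℤ.≤ ℤ.+ suc q
    #norm-fibre≤ b = #powers≤ q b

    -- Each nonzero x lies over exactly one fixed unit, namely its norm, and 0 lies over none.
    sum-fibres : sum (λ j → ⟦ fixed-unit? (scalar j) ⟧ ℤ.* #norm-fibre (scalar j)) ≡ ℤ.+ card ℤ.- 1ℤ
    sum-fibres = begin
      sum (λ j → ⟦ fixed-unit? (scalar j) ⟧ ℤ.* #norm-fibre (scalar j))
        ≡⟨ sum-cong (λ j → *-distribˡ-sum ⟦ fixed-unit? (scalar j) ⟧ _) ⟩
      sum (λ j → sum (λ i → ⟦ fixed-unit? (scalar j) ⟧ ℤ.* ⟦ norm (scalar i) ≟ scalar j ⟧))
        ≡⟨ sum-comm _ ⟩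
      sum (λ i → sum (λ j → ⟦ fixed-unit? (scalar j) ⟧ ℤ.* ⟦ norm (scalar i) ≟ scalar j ⟧))
        ≡⟨ sum-cong (λ i → ≡.trans (sum-cong (λ j → at i j)) (sum-δ (scalar-index (norm (scalar i))) (λ _ → 1ℤ ℤ.- ⟦ scalar i ≟ 0# ⟧))) ⟩
      sum (λ i → 1ℤ ℤ.- ⟦ scalar i ≟ 0# ⟧)
        ≡⟨ sum-minus _ _ ⟩
      sum {card} (λ i → 1ℤ) ℤ.- sum (λ i → ⟦ scalar i ≟ 0# ⟧)
        ≡⟨ cong₂ ℤ._-_ (≡.trans (sum-const card 1ℤ) (ℤP.*-identityʳ (ℤ.+ card))) (≡.trans (sum-cong (λ i → ≡.trans
             (⟦cong⟧ (scalar i ≟ 0#) (i Fin.≟ scalar-index 0#) (λ e → scalar-injective (trans e (sym (scalar-scalar-index 0#))))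
               (λ { ≡.refl → scalar-scalar-index 0# })) (≡.sym (ℤP.*-identityʳ _)))) (sum-δ (scalar-index 0#) (λ _ → 1ℤ))) ⟩
      ℤ.+ card ℤ.- 1ℤ ∎
      where
      open ≡-Reasoning
      at : ∀ i j → ⟦ fixed-unit? (scalar j) ⟧ ℤ.* ⟦ norm (scalar i) ≟ scalar j ⟧
                 ≡ ⟦ j Fin.≟ scalar-index (norm (scalar i)) ⟧ ℤ.* (1ℤ ℤ.- ⟦ scalar i ≟ 0# ⟧)
      at i j = ≡.trans (≡.sym (⟦×⟧ (fixed-unit? (scalar j)) (norm (scalar i) ≟ scalar j)))
        (≡.trans (⟦cong⟧ (fixed-unit? (scalar j) ×-dec (norm (scalar i) ≟ scalar j)) ((j Fin.≟ scalar-index (norm (scalar i))) ×-dec ¬? (scalar i ≟ 0#))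
           (λ ((_ , nz) , e) → scalar-injective (trans (sym e) (sym (scalar-scalar-index _))) ,
              λ i0 → nz (trans (sym e) (trans (*-congʳ i0) (zeroˡ _))))
           (λ { (≡.refl , nz) → let e = scalar-scalar-index (norm (scalar i)) in
              (trans (^-congˡ q e) (trans (norm^q _) (sym e)) , λ z → norm-≉0 nz (trans (sym e) z)) , sym e }))
        (≡.trans (⟦×⟧ (j Fin.≟ scalar-index (norm (scalar i))) (¬? (scalar i ≟ 0#)))
          (cong (⟦ j Fin.≟ scalar-index (norm (scalar i)) ⟧ ℤ.*_) (⟦¬⟧ (scalar i ≟ 0#)))))

    -- The fibres over the at most q − 1 fixed units have at most q + 1 elements, and together they
    -- contain the q² − 1 units.
    norm-fibre≡ : ∀ b → b ^ q ≈ b → ¬ b ≈ 0# → #norm-fibre b ≡ ℤ.+ suc q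
    norm-fibre≡ b bq nz = begin
      #norm-fibre b                                ≡⟨ sum-cong (λ i → ⟦≟⟧-cong refl (sym (scalar-scalar-index b))) ⟩
      #norm-fibre (scalar j)                       ≡⟨ ℤP.*-identityˡ _ ⟨
      1ℤ ℤ.* #norm-fibre (scalar j)                ≡⟨ cong (ℤ._* #norm-fibre (scalar j)) unit ⟨
      ⟦ fixed-unit? (scalar j) ⟧ ℤ.* #norm-fibre (scalar j)  ≡⟨ sum-≤-≡ _ _ (λ i → ≤-at (fixed-unit? (scalar i)) (#norm-fibre≤ (scalar i))) total≤ j ⟩
      ⟦ fixed-unit? (scalar j) ⟧ ℤ.* ℤ.+ suc q     ≡⟨ cong (ℤ._* ℤ.+ suc q) unit ⟩
      1ℤ ℤ.* ℤ.+ suc q                             ≡⟨ ℤP.*-identityˡ _ ⟩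
      ℤ.+ suc q                                    ∎
      where
      open ≡-Reasoning
      j = scalar-index b
      e = scalar-scalar-index b
      unit : ⟦ fixed-unit? (scalar j) ⟧ ≡ 1ℤ
      unit = ⟦yes⟧ (fixed-unit? (scalar j)) (trans (^-congˡ q e) (trans bq (sym e)) , λ z → nz (trans (sym e) z))
      ≤-at : ∀ {a} {P : Set a} (d : Dec P) {x y} → x ℤ.≤ y → ⟦ d ⟧ ℤ.* x ℤ.≤ ⟦ d ⟧ ℤ.* y
      ≤-at (yes _) x≤y = ℤP.*-monoˡ-≤-nonNeg 1ℤ x≤y
      ≤-at (no _) x≤y = ℤP.≤-refl
      -- This is (q - 1)(q + 1) = q² - 1 with `t` = q - 2.
      square : ∀ t → (1ℤ ℤ.+ t) ℤ.* (ℤ.+ 3 ℤ.+ t) ≡ (ℤ.+ 2 ℤ.+ t) ℤ.* (ℤ.+ 2 ℤ.+ t) ℤ.- 1ℤ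
      square = solve-∀
      total≤ : sum (λ i → ⟦ fixed-unit? (scalar i) ⟧ ℤ.* ℤ.+ suc q) ℤ.≤ sum (λ i → ⟦ fixed-unit? (scalar i) ⟧ ℤ.* #norm-fibre (scalar i))
      total≤ = ℤP.≤-trans (ℤP.≤-reflexive (≡.sym (*-distribʳ-sum (ℤ.+ suc q) _)))
        (ℤP.≤-trans (ℤP.*-monoʳ-≤-nonNeg (ℤ.+ suc q) #fixed-units≤)
          (ℤP.≤-reflexive (≡.trans (square (ℤ.+ s)) (≡.trans (cong (ℤ._- 1ℤ) (≡.sym (≡.trans (cong ℤ.+_ card≡q²) (ℤP.pos-* q q)))) (≡.sym sum-fibres)))))

    trace-monic : Monic q trace
    trace-monic = horner 0# (horner 1# (monic-power s) (λ x → refl))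
      (λ x → solve 2 (λ x y → x :+ x :* y := con (0 , 0) :+ x :* (one :+ y)) refl x (x ^ suc s))

    -- The trace is a monic polynomial of degree q, too small to vanish at all q² elements.
    trace-≉0 : Σ Carrier λ x → ¬ trace x ≈ 0#
    trace-≉0 with FinP.any? (λ i → ¬? (trace (scalar i) ≟ 0#))
    ... | yes (i , nz) = scalar i , nz
    ... | no none = ⊥-elim (ℕP.<⇒≱ (ℕP.m<m*n q q (ℕ.s≤s (ℕ.s≤s ℕ.z≤n))) (ℤP.drop‿+≤+ (subst (ℤ._≤ ℤ.+ q)
          (≡.trans (sum-cong (λ i → ⟦yes⟧ (trace (scalar i) ≟ 0#) (all-0 i))) (≡.trans (sum-const card 1ℤ) (≡.trans (ℤP.*-identityʳ _) (cong ℤ.+_ card≡q²))))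
          (#roots≤ trace-monic))))
      where
      all-0 : ∀ i → trace (scalar i) ≈ 0#
      all-0 i with trace (scalar i) ≟ 0#
      ... | yes z = z
      ... | no nz = ⊥-elim (none (i , nz))

    -- Dividing by a nonzero trace t is compatible with the trace, because t and hence its inverse
    -- are fixed by the q-th power.
    trace-1 : Σ Carrier λ x → trace x ≈ 1#
    trace-1 = x * t⁻¹ , trans (+-congˡ (trans (^-distrib-* x t⁻¹ q) (*-congˡ t⁻¹-fixed)))
        (trans (solve 3 (λ x y i → x :* i :+ y :* i := (x :+ y) :* i) refl x (x ^ q) t⁻¹) inv-t)
      where
      x = proj₁ trace-≉0
      t⁻¹ = proj₁ (inverse (trace x) (proj₂ trace-≉0))
      inv-t = proj₂ (inverse (trace x) (proj₂ trace-≉0))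
      t⁻¹-fixed : t⁻¹ ^ q ≈ t⁻¹
      t⁻¹-fixed = *-cancelˡ-≉0 (proj₂ trace-≉0) (trans (*-congʳ (sym (trace^q x)))
        (trans (sym (^-distrib-* _ _ q)) (trans (^-congˡ q inv-t) (trans (1^ q) (sym inv-t)))))

    conjugation : Conjugation q
    conjugation = record
      { σ = λ x → pow x q
      ; σ-cong = λ {x} {y} e → trans (↓ x) (trans (^-congˡ q e) (↑ y))
      ; σ-+ = λ x y → trans (↓ _) (trans (^-+ x y) (+-cong (↑ x) (↑ y)))
      ; σ-* = λ x y → trans (↓ _) (trans (^-distrib-* x y q) (*-cong (↑ x) (↑ y)))
      ; σ-0 = zeroˡ _
      ; σ-1 = trans (↓ 1#) (1^ q)
      ; σσ = λ x → trans (↓ _) (trans (^-congˡ q (↓ x)) (^q^q x))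
      ; τ = proj₁ trace-1
      ; τ+στ = trans (+-congˡ (↓ _)) (proj₂ trace-1)
      ; norm-fibre = λ b bq nz → ≡.trans (sum-cong (λ i → ⟦≟⟧-cong (*-congˡ (↓ _)) refl)) (norm-fibre≡ b (trans (↑ b) bq) nz)
      ; card≡ = card≡q²
      }
      where
      ↓ : ∀ x → pow x q ≈ x ^ q
      ↓ x = reflexive (pow≡^ x q)
      ↑ : ∀ x → x ^ q ≈ pow x q
      ↑ x = sym (↓ x)

  prime-power≥2 : ∀ {p} → Prime p → ∀ k → k ≥ 1 → 2 ℕ.≤ p ℕ.^ k
  prime-power≥2 {p} isPrime (suc k) _ = ℕP.≤-trans (ℕ.nonTrivial⇒n>1 p {{prime⇒nonTrivial isPrime}})
    (ℕP.m≤m*n p (p ℕ.^ k) {{ℕP.m^n≢0 p k {{prime⇒nonZero isPrime}}}})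

  -- The second component ties the abstract `σ` to the `pow` in the definition of the Hermitian
  -- form. The cases q = 0 and q = 1 contradict q being a prime power.
  frobenius-conjugation : ∀ p k q → Prime p → k ≥ 1 → q ≡ p ℕ.^ k → card ≡ q ℕ.^ 2 → Σ (Conjugation q) λ conj → ∀ x → Conjugation.σ conj x ≡ pow x q
  frobenius-conjugation p k zero isPrime k≥1 q≡ _ with () ← subst (2 ℕ.≤_) (≡.sym q≡) (prime-power≥2 isPrime k k≥1)
  frobenius-conjugation p k (suc zero) isPrime k≥1 q≡ _ with ℕ.s≤s () ← subst (2 ℕ.≤_) (≡.sym q≡) (prime-power≥2 isPrime k k≥1)
  frobenius-conjugation p k q@(suc (suc s)) isPrime k≥1 q≡ card≡ =
    QuadraticPower.conjugation s (≡.trans card≡ (cong (q ℕ.*_) (ℕP.*-identityʳ q))) ^-+ , λ x → ≡.refl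
    where
    char : p ×ₙ 1# ≈ 0#
    char = characteristic {n = k ℕ.* 2} (≡.trans card≡ (≡.trans (cong (ℕ._^ 2) q≡) (ℕP.^-*-assoc p k 2)))
    ^-+ : ∀ x y → (x + y) ^ q ≈ x ^ q + y ^ q
    ^-+ x y = subst (λ n → (x + y) ^ n ≈ x ^ n + y ^ n) (≡.sym q≡) (FreshmansDream.freshman-iterated cring isPrime char k x y)

-- Solving the three linear relations for T.

module Elimination where

  open import Data.Integer using (-_; _+_; _*_; _-_)

  -- In the application T = Σ |Fix g ^⊥| over the n isometries g, C, X and Y are the numbers of unit vectors
  -- of the space, of unit vectors in Fix g ^⊥ (summed over g), and of unit vectors in Fix g (summed with
  -- weight |Fix g ^⊥|); X and Y are eliminated.
  eliminate : ∀ (r s s′ n C W X Y T E′ E : ℤ) → ℤ.NonZero s →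
    s * (T - r * X) ≡ W * (n * s - r * Y) →
    (1ℤ + r) * X ≡ C * (r * n) →
    Y * (1ℤ + r) * E′ ≡ n * s′ * (1ℤ + r * E′) →
    s ≡ r * r * s′ → W ≡ s - r * C → W * W ≡ s → E ≡ E′ * ((- r) * W) →
    T * (1ℤ + r) * E ≡ n * s * (1ℤ + r * E)
  eliminate r s s′ n C W X Y T E′ E s≢0 dual perp byvec size signed square expo = begin
    T * (1ℤ + r) * E                    ≡⟨ cong (T * (1ℤ + r) *_) expo ⟩
    T * (1ℤ + r) * (E′ * ((- r) * W))   ≡⟨ step₄ r T E′ W ⟩
    (- W) * (T * (1ℤ + r) * E′ * r)     ≡⟨ cong ((- W) *_) key ⟩
    (- W) * (n * (r * r * E′ * s - W))  ≡⟨ step₅ r s n W E′ ⟩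
    n * (W * W + s * r * (E′ * ((- r) * W))) ≡⟨ cong₂ (λ a b → n * (a + s * r * b)) square (≡.sym expo) ⟩
    n * (s + s * r * E)                 ≡⟨ step₆ r s n E ⟩
    n * s * (1ℤ + r * E)                ∎
    where
    open ≡-Reasoning
    rC : r * C ≡ s - W
    rC = ≡.trans (undo s (r * C)) (cong (λ z → s - z) (≡.sym signed))
      where
      undo : ∀ s x → x ≡ s - (s - x)
      undo = solve-∀
    step₁ : ∀ r s T X E′ → s * (T * (1ℤ + r) * E′ * r)
      ≡ r * E′ * (1ℤ + r) * (s * (T - r * X)) + s * r * r * E′ * ((1ℤ + r) * X)
    step₁ = solve-∀
    step₂ : ∀ r s n C W Y E′ → r * E′ * (1ℤ + r) * (W * (n * s - r * Y)) + s * r * r * E′ * (C * (r * n))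
      ≡ r * E′ * (1ℤ + r) * W * n * s - W * r * r * (Y * (1ℤ + r) * E′) + s * r * r * E′ * n * (r * C)
    step₂ = solve-∀
    regroup : ∀ r s′ n W E′ → W * r * r * (n * s′ * (1ℤ + r * E′)) ≡ W * n * (r * r * s′) * (1ℤ + r * E′)
    regroup = solve-∀
    step₃ : ∀ r s n W E′ → r * E′ * (1ℤ + r) * W * n * s - W * n * s * (1ℤ + r * E′) + s * r * r * E′ * n * (s - W)
      ≡ s * (n * (r * r * E′ * s - W))
    step₃ = solve-∀
    step₄ : ∀ r T E′ W → T * (1ℤ + r) * (E′ * ((- r) * W)) ≡ (- W) * (T * (1ℤ + r) * E′ * r)
    step₄ = solve-∀
    step₅ : ∀ r s n W E′ → (- W) * (n * (r * r * E′ * s - W)) ≡ n * (W * W + s * r * (E′ * ((- r) * W)))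
    step₅ = solve-∀
    step₆ : ∀ r s n E → n * (s + s * r * E) ≡ n * s * (1ℤ + r * E)
    step₆ = solve-∀
    -- `dual` trades T for X and Y; `perp` evaluates X, `byvec` with s = r²s′ evaluates Y, and s is
    -- cancelled. Multiplication by -W then turns W² into s and completes E′ to E.
    key : T * (1ℤ + r) * E′ * r ≡ n * (r * r * E′ * s - W)
    key = ℤP.*-cancelˡ-≡ s _ _ {{s≢0}} (begin
      s * (T * (1ℤ + r) * E′ * r)
        ≡⟨ step₁ r s T X E′ ⟩
      r * E′ * (1ℤ + r) * (s * (T - r * X)) + s * r * r * E′ * ((1ℤ + r) * X)
        ≡⟨ cong₂ (λ a b → r * E′ * (1ℤ + r) * a + s * r * r * E′ * b) dual perp ⟩
      r * E′ * (1ℤ + r) * (W * (n * s - r * Y)) + s * r * r * E′ * (C * (r * n))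
        ≡⟨ step₂ r s n C W Y E′ ⟩
      r * E′ * (1ℤ + r) * W * n * s - W * r * r * (Y * (1ℤ + r) * E′) + s * r * r * E′ * n * (r * C)
        ≡⟨ cong₂ (λ a b → r * E′ * (1ℤ + r) * W * n * s - a + s * r * r * E′ * n * b)
             (≡.trans (cong (W * r * r *_) byvec) (≡.trans (regroup r s′ n W E′) (cong (λ z → W * n * z * (1ℤ + r * E′)) (≡.sym size)))) rC ⟩
      r * E′ * (1ℤ + r) * W * n * s - W * n * s * (1ℤ + r * E′) + s * r * r * E′ * n * (s - W)
        ≡⟨ step₃ r s n W E′ ⟩
      s * (n * (r * r * E′ * s - W)) ∎)

-- Abstract Hermitian spaces with their full isometry groups.

module HermitianSpaces {c ℓ : Level} (K : FiniteField c ℓ) {q : ℕ} (conj : FieldArithmetic.Conjugation K q) where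

  open IntegerSums
  open FiniteField K hiding (zero)
  open RingNormalisation cring
  open FieldArithmetic K
  open Conjugation conj

  -- Vectors and isometries are numbered, so that their equality is ≡ whatever that of K.  The vector space
  -- axioms and the linearity of isometries are consequences: the form separates vectors.
  record Space : Set (c ⊔ ℓ) where
   infixl 6 _⊕_
   infixr 7 _∙_
   field
     size : ℕ
   V : Set
   V = Fin size
   field
     _⊕_  : V → V → V
     _∙_  : Carrier → V → V
     0v   : V
     form : V → V → Carrier
     form-⊕ : ∀ x y z → form (x ⊕ y) z ≈ form x z + form y z
     form-∙ : ∀ a x z → form (a ∙ x) z ≈ a * form x z
     form-0 : ∀ z → form 0v z ≈ 0#
     form-σ : ∀ x y → form y x ≈ σ (form x y)
     separated : ∀ {x y} → (∀ z → form x z ≈ form y z) → x ≡ y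
     order : ℕ
   G : Set
   G = Fin order
   field
     act act⁻ : G → V → V
     act⁻-act : ∀ g x → act⁻ g (act g x) ≡ x
     act-act⁻ : ∀ g x → act g (act⁻ g x) ≡ x
     isometry : ∀ g x y → form (act g x) (act g y) ≈ form x y
     faithful : ∀ {g h} → (∀ x → act g x ≡ act h x) → g ≡ h
     -- `G` is the whole isometry group. This supplies composites, inverses and reflections, and it
     -- is what makes the stabiliser of a unit vector the whole isometry group of the complement.
     full : (φ ψ : V → V) → (∀ x → ψ (φ x) ≡ x) → (∀ x → φ (ψ x) ≡ x) →
            (∀ x y → form (φ x) (φ y) ≈ form x y) → Σ G λ g → ∀ x → act g x ≡ φ x

  module Geometry (S : Space) where
   open Space S

   form-≡ : ∀ {x x' y y'} → x ≡ x' → y ≡ y' → form x y ≈ form x' y'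
   form-≡ ≡.refl ≡.refl = refl

   form-⊕ʳ : ∀ x y z → form x (y ⊕ z) ≈ form x y + form x z
   form-⊕ʳ x y z = trans (form-σ (y ⊕ z) x) (trans (σ-cong (form-⊕ y z x)) (trans (σ-+ _ _)
     (+-cong (sym (form-σ y x)) (sym (form-σ z x)))))

   form-∙ʳ : ∀ a x y → form x (a ∙ y) ≈ σ a * form x y
   form-∙ʳ a x y = trans (form-σ (a ∙ y) x) (trans (σ-cong (form-∙ a y x)) (trans (σ-* _ _) (*-congˡ (sym (form-σ y x)))))

   form-0ʳ : ∀ x → form x 0v ≈ 0#
   form-0ʳ x = trans (form-σ 0v x) (trans (σ-cong (form-0 x)) σ-0)

   N : V → Carrier
   N x = form x x

   σN : ∀ x → σ (N x) ≈ N x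
   σN x = sym (form-σ x x)

   N-∙ : ∀ a x → N (a ∙ x) ≈ (a * σ a) * N x
   N-∙ a x = trans (form-∙ a x (a ∙ x)) (trans (*-congˡ (form-∙ʳ a x x)) (sym (*-assoc _ _ _)))

   N-⊕ : ∀ x y → N (x ⊕ y) ≈ (N x + (form x y + σ (form x y))) + N y
   N-⊕ x y = trans (form-⊕ x y (x ⊕ y)) (trans (+-cong (form-⊕ʳ x x y) (form-⊕ʳ y x y))
     (trans (+-congˡ (+-congʳ (form-σ x y)))
      (solve 4 (λ a b c d → (a :+ b) :+ (c :+ d) := (a :+ (b :+ c)) :+ d) refl _ _ _ _)))

   act-⊕ : ∀ g x y → act g (x ⊕ y) ≡ act g x ⊕ act g y
   act-⊕ g x y = separated λ z → let z' = act⁻ g z ; e = ≡.sym (act-act⁻ g z) in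
     trans (form-≡ ≡.refl e) (trans (isometry g (x ⊕ y) z') (trans (form-⊕ x y z')
       (sym (trans (form-⊕ _ _ z) (+-cong (trans (form-≡ ≡.refl e) (isometry g x z')) (trans (form-≡ ≡.refl e) (isometry g y z')))))))

   act-∙ : ∀ g a x → act g (a ∙ x) ≡ a ∙ act g x
   act-∙ g a x = separated λ z → let z' = act⁻ g z ; e = ≡.sym (act-act⁻ g z) in
     trans (form-≡ ≡.refl e) (trans (isometry g (a ∙ x) z') (trans (form-∙ a x z')
       (sym (trans (form-∙ a _ z) (*-congˡ (trans (form-≡ ≡.refl e) (isometry g x z')))))))

   ⊖_ : V → V
   ⊖ x = (- 1#) ∙ x

   form-⊖ : ∀ x z → form (⊖ x) z ≈ - form x z
   form-⊖ x z = trans (form-∙ _ x z) (solve 1 (λ a → (:- one) :* a := :- a) refl _)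

   form-⊖ʳ : ∀ z x → form z (⊖ x) ≈ - form z x
   form-⊖ʳ z x = trans (form-σ (⊖ x) z) (trans (σ-cong (form-⊖ x z)) (trans (σ-neg _) (-‿cong (sym (form-σ x z)))))

   ⊕-⊖ : ∀ x y → (x ⊕ y) ⊕ (⊖ y) ≡ x
   ⊕-⊖ x y = separated λ z → trans (form-⊕ _ _ z) (trans (+-cong (form-⊕ x y z) (form-⊖ y z))
     (solve 2 (λ a b → (a :+ b) :- b := a) refl _ _))

   ⊖-⊕ : ∀ x y → (x ⊕ (⊖ y)) ⊕ y ≡ x
   ⊖-⊕ x y = separated λ z → trans (form-⊕ _ _ z) (trans (+-congʳ (trans (form-⊕ x _ z) (+-congˡ (form-⊖ y z))))
     (solve 2 (λ a b → (a :- b) :+ b := a) refl _ _))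

   record Subspace (a : Level) : Set (Level.suc a ⊔ c) where
     field
       _∋_  : V → Set a
       _∋?_ : ∀ x → Dec (_∋_ x)
       ⊕-closed : ∀ {x y} → _∋_ x → _∋_ y → _∋_ (x ⊕ y)
       ∙-closed : ∀ k {x} → _∋_ x → _∋_ (k ∙ x)
       0-closed : _∋_ 0v

  module Counting (S : Space) where
    open Space S
    open Geometry S
    open Subspace

    #_ : ∀ {a} → Subspace a → ℤ
    # F = count (F ∋?_)

    whole : Subspace Level.zero
    whole = record { _∋_ = λ _ → 0 ≡ 0 ; _∋?_ = λ _ → yes ≡.refl ; ⊕-closed = λ _ _ → ≡.refl ; ∙-closed = λ _ _ → ≡.refl ; 0-closed = ≡.refl }

    #whole : # whole ≡ ℤ.+ size
    #whole = ≡.trans (sum-const size 1ℤ) (ℤP.*-identityʳ _)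

    _⊥_ : ∀ {a} → V → Subspace a → Set (a ⊔ ℓ)
    x ⊥ F = ∀ y → F ∋ y → form x y ≈ 0#

    abstract
      _⊥?_ : ∀ {a} x (F : Subspace a) → Dec (x ⊥ F)
      x ⊥? F = FinP.all? λ y → F ∋? y →-dec (form x y ≟ 0#)

    _^⊥ : ∀ {a} → Subspace a → Subspace (a ⊔ ℓ)
    F ^⊥ = record
      { _∋_ = λ x → x ⊥ F
      ; _∋?_ = λ x → x ⊥? F
      ; ⊕-closed = λ p r y y∈ → trans (form-⊕ _ _ y) (trans (+-cong (p y y∈) (r y y∈)) (+-identityˡ _))
      ; ∙-closed = λ k p y y∈ → trans (form-∙ k _ y) (trans (*-congˡ (p y y∈)) (zeroʳ k))
      ; 0-closed = λ y _ → form-0 y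
      }

    scaled-to : ∀ b x y → ¬ form x y ≈ 0# → Σ Carrier λ k → form x (k ∙ y) ≈ b
    scaled-to b x y nz with inverse (form x y) nz
    ... | i , inv = σ (b * i) , trans (form-∙ʳ _ x y) (trans (*-congʳ (σσ _))
      (trans (*-assoc b i _) (trans (*-congˡ (trans (*-comm i _) inv)) (*-identityʳ b))))

    -- A functional that is nonzero somewhere on F takes every value there, after rescaling. The
    -- values wanted later are 1 and `τ`.
    ¬⊥⇒ : ∀ {a} (F : Subspace a) x → ¬ x ⊥ F → ∀ b → Σ V λ y → (F ∋ y) × (form x y ≈ b)
    ¬⊥⇒ F x n b with FinP.¬∀⟶∃¬ size _ (λ y → F ∋? y →-dec (form x y ≟ 0#)) n
    ... | y , ¬imp with F ∋? y | form x y ≟ 0#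
    ... | _ | yes z = ⊥-elim (¬imp (λ _ → z))
    ... | no y∉ | no _ = ⊥-elim (¬imp (λ y∈ → ⊥-elim (y∉ y∈)))
    ... | yes y∈ | no nz with scaled-to b x y nz
    ... | k , e = k ∙ y , ∙-closed F k y∈ , e

    ≢0⇒ : ∀ x → ¬ x ≡ 0v → ∀ b → Σ V λ y → form x y ≈ b
    ≢0⇒ x x≢0 b with ¬⊥⇒ whole x (λ p → x≢0 (separated λ z → trans (p z ≡.refl) (sym (form-0 z)))) b
    ... | y , _ , e = y , e

    translate : ∀ {a} (F : Subspace a) {y₀} → F ∋ y₀ → (f : V → ℤ) →
                sum (λ y → ⟦ F ∋? y ⟧ ℤ.* f (y ⊕ y₀)) ≡ sum (λ y → ⟦ F ∋? y ⟧ ℤ.* f y)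
    translate F {y₀} y₀∈ f = sum-reindex (F ∋?_) (F ∋?_) (_⊕ y₀) (λ y → y ⊕ (⊖ y₀))
      (λ y y∈ → ⊕-closed F y∈ y₀∈) (λ y y∈ → ⊕-closed F y∈ (∙-closed F (- 1#) y₀∈))
      (λ y _ → ⊕-⊖ y y₀) (λ y _ → ⊖-⊕ y y₀) f

    sum-χ : ∀ {n} (w : Fin n → ℤ) (h : Fin n → Carrier) →
            sum (λ y → w y ℤ.* χ (h y)) ≡ sum (λ y → w y ℤ.* ⟦ h y ≟ 0# ⟧) ℤ.- sum (λ y → w y ℤ.* ⟦ h y ≟ 1# ⟧)
    sum-χ w h = ≡.trans (sum-cong (λ y → distr (w y) _ _)) (sum-minus _ _)
      where
      distr : ∀ a b d → a ℤ.* (b ℤ.- d) ≡ a ℤ.* b ℤ.- a ℤ.* d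
      distr = solve-∀

    -- Translation by `y₀` maps the solutions of h = 0 in F bijectively to those of h = 1, and `χ`
    -- counts the two with opposite signs.
    χ-vanishes : ∀ {a} (F : Subspace a) {y₀} → F ∋ y₀ → (h : V → Carrier) → (∀ y → h (y ⊕ y₀) ≈ h y + 1#) →
                 sum (λ y → ⟦ F ∋? y ⟧ ℤ.* χ (h y)) ≡ 0ℤ
    χ-vanishes F {y₀} y₀∈ h shift = ≡.trans (sum-χ (λ y → ⟦ F ∋? y ⟧) h)
      (≡.trans (cong (ℤ._- sum (λ y → ⟦ F ∋? y ⟧ ℤ.* ⟦ h y ≟ 1# ⟧))
         (≡.trans (sum-cong (λ y → cong (⟦ F ∋? y ⟧ ℤ.*_) (⟦cong⟧ (h y ≟ 0#) (h (y ⊕ y₀) ≟ 1#)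
             (λ e → trans (shift y) (trans (+-congʳ e) (+-identityˡ 1#)))
             (λ e → trans (solve 1 (λ a → a := (a :+ one) :- one) refl (h y)) (≈⇒-≈0 (trans (sym (shift y)) e))))))
           (translate F y₀∈ (λ y → ⟦ h y ≟ 1# ⟧))))
        (ℤP.+-inverseʳ (sum (λ y → ⟦ F ∋? y ⟧ ℤ.* ⟦ h y ≟ 1# ⟧))))

    χ-constant : ∀ {a} (F : Subspace a) {b} (h : V → Carrier) → (∀ y → F ∋ y → h y ≈ b) →
                 sum (λ y → ⟦ F ∋? y ⟧ ℤ.* χ (h y)) ≡ χ b ℤ.* # F
    χ-constant F {b} h e = ≡.trans (sum-cong (λ y → ≡.trans (⟦⟧*-cong (F ∋? y) (λ y∈ → χ-cong (e y y∈))) (ℤP.*-comm _ (χ b))))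
      (≡.sym (*-distribˡ-sum (χ b) _))

    -- Orthogonality relations: sum χ(form x y) over x in V and y in F. For fixed x the sum is |F|
    -- or 0 according as x ⊥ F or not; for fixed y it is |V| or 0 according as y = 0 or not.
    #*#^⊥ : ∀ {a} (F : Subspace a) → # F ℤ.* # (F ^⊥) ≡ ℤ.+ size
    #*#^⊥ F = begin
      # F ℤ.* # (F ^⊥)                                     ≡⟨ *-distribˡ-sum (# F) _ ⟩
      sum (λ x → # F ℤ.* ⟦ x ⊥? F ⟧)                       ≡⟨ sum-cong by-rows ⟨
      sum (λ x → sum (λ y → ⟦ F ∋? y ⟧ ℤ.* χ (form x y)))  ≡⟨ sum-comm _ ⟩
      sum (λ y → sum (λ x → ⟦ F ∋? y ⟧ ℤ.* χ (form x y)))  ≡⟨ sum-cong by-columns ⟩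
      sum (λ y → ⟦ y Fin.≟ 0v ⟧ ℤ.* # whole)               ≡⟨ sum-δ 0v _ ⟩
      # whole                                              ≡⟨ #whole ⟩
      ℤ.+ size                                             ∎
      where
      open ≡-Reasoning
      by-rows : ∀ x → sum (λ y → ⟦ F ∋? y ⟧ ℤ.* χ (form x y)) ≡ # F ℤ.* ⟦ x ⊥? F ⟧
      by-rows x with x ⊥? F
      ... | yes p = ≡.trans (χ-constant F (form x) p) (≡.trans (cong (ℤ._* # F) χ0) (ℤP.*-comm 1ℤ _))
      ... | no ¬p with ¬⊥⇒ F x ¬p 1#
      ... | y₀ , y₀∈ , e = ≡.trans (χ-vanishes F y₀∈ (form x) (λ y → trans (form-⊕ʳ x y y₀) (+-congˡ e)))
                             (≡.sym (ℤP.*-zeroʳ (# F)))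
      column : ∀ y → sum (λ x → ⟦ whole ∋? x ⟧ ℤ.* χ (form x y)) ≡ ⟦ y Fin.≟ 0v ⟧ ℤ.* # whole
      column y with y Fin.≟ 0v
      ... | yes ≡.refl = ≡.trans (χ-constant whole (λ x → form x 0v) (λ x _ → form-0ʳ x)) (cong (ℤ._* # whole) χ0)
      ... | no y≢0 with ≢0⇒ y y≢0 1#
      ... | x₀ , e = χ-vanishes whole {x₀} ≡.refl (λ x → form x y)
                       (λ x → trans (form-⊕ x x₀ y) (+-congˡ (trans (form-σ y x₀) (trans (σ-cong e) σ-1))))
      by-columns : ∀ y → sum (λ x → ⟦ F ∋? y ⟧ ℤ.* χ (form x y)) ≡ ⟦ y Fin.≟ 0v ⟧ ℤ.* # whole
      by-columns y = begin
        sum (λ x → ⟦ F ∋? y ⟧ ℤ.* χ (form x y))      ≡⟨ *-distribˡ-sum ⟦ F ∋? y ⟧ _ ⟨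
        ⟦ F ∋? y ⟧ ℤ.* sum (λ x → χ (form x y))      ≡⟨ cong (⟦ F ∋? y ⟧ ℤ.*_) (≡.trans (sum-cong (λ x → ≡.sym (ℤP.*-identityˡ _))) (column y)) ⟩
        ⟦ F ∋? y ⟧ ℤ.* (⟦ y Fin.≟ 0v ⟧ ℤ.* # whole)  ≡⟨ at-0 ⟩
        ⟦ y Fin.≟ 0v ⟧ ℤ.* # whole                   ∎
        where
        at-0 : ⟦ F ∋? y ⟧ ℤ.* (⟦ y Fin.≟ 0v ⟧ ℤ.* # whole) ≡ ⟦ y Fin.≟ 0v ⟧ ℤ.* # whole
        at-0 with y Fin.≟ 0v
        ... | yes ≡.refl = ≡.trans (cong (ℤ._* (1ℤ ℤ.* # whole)) (⟦yes⟧ (F ∋? 0v) (0-closed F))) (ℤP.*-identityˡ _)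
        ... | no _ = ℤP.*-zeroʳ ⟦ F ∋? y ⟧

  count≢0⇒∃ : ∀ {n a} {P : Fin n → Set a} (d : ∀ i → Dec (P i)) → ¬ count d ≡ 0ℤ → ∃ P
  count≢0⇒∃ d nz with FinP.any? d
  ... | yes e = e
  ... | no ¬e = ⊥-elim (nz (sum-zero _ (λ i → ⟦no⟧ (d i) (λ p → ¬e (i , p)))))

  +suc≢0 : ∀ {n} → ¬ ℤ.+ suc n ≡ 0ℤ
  +suc≢0 ()

  norm-surjective : ∀ b → σ b ≈ b → ¬ b ≈ 0# → Σ Carrier λ k → k * σ k ≈ b
  norm-surjective b σb nz with count≢0⇒∃ (λ i → (scalar i * σ (scalar i)) ≟ b)
                                (λ e → +suc≢0 (≡.trans (≡.sym (norm-fibre b σb nz)) e))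
  ... | i , e = scalar i , e

  σ-inverse : ∀ {b i} → σ b ≈ b → b * i ≈ 1# → σ i ≈ i
  σ-inverse {b} {i} σb inv = *-cancelˡ-≉0 b≉0 (trans (trans (*-congʳ (sym σb)) (trans (sym (σ-* b i)) (trans (σ-cong inv) σ-1))) (sym inv))
    where
    b≉0 : ¬ b ≈ 0#
    b≉0 e = 1≉0 (trans (sym inv) (trans (*-congʳ e) (zeroˡ i)))

  #nonzero-scalars : sum (λ i → 1ℤ ℤ.- ⟦ scalar i ≟ 0# ⟧) ≡ ℤ.+ q ℤ.* ℤ.+ q ℤ.- 1ℤ
  #nonzero-scalars = ≡.trans (sum-minus _ _) (cong₂ ℤ._-_
    (≡.trans (sum-const card 1ℤ) (≡.trans (ℤP.*-identityʳ _) (≡.trans (cong ℤ.+_ card≡) (ℤP.pos-* q q))))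
    (≡.trans (sum-cong (λ i → ≡.trans (⟦cong⟧ (scalar i ≟ 0#) (i Fin.≟ scalar-index 0#)
        (λ e → scalar-injective (trans e (sym (scalar-scalar-index 0#))))
        (λ { ≡.refl → scalar-scalar-index 0# })) (≡.sym (ℤP.*-identityʳ _)))) (sum-δ (scalar-index 0#) (λ _ → 1ℤ))))

  -- Distribution of norms on subspaces, and Poisson summation.

  module Duality (S : Space) where
    open Space S
    open Geometry S
    open Subspace
    open Counting S

    -- The integer counterpart of a Gauss sum for the norm: the vectors of norm 0 minus those of
    -- norm 1.
    signed-norms : ∀ {a} → Subspace a → ℤ
    signed-norms F = sum (λ x → ⟦ F ∋? x ⟧ ℤ.* χ (N x))

    #norm : ∀ {a} → Subspace a → Carrier → ℤ
    #norm F b = sum (λ x → ⟦ F ∋? x ⟧ ℤ.* ⟦ N x ≟ b ⟧)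

    #norm-cong : ∀ {a} (F : Subspace a) {b b'} → b ≈ b' → #norm F b ≡ #norm F b'
    #norm-cong F e = sum-cong (λ x → cong (⟦ F ∋? x ⟧ ℤ.*_) (⟦≟⟧-cong refl e))

    ∙-inverse : ∀ {k i} → k * i ≈ 1# → ∀ x → i ∙ (k ∙ x) ≡ x
    ∙-inverse {k} {i} inv x = separated λ z → trans (form-∙ i _ z) (trans (*-congˡ (form-∙ k x z))
      (trans (solve 3 (λ i k f → i :* (k :* f) := (k :* i) :* f) refl i k _) (trans (*-congʳ inv) (*-identityˡ _))))

    #norm-scale : ∀ {a} (F : Subspace a) k b b' → ¬ k ≈ 0# → (k * σ k) * b ≈ b' → #norm F b ≡ #norm F b'
    #norm-scale F k b b' k≉0 e with inverse k k≉0
    ... | i , inv = ≡.trans (sum-cong (λ x → cong (⟦ F ∋? x ⟧ ℤ.*_) (⟦cong⟧ (N x ≟ b) (N (k ∙ x) ≟ b')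
                        (λ Nx → trans (N-∙ k x) (trans (*-congˡ Nx) e))
                        (λ Nkx → *-cancelˡ-≉0 (*-≉0 k≉0 (σ-≉0 k≉0)) (trans (sym (N-∙ k x)) (trans Nkx (sym e)))))))
          (sum-reindex (F ∋?_) (F ∋?_) (k ∙_) (i ∙_) (λ _ → ∙-closed F k) (λ _ → ∙-closed F i)
            (λ x _ → ∙-inverse inv x) (λ x _ → ∙-inverse (trans (*-comm i k) inv) x) (λ x → ⟦ N x ≟ b' ⟧))

    -- Multiplication by a scalar k with k σ(k) = b permutes F and carries norm 1 to norm b.
    #norm≡ : ∀ {a} (F : Subspace a) b → σ b ≈ b → ¬ b ≈ 0# → #norm F b ≡ #norm F 1#
    #norm≡ F b σb nz with norm-surjective b σb nz
    ... | k , e = ≡.sym (#norm-scale F k 1# b (λ k0 → nz (trans (sym e) (trans (*-congʳ k0) (zeroˡ _))))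
                          (trans (*-identityʳ _) e))

    signed≡ : ∀ {a} (F : Subspace a) → signed-norms F ≡ #norm F 0# ℤ.- #norm F 1#
    signed≡ F = sum-χ (λ x → ⟦ F ∋? x ⟧) N

    σ-1# : σ (- 1#) ≈ - 1#
    σ-1# = trans (σ-neg 1#) (-‿cong σ-1)

    -1≉0 : ¬ - 1# ≈ 0#
    -1≉0 e = 1≉0 (trans (solve 0 (one := :- (:- one)) refl) (trans (-‿cong e) (solve 0 (:- con (0 , 0) := con (0 , 0)) refl)))

    -- The sum compares the frequencies of the norms b and 1 + b, which agree unless one of the two
    -- is 0. The coefficient on the right is χ(-b).
    convolve : ∀ b → σ b ≈ b → sum (λ x → χ (N x - b)) ≡ (⟦ b ≟ 0# ⟧ ℤ.- ⟦ b ≟ (- 1#) ⟧) ℤ.* signed-norms whole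
    convolve b σb = begin
      sum (λ x → χ (N x - b))
        ≡⟨ sum-cong (λ x → ≡.sym (ℤP.*-identityˡ _)) ⟩
      sum (λ x → 1ℤ ℤ.* χ (N x - b))
        ≡⟨ sum-χ (λ _ → 1ℤ) (λ x → N x - b) ⟩
      sum (λ x → 1ℤ ℤ.* ⟦ (N x - b) ≟ 0# ⟧) ℤ.- sum (λ x → 1ℤ ℤ.* ⟦ (N x - b) ≟ 1# ⟧)
        ≡⟨ cong₂ ℤ._-_ (sum-cong (λ x → cong (1ℤ ℤ.*_) (⟦cong⟧ ((N x - b) ≟ 0#) (N x ≟ b) -≈0 ≈⇒-≈0)))
             (sum-cong (λ x → cong (1ℤ ℤ.*_) (⟦cong⟧ ((N x - b) ≟ 1#) (N x ≟ (1# + b))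
                (λ e → trans (solve 2 (λ n b → n := (n :- b) :+ b) refl (N x) b) (+-congʳ e))
                (λ e → trans (+-congʳ e) (solve 1 (λ b → (one :+ b) :- b := one) refl b))))) ⟩
      #norm whole b ℤ.- #norm whole (1# + b)
        ≡⟨ cases ⟩
      (⟦ b ≟ 0# ⟧ ℤ.- ⟦ b ≟ (- 1#) ⟧) ℤ.* (#norm whole 0# ℤ.- #norm whole 1#)
        ≡⟨ cong ((⟦ b ≟ 0# ⟧ ℤ.- ⟦ b ≟ (- 1#) ⟧) ℤ.*_) (signed≡ whole) ⟨
      (⟦ b ≟ 0# ⟧ ℤ.- ⟦ b ≟ (- 1#) ⟧) ℤ.* signed-norms whole ∎
      where
      open ≡-Reasoning
      Z = #norm whole 0#
      C = #norm whole 1#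
      pos : ∀ z c → z ℤ.- c ≡ 1ℤ ℤ.* (z ℤ.- c)
      pos = solve-∀
      neg : ∀ z c → c ℤ.- z ≡ ℤ.-1ℤ ℤ.* (z ℤ.- c)
      neg = solve-∀
      nil : ∀ z c → c ℤ.- c ≡ 0ℤ ℤ.* (z ℤ.- c)
      nil = solve-∀
      cases : #norm whole b ℤ.- #norm whole (1# + b) ≡ (⟦ b ≟ 0# ⟧ ℤ.- ⟦ b ≟ (- 1#) ⟧) ℤ.* (Z ℤ.- C)
      cases with b ≟ 0# | b ≟ (- 1#)
      ... | yes b0 | yes b-1 = ⊥-elim (-1≉0 (trans (sym b-1) b0))
      ... | yes b0 | no _ = ≡.trans (cong₂ ℤ._-_ (#norm-cong whole b0) (#norm-cong whole (trans (+-congˡ b0) (+-identityʳ 1#)))) (pos Z C)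
      ... | no b≉0 | yes b-1 = ≡.trans (cong₂ ℤ._-_ (#norm≡ whole b σb b≉0) (#norm-cong whole (trans (+-congˡ b-1) (-‿inverseʳ 1#)))) (neg Z C)
      ... | no b≉0 | no b≉-1 = ≡.trans (cong₂ ℤ._-_ (#norm≡ whole b σb b≉0)
              (#norm≡ whole (1# + b) (trans (σ-+ 1# b) (+-cong σ-1 σb)) (λ e → b≉-1 (+-cancel (trans (+-comm b 1#) e))))) (nil Z C)

    trace : V → V → Carrier
    trace x y = form x y + σ (form x y)

    trace-⊕ʳ : ∀ x y z → trace x (y ⊕ z) ≈ trace x y + trace x z
    trace-⊕ʳ x y z = trans (+-cong (form-⊕ʳ x y z) (trans (σ-cong (form-⊕ʳ x y z)) (σ-+ _ _)))
      (solve 4 (λ a b c d → (a :+ b) :+ (c :+ d) := (a :+ c) :+ (b :+ d)) refl _ _ _ _)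

    -- Poisson summation for the norm: completing the square in N x + trace x y.
    duality : ∀ {a} (F : Subspace a) → # F ℤ.* signed-norms (F ^⊥) ≡ signed-norms whole ℤ.* signed-norms F
    duality F = begin
      # F ℤ.* signed-norms (F ^⊥)                                          ≡⟨ *-distribˡ-sum (# F) _ ⟩
      sum (λ x → # F ℤ.* (⟦ x ⊥? F ⟧ ℤ.* χ (N x)))                         ≡⟨ sum-cong by-rows ⟨
      sum (λ x → sum (λ y → ⟦ F ∋? y ⟧ ℤ.* χ (N x + trace x y)))         ≡⟨ sum-comm _ ⟩
      sum (λ y → sum (λ x → ⟦ F ∋? y ⟧ ℤ.* χ (N x + trace x y)))         ≡⟨ sum-cong by-columns ⟩
      sum (λ y → W ℤ.* (⟦ F ∋? y ⟧ ℤ.* (⟦ N y ≟ 0# ⟧ ℤ.- ⟦ N y ≟ (- 1#) ⟧))) ≡⟨ *-distribˡ-sum W _ ⟨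
      W ℤ.* sum (λ y → ⟦ F ∋? y ⟧ ℤ.* (⟦ N y ≟ 0# ⟧ ℤ.- ⟦ N y ≟ (- 1#) ⟧))  ≡⟨ cong (W ℤ.*_) (≡.trans (sum-cong (λ y → distr ⟦ F ∋? y ⟧ _ _)) (sum-minus _ _)) ⟩
      W ℤ.* (#norm F 0# ℤ.- #norm F (- 1#))                                ≡⟨ cong (λ z → W ℤ.* (#norm F 0# ℤ.- z)) (#norm≡ F (- 1#) σ-1# -1≉0) ⟩
      W ℤ.* (#norm F 0# ℤ.- #norm F 1#)                                    ≡⟨ cong (W ℤ.*_) (signed≡ F) ⟨
      W ℤ.* signed-norms F                                                 ∎
      where
      open ≡-Reasoning
      W = signed-norms whole
      distr : ∀ a b d → a ℤ.* (b ℤ.- d) ≡ a ℤ.* b ℤ.- a ℤ.* d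
      distr = solve-∀
      swap : ∀ a b d → a ℤ.* (b ℤ.* d) ≡ d ℤ.* (a ℤ.* b)
      swap = solve-∀
      by-rows : ∀ x → sum (λ y → ⟦ F ∋? y ⟧ ℤ.* χ (N x + trace x y)) ≡ # F ℤ.* (⟦ x ⊥? F ⟧ ℤ.* χ (N x))
      by-rows x with x ⊥? F
      ... | yes p = ≡.trans (χ-constant F (λ y → N x + trace x y)
                      (λ y y∈ → trans (+-congˡ (trans (+-cong (p y y∈) (trans (σ-cong (p y y∈)) σ-0)) (+-identityˡ 0#))) (+-identityʳ _)))
                      (≡.trans (ℤP.*-comm (χ (N x)) (# F)) (cong (# F ℤ.*_) (≡.sym (ℤP.*-identityˡ _))))
      -- Since `τ` has trace 1, translating y by `y₀` raises `trace x y` by exactly 1.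
      ... | no ¬p with ¬⊥⇒ F x ¬p τ
      ... | y₀ , y₀∈ , e = ≡.trans (χ-vanishes F y₀∈ (λ y → N x + trace x y)
                      (λ y → trans (+-congˡ (trans (trace-⊕ʳ x y y₀) (+-congˡ (trans (+-cong e (σ-cong e)) τ+στ))))
                               (sym (+-assoc _ _ _))))
                      (≡.sym (ℤP.*-zeroʳ (# F)))
      by-columns : ∀ y → sum (λ x → ⟦ F ∋? y ⟧ ℤ.* χ (N x + trace x y))
                       ≡ W ℤ.* (⟦ F ∋? y ⟧ ℤ.* (⟦ N y ≟ 0# ⟧ ℤ.- ⟦ N y ≟ (- 1#) ⟧))
      by-columns y = begin
        sum (λ x → ⟦ F ∋? y ⟧ ℤ.* χ (N x + trace x y))
          ≡⟨ *-distribˡ-sum ⟦ F ∋? y ⟧ _ ⟨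
        ⟦ F ∋? y ⟧ ℤ.* sum (λ x → χ (N x + trace x y))
          -- N x + trace x y = N (x ⊕ y) - N y; the translation x ↦ x ⊕ y is removed next.
          ≡⟨ cong (⟦ F ∋? y ⟧ ℤ.*_) (sum-cong (λ x → χ-cong (trans (solve 2 (λ s n → s := (s :+ n) :- n) refl _ (N y)) (+-congʳ (sym (N-⊕ x y)))))) ⟩
        ⟦ F ∋? y ⟧ ℤ.* sum (λ x → χ (N (x ⊕ y) - N y))
          ≡⟨ cong (⟦ F ∋? y ⟧ ℤ.*_) (sum-bij (_⊕ y) (λ x → x ⊕ (⊖ y)) (λ x → ⊕-⊖ x y) (λ x → ⊖-⊕ x y) (λ x → χ (N x - N y))) ⟩
        ⟦ F ∋? y ⟧ ℤ.* sum (λ x → χ (N x - N y))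
          ≡⟨ cong (⟦ F ∋? y ⟧ ℤ.*_) (convolve (N y) (σN y)) ⟩
        ⟦ F ∋? y ⟧ ℤ.* ((⟦ N y ≟ 0# ⟧ ℤ.- ⟦ N y ≟ (- 1#) ⟧) ℤ.* W)
          ≡⟨ swap ⟦ F ∋? y ⟧ _ W ⟩
        W ℤ.* (⟦ F ∋? y ⟧ ℤ.* (⟦ N y ≟ 0# ⟧ ℤ.- ⟦ N y ≟ (- 1#) ⟧)) ∎

    -- Count the pairs (x , k) with x ∈ F and N (k ∙ x) ≈ 1 in two ways.
    #nonisotropic : ∀ {a} (F : Subspace a) → (# F ℤ.- #norm F 0#) ℤ.* ℤ.+ suc q ≡ (ℤ.+ q ℤ.* ℤ.+ q ℤ.- 1ℤ) ℤ.* #norm F 1#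
    #nonisotropic F = begin
      (# F ℤ.- #norm F 0#) ℤ.* ℤ.+ suc q
        ≡⟨ cong (ℤ._* ℤ.+ suc q) (sum-minus _ _) ⟨
      sum (λ x → ⟦ F ∋? x ⟧ ℤ.- ⟦ F ∋? x ⟧ ℤ.* ⟦ N x ≟ 0# ⟧) ℤ.* ℤ.+ suc q
        ≡⟨ *-distribʳ-sum (ℤ.+ suc q) _ ⟩
      sum (λ x → (⟦ F ∋? x ⟧ ℤ.- ⟦ F ∋? x ⟧ ℤ.* ⟦ N x ≟ 0# ⟧) ℤ.* ℤ.+ suc q)
        ≡⟨ sum-cong by-rows ⟩
      sum (λ x → sum (λ i → ⟦ F ∋? x ⟧ ℤ.* ⟦ N (scalar i ∙ x) ≟ 1# ⟧))
        ≡⟨ sum-comm _ ⟩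
      sum (λ i → sum (λ x → ⟦ F ∋? x ⟧ ℤ.* ⟦ N (scalar i ∙ x) ≟ 1# ⟧))
        ≡⟨ sum-cong by-columns ⟩
      sum (λ i → (1ℤ ℤ.- ⟦ scalar i ≟ 0# ⟧) ℤ.* #norm F 1#)
        ≡⟨ *-distribʳ-sum (#norm F 1#) _ ⟨
      sum (λ i → 1ℤ ℤ.- ⟦ scalar i ≟ 0# ⟧) ℤ.* #norm F 1#
        ≡⟨ cong (ℤ._* #norm F 1#) #nonzero-scalars ⟩
      (ℤ.+ q ℤ.* ℤ.+ q ℤ.- 1ℤ) ℤ.* #norm F 1# ∎
      where
      open ≡-Reasoning
      factor : ∀ a b d → (a ℤ.- a ℤ.* b) ℤ.* d ≡ a ℤ.* ((1ℤ ℤ.- b) ℤ.* d)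
      factor = solve-∀
      multiples : ∀ x → (1ℤ ℤ.- ⟦ N x ≟ 0# ⟧) ℤ.* ℤ.+ suc q ≡ sum (λ i → ⟦ N (scalar i ∙ x) ≟ 1# ⟧)
      multiples x with N x ≟ 0#
      ... | yes e = ≡.sym (sum-zero _ (λ i → ⟦no⟧ (N (scalar i ∙ x) ≟ 1#)
                      (λ h → 1≉0 (trans (sym h) (trans (N-∙ _ x) (trans (*-congˡ e) (zeroʳ _)))))))
      ... | no nz with inverse (N x) nz
      ... | b , inv = ≡.trans (ℤP.*-identityˡ _) (≡.trans
          (≡.sym (norm-fibre b (σ-inverse (σN x) inv) (λ e → 1≉0 (trans (sym inv) (trans (*-congˡ e) (zeroʳ _))))))
          (sum-cong (λ i → ⟦cong⟧ ((scalar i * σ (scalar i)) ≟ b) (N (scalar i ∙ x) ≟ 1#)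
            (λ e → trans (N-∙ _ x) (trans (*-congʳ e) (trans (*-comm b _) inv)))
            (λ h → *-cancelˡ-≉0 nz (trans (*-comm (N x) _) (trans (sym (N-∙ _ x)) (trans h (sym inv))))))))
      by-rows : ∀ x → (⟦ F ∋? x ⟧ ℤ.- ⟦ F ∋? x ⟧ ℤ.* ⟦ N x ≟ 0# ⟧) ℤ.* ℤ.+ suc q
                    ≡ sum (λ i → ⟦ F ∋? x ⟧ ℤ.* ⟦ N (scalar i ∙ x) ≟ 1# ⟧)
      by-rows x = ≡.trans (factor ⟦ F ∋? x ⟧ ⟦ N x ≟ 0# ⟧ (ℤ.+ suc q))
        (≡.trans (cong (⟦ F ∋? x ⟧ ℤ.*_) (multiples x)) (*-distribˡ-sum ⟦ F ∋? x ⟧ _))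
      by-columns : ∀ i → sum (λ x → ⟦ F ∋? x ⟧ ℤ.* ⟦ N (scalar i ∙ x) ≟ 1# ⟧) ≡ (1ℤ ℤ.- ⟦ scalar i ≟ 0# ⟧) ℤ.* #norm F 1#
      by-columns i with scalar i ≟ 0#
      ... | yes e = sum-zero _ (λ x → ≡.trans (cong (⟦ F ∋? x ⟧ ℤ.*_) (⟦no⟧ (N (scalar i ∙ x) ≟ 1#)
                (λ h → 1≉0 (trans (sym h) (trans (N-∙ _ x) (trans (*-congʳ (trans (*-congʳ e) (zeroˡ _))) (zeroˡ _)))))))
                (ℤP.*-zeroʳ ⟦ F ∋? x ⟧))
      ... | no nz with inverse (scalar i) nz
      ... | j , inv = ≡.trans (sum-reindex (F ∋?_) (F ∋?_) (scalar i ∙_) (j ∙_) (λ _ → ∙-closed F _) (λ _ → ∙-closed F j)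
            (λ x _ → ∙-inverse inv x) (λ x _ → ∙-inverse (trans (*-comm j _) inv) x) (λ x → ⟦ N x ≟ 1# ⟧))
            (≡.sym (ℤP.*-identityˡ _))

    -- After cancelling q + 1, `#nonisotropic` says that F has (q - 1) `#norm F 1#` vectors of
    -- nonzero norm. The cancellation is postponed to the end, so both sides are compared after
    -- multiplication by q + 1.
    signed-norms≡ : ∀ {a} (F : Subspace a) → signed-norms F ≡ # F ℤ.- ℤ.+ q ℤ.* #norm F 1#
    signed-norms≡ F = ≡.trans (signed≡ F) (ℤP.*-cancelʳ-≡ _ _ (ℤ.+ suc q)
      (≡.trans (step₁ (# F) (#norm F 0#) (#norm F 1#) (ℤ.+ suc q))
        (≡.trans (cong (λ z → (# F ℤ.- #norm F 1#) ℤ.* ℤ.+ suc q ℤ.- z) (#nonisotropic F))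
          (step₂ (# F) (#norm F 1#) (ℤ.+ q)))))
      where
      step₁ : ∀ f z n s → (z ℤ.- n) ℤ.* s ≡ (f ℤ.- n) ℤ.* s ℤ.- (f ℤ.- z) ℤ.* s
      step₁ = solve-∀
      step₂ : ∀ f n r → (f ℤ.- n) ℤ.* (1ℤ ℤ.+ r) ℤ.- (r ℤ.* r ℤ.- 1ℤ) ℤ.* n ≡ (f ℤ.- r ℤ.* n) ℤ.* (1ℤ ℤ.+ r)
      step₂ = solve-∀

  0≢1 : ¬ 0ℤ ≡ 1ℤ
  0≢1 ()

  -- Isometries, their fixed spaces, and the image of 1 - g.

  module Isometries (S : Space) where
    open Space S
    open Geometry S
    open Subspace
    open Counting S

    infixl 7 _∘ᵍ_
    _∘ᵍ_ : G → G → G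
    g ∘ᵍ h = proj₁ (full (act h ∘ act g) (act⁻ g ∘ act⁻ h)
      (λ x → ≡.trans (cong (act⁻ g) (act⁻-act h _)) (act⁻-act g x))
      (λ x → ≡.trans (cong (act h) (act-act⁻ g _)) (act-act⁻ h x))
      (λ x y → trans (isometry h _ _) (isometry g x y)))

    act-∘ : ∀ g h x → act (g ∘ᵍ h) x ≡ act h (act g x)
    act-∘ g h = proj₂ (full _ _ _ _ _)

    inv : G → G
    inv g = proj₁ (full (act⁻ g) (act g) (act-act⁻ g) (act⁻-act g)
      (λ x y → trans (sym (isometry g _ _)) (form-≡ (act-act⁻ g x) (act-act⁻ g y))))

    act-inv : ∀ g x → act (inv g) x ≡ act⁻ g x
    act-inv g = proj₂ (full _ _ _ _ _)

    ∘-invʳ : ∀ g h → (g ∘ᵍ h) ∘ᵍ inv h ≡ g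
    ∘-invʳ g h = faithful λ x → ≡.trans (act-∘ _ _ x) (≡.trans (act-inv h _) (≡.trans (cong (act⁻ h) (act-∘ g h x)) (act⁻-act h _)))

    ∘-inv'ʳ : ∀ g h → (g ∘ᵍ inv h) ∘ᵍ h ≡ g
    ∘-inv'ʳ g h = faithful λ x → ≡.trans (act-∘ _ _ x) (≡.trans (cong (act h) (≡.trans (act-∘ g _ x) (act-inv h _))) (act-act⁻ h _))

    ∘-invˡ : ∀ g h → inv g ∘ᵍ (g ∘ᵍ h) ≡ h
    ∘-invˡ g h = faithful λ x → ≡.trans (act-∘ _ _ x) (≡.trans (act-∘ g h _) (cong (act h) (≡.trans (cong (act g) (act-inv g x)) (act-act⁻ g x))))

    ∘-inv'ˡ : ∀ g h → g ∘ᵍ (inv g ∘ᵍ h) ≡ h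
    ∘-inv'ˡ g h = faithful λ x → ≡.trans (act-∘ _ _ x) (≡.trans (act-∘ (inv g) h _) (cong (act h) (≡.trans (act-inv g _) (act⁻-act g x))))

    Fix : G → Subspace Level.zero
    Fix g = record
      { _∋_ = λ x → act g x ≡ x
      ; _∋?_ = λ x → act g x Fin.≟ x
      ; ⊕-closed = λ {x} {y} p r → ≡.trans (act-⊕ g x y) (cong₂ _⊕_ p r)
      ; ∙-closed = λ k {x} p → ≡.trans (act-∙ g k x) (cong (k ∙_) p)
      ; 0-closed = fix-0
      }
      where
      0∙≡0v : ∀ x → 0# ∙ x ≡ 0v
      0∙≡0v x = separated λ z → trans (form-∙ 0# x z) (trans (zeroˡ _) (sym (form-0 z)))
      fix-0 : act g 0v ≡ 0v
      fix-0 = ≡.trans (cong (act g) (≡.sym (0∙≡0v 0v))) (≡.trans (act-∙ g 0# 0v) (0∙≡0v _))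

    displacement : G → V → V
    displacement g x = x ⊕ (⊖ act g x)

    form-displacement : ∀ g x z → form (displacement g x) z ≈ form x z - form (act g x) z
    form-displacement g x z = trans (form-⊕ x _ z) (+-congˡ (form-⊖ _ z))

    Displaced : G → V → Set
    Displaced g v = ∃ λ x → displacement g x ≡ v

    displaced? : ∀ g v → Dec (Displaced g v)
    displaced? g v = FinP.any? (λ x → displacement g x Fin.≟ v)

    -- For y fixed by g, form (g x) y = form (g x) (g y) = form x y.
    displaced⇒⊥ : ∀ g v → Displaced g v → v ⊥ Fix g
    displaced⇒⊥ g v (x , ≡.refl) y gy = trans (form-displacement g x y)
      (≈⇒-≈0 (trans (sym (isometry g x y)) (form-≡ ≡.refl gy)))

    -- The fibres of 1 - g are the cosets of Fix g.
    fibre≡Fix : ∀ g x₀ → count (λ x → displacement g x Fin.≟ displacement g x₀) ≡ # Fix g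
    fibre≡Fix g x₀ = count-bij (λ x → displacement g x Fin.≟ displacement g x₀) (Fix g ∋?_) (λ x → x ⊕ (⊖ x₀)) (_⊕ x₀)
      (λ x e → separated λ z → trans (form-≡ (≡.trans (act-⊕ g x _) (cong (act g x ⊕_) (act-∙ g _ x₀))) ≡.refl)
        (trans (form-⊕ _ _ z) (trans (+-congˡ (form-⊖ _ z)) (trans (rearr (trans (sym (form-displacement g x z)) (trans (form-≡ e ≡.refl) (form-displacement g x₀ z))))
          (sym (trans (form-⊕ _ _ z) (+-congˡ (form-⊖ _ z))))))))
      (λ y gy → separated λ z → trans (form-displacement g _ z) (trans
         (+-cong (form-⊕ y x₀ z) (-‿cong (trans (form-≡ (≡.trans (act-⊕ g y x₀) (cong (_⊕ act g x₀) gy)) ≡.refl) (form-⊕ y _ z))))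
         (trans (solve 3 (λ a b d → (a :+ b) :- (a :+ d) := b :- d) refl _ _ _) (sym (form-displacement g x₀ z)))))
      (λ x _ → ⊖-⊕ x x₀) (λ y _ → ⊕-⊖ y x₀)
      where
      rearr : ∀ {a b d e} → a - b ≈ d - e → b - e ≈ a - d
      rearr {a} {b} {d} {e} h = trans (solve 3 (λ a b e → b :- e := (a :- e) :- (a :- b)) refl a b e)
        (trans (+-congˡ (-‿cong h)) (solve 3 (λ a d e → (a :- e) :- (d :- e) := a :- d) refl a d e))

    #displaced*#Fix : ∀ g → count (displaced? g) ℤ.* # Fix g ≡ ℤ.+ size
    #displaced*#Fix g = begin
      count (displaced? g) ℤ.* # Fix g                      ≡⟨ *-distribʳ-sum (# Fix g) _ ⟩
      sum (λ v → ⟦ displaced? g v ⟧ ℤ.* # Fix g)            ≡⟨ sum-cong fibre ⟨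
      sum (λ v → sum (λ x → ⟦ displacement g x Fin.≟ v ⟧))  ≡⟨ sum-comm _ ⟩
      sum (λ x → sum (λ v → ⟦ displacement g x Fin.≟ v ⟧))  ≡⟨ sum-cong (λ x → ≡.trans (sum-cong (λ v →
          ≡.trans (⟦cong⟧ (displacement g x Fin.≟ v) (v Fin.≟ displacement g x) ≡.sym ≡.sym) (≡.sym (ℤP.*-identityʳ _)))) (sum-δ (displacement g x) (λ _ → 1ℤ))) ⟩
      sum {size} (λ x → 1ℤ)                                 ≡⟨ #whole ⟩
      ℤ.+ size                                              ∎
      where
      open ≡-Reasoning
      fibre : ∀ v → sum (λ x → ⟦ displacement g x Fin.≟ v ⟧) ≡ ⟦ displaced? g v ⟧ ℤ.* # Fix g
      fibre v with displaced? g v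
      ... | yes (x₀ , ≡.refl) = ≡.trans (fibre≡Fix g x₀) (≡.sym (ℤP.*-identityˡ _))
      ... | no n = sum-zero _ (λ x → ⟦no⟧ (displacement g x Fin.≟ v) (λ e → n (x , e)))

    #Fix≢0 : ∀ g → ℤ.NonZero (# Fix g)
    #Fix≢0 g = ℤ.≢-nonZero λ e → 0≢1 (≡.trans
        (sum-≤-≡ (λ _ → 0ℤ) (λ x → ⟦ Fix g ∋? x ⟧) (λ x → ⟦⟧≥0 (Fix g ∋? x))
          (ℤP.≤-reflexive (≡.trans e (≡.sym (sum-zero _ (λ _ → ≡.refl))))) 0v)
        (⟦yes⟧ (Fix g ∋? 0v) (0-closed (Fix g))))

    #displaced≡ : ∀ g → count (displaced? g) ≡ # (Fix g ^⊥)
    #displaced≡ g = ℤP.*-cancelʳ-≡ _ _ (# Fix g) {{#Fix≢0 g}}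
      (≡.trans (#displaced*#Fix g) (≡.trans (≡.sym (#*#^⊥ (Fix g))) (ℤP.*-comm (# Fix g) _)))

    -- The image of 1 - g lies in the complement of Fix g, and both have |V| / |Fix g| elements.
    ⊥⇒displaced : ∀ g v → v ⊥ Fix g → Displaced g v
    ⊥⇒displaced g v p with displaced? g v
    ... | yes d = d
    ... | no n = ⊥-elim (0≢1 (≡.trans (≡.sym (⟦no⟧ (displaced? g v) n)) (≡.trans
            (sum-≤-≡ _ _ (λ x → ⟦⟧-mono (displaced? g x) (x ⊥? Fix g) (displaced⇒⊥ g x)) (ℤP.≤-reflexive (≡.sym (#displaced≡ g))) v)
            (⟦yes⟧ (v ⊥? Fix g) p))))

  -- Reflections, and transitivity on vectors of norm 1.

  module Reflections (S : Space) where
    open Space S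
    open Geometry S
    open Isometries S

    -- A quasi-reflection with centre r, or a unitary transvection if r is isotropic. The inverse
    -- has parameter b with a + b + a b N r = 0, and the map is an isometry when b = σ a satisfies
    -- this equation.
    reflect : V → Carrier → V → V
    reflect r a x = x ⊕ (a * form x r) ∙ r

    form-reflect : ∀ r a x z → form (reflect r a x) z ≈ form x z + (a * form x r) * form r z
    form-reflect r a x z = trans (form-⊕ x _ z) (+-congˡ (form-∙ _ r z))

    reflect-reflect : ∀ r a b → (a + b) + (a * b) * N r ≈ 0# → ∀ x → reflect r b (reflect r a x) ≡ x
    reflect-reflect r a b e x = separated λ z → begin
      form (reflect r b (reflect r a x)) z
        ≈⟨ form-reflect r b _ z ⟩
      form (reflect r a x) z + (b * form (reflect r a x) r) * form r z
        ≈⟨ +-cong (form-reflect r a x z) (*-congʳ (*-congˡ (form-reflect r a x r))) ⟩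
      (form x z + (a * form x r) * form r z) + (b * (form x r + (a * form x r) * N r)) * form r z
        ≈⟨ solve 6 (λ f g h n a b → (f :+ (a :* g) :* h) :+ (b :* (g :+ (a :* g) :* n)) :* h := f :+ ((a :+ b) :+ (a :* b) :* n) :* (g :* h)) refl _ _ _ _ _ _ ⟩
      form x z + ((a + b) + (a * b) * N r) * (form x r * form r z)
        ≈⟨ +-congˡ (trans (*-congʳ e) (zeroˡ _)) ⟩
      form x z + 0#
        ≈⟨ +-identityʳ _ ⟩
      form x z ∎
      where open ≈-Reasoning

    reflect-isometry : ∀ r a → (a + σ a) + (a * σ a) * N r ≈ 0# → ∀ x y → form (reflect r a x) (reflect r a y) ≈ form x y
    reflect-isometry r a e x y = begin
      form (reflect r a x) (reflect r a y)
        ≈⟨ form-reflect r a x _ ⟩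
      form x (reflect r a y) + (a * form x r) * form r (reflect r a y)
        ≈⟨ +-cong (right x) (*-congˡ (right r)) ⟩
      (form x y + (σ a * form r y) * form x r) + (a * form x r) * (form r y + (σ a * form r y) * N r)
        ≈⟨ solve 6 (λ f g h n a b → (f :+ (b :* h) :* g) :+ (a :* g) :* (h :+ (b :* h) :* n) := f :+ ((a :+ b) :+ (a :* b) :* n) :* (g :* h)) refl _ _ _ _ _ _ ⟩
      form x y + ((a + σ a) + (a * σ a) * N r) * (form x r * form r y)
        ≈⟨ +-congˡ (trans (*-congʳ e) (zeroˡ _)) ⟩
      form x y + 0#
        ≈⟨ +-identityʳ _ ⟩
      form x y ∎
      where
      open ≈-Reasoning
      right : ∀ z → form z (reflect r a y) ≈ form z y + (σ a * form r y) * form z r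
      right z = trans (form-⊕ʳ z y _) (+-congˡ (trans (form-∙ʳ _ z r)
        (*-congʳ (trans (σ-* _ _) (*-congˡ (sym (form-σ y r)))))))

    reflection : ∀ r a → (a + σ a) + (a * σ a) * N r ≈ 0# → Σ G λ g → ∀ x → act g x ≡ reflect r a x
    reflection r a e = full (reflect r a) (reflect r (σ a)) (reflect-reflect r a (σ a) e)
      (reflect-reflect r (σ a) a (trans (+-cong (+-comm _ _) (*-congʳ (*-comm _ _))) e)) (reflect-isometry r a e)

    -- Multiplies r by l and fixes the complement of r.
    homology : ∀ {r} → N r ≈ 1# → ∀ l → l * σ l ≈ 1# → Σ G λ g → ∀ x → act g x ≡ reflect r (l - 1#) x
    homology {r} Nr l norm = reflection r (l - 1#) (begin
      ((l - 1#) + σ (l - 1#)) + ((l - 1#) * σ (l - 1#)) * N r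
        ≈⟨ +-cong (+-congˡ σ[l-1]) (*-cong (*-congˡ σ[l-1]) Nr) ⟩
      ((l - 1#) + (σ l - 1#)) + ((l - 1#) * (σ l - 1#)) * 1#
        ≈⟨ solve 2 (λ l l' → ((l :- one) :+ (l' :- one)) :+ ((l :- one) :* (l' :- one)) :* one := l :* l' :- one) refl l (σ l) ⟩
      l * σ l - 1#
        ≈⟨ ≈⇒-≈0 norm ⟩
      0# ∎)
      where
      open ≈-Reasoning
      σ[l-1] : σ (l - 1#) ≈ σ l - 1#
      σ[l-1] = trans (σ-+ l _) (+-congˡ (trans (σ-neg 1#) (-‿cong σ-1)))

    -- Reflect along r = w - u with a = 1/d, where d = form u w - 1 = form u r: then u goes to u + r
    -- = w. The isometry condition holds because N r = -(d + σ d).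
    step : ∀ u w → N u ≈ 1# → N w ≈ 1# → ¬ form u w ≈ 1# → Σ G λ g → act g u ≡ w
    step u w Nu Nw ≉1 with inverse (form u w - 1#) (λ e → ≉1 (-≈0 e))
    ... | a , inv-a = proj₁ g , ≡.trans (proj₂ g u) (separated λ z → trans (form-reflect r a u z)
          (trans (+-congˡ (trans (*-congʳ (trans (*-congˡ ur) (trans (*-comm a _) inv-a))) (trans (*-identityˡ _) (form-r z))))
            (solve 2 (λ u w → u :+ (w :- u) := w) refl _ _)))
      where
      open ≈-Reasoning
      d = form u w - 1#
      r = w ⊕ (⊖ u)
      form-r : ∀ z → form r z ≈ form w z - form u z
      form-r z = trans (form-⊕ w _ z) (+-congˡ (form-⊖ u z))
      ur : form u r ≈ d
      ur = trans (form-⊕ʳ u w _) (+-congˡ (trans (form-⊖ʳ u u) (-‿cong Nu)))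
      σd : σ d ≈ form w u - 1#
      σd = trans (σ-+ _ _) (+-cong (sym (form-σ u w)) (trans (σ-neg 1#) (-‿cong σ-1)))
      wr : form w r ≈ - σ d
      wr = trans (form-⊕ʳ w w _) (trans (+-cong Nw (form-⊖ʳ w u)) (trans (solve 1 (λ f → one :- f := :- (f :- one)) refl _) (-‿cong (sym σd))))
      Nr : N r ≈ - (d + σ d)
      Nr = trans (form-r r) (trans (+-cong wr (-‿cong ur)) (solve 2 (λ d e → (:- e) :- d := :- (d :+ e)) refl d (σ d)))
      σ-inv : σ d * σ a ≈ 1#
      σ-inv = trans (sym (σ-* d a)) (trans (σ-cong inv-a) σ-1)
      g = reflection r a (begin
        (a + σ a) + (a * σ a) * N r
          ≈⟨ +-cong (+-cong (trans (sym (*-identityʳ a)) (*-congˡ (sym σ-inv))) (trans (sym (*-identityʳ _)) (*-congˡ (sym inv-a)))) (*-congˡ Nr) ⟩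
        (a * (σ d * σ a) + σ a * (d * a)) + (a * σ a) * - (d + σ d)
          ≈⟨ solve 4 (λ a a' d d' → (a :* (d' :* a') :+ a' :* (d :* a)) :+ (a :* a') :* (:- (d :+ d')) := con (0 , 0)) refl a (σ a) d (σ d) ⟩
        0# ∎)

    q≢0 : ¬ q ≡ 0
    q≢0 ≡.refl = FinP.¬Fin0 (subst Fin card≡ (scalar-index 0#))

    -- The fibre of the norm over 1 has q + 1 elements, which is more than one.
    nontrivial-norm-1 : Σ Carrier λ l → (l * σ l ≈ 1#) × ¬ l ≈ 1#
    nontrivial-norm-1 with FinP.any? (λ i → ((scalar i * σ (scalar i)) ≟ 1#) ×-dec ¬? (scalar i ≟ 1#))
    ... | yes (i , norm , ≉1) = scalar i , norm , ≉1
    ... | no none = ⊥-elim (q≢0 (ℕP.suc-injective (ℤP.+-injective (≡.trans (≡.sym (norm-fibre 1# σ-1 1≉0)) only-1))))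
      where
      only-1 : count (λ i → (scalar i * σ (scalar i)) ≟ 1#) ≡ 1ℤ
      only-1 = ≡.trans (sum-cong (λ i → ≡.trans
          (⟦cong⟧ ((scalar i * σ (scalar i)) ≟ 1#) (i Fin.≟ scalar-index 1#) (is-1 i)
            (λ { ≡.refl → trans (*-cong (scalar-scalar-index 1#) (trans (σ-cong (scalar-scalar-index 1#)) σ-1)) (*-identityˡ 1#) }))
          (≡.sym (ℤP.*-identityʳ _)))) (sum-δ (scalar-index 1#) (λ _ → 1ℤ))
        where
        is-1 : ∀ i → scalar i * σ (scalar i) ≈ 1# → i ≡ scalar-index 1#
        is-1 i norm with scalar i ≟ 1#
        ... | yes e = scalar-injective (trans e (sym (scalar-scalar-index 1#)))
        ... | no ≉1 = ⊥-elim (none (i , norm , ≉1))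

    -- The remaining case form u w = 1, where `step` would divide by 0. A homology first replaces u
    -- by l u, and form (l u) w = l differs from 1.
    transitive-via : ∀ {l} → l * σ l ≈ 1# → ¬ l ≈ 1# → ∀ u w → N u ≈ 1# → N w ≈ 1# → form u w ≈ 1# → Σ G λ g → act g u ≡ w
    transitive-via {l} norm l≉1 u w Nu Nw uw = proj₁ g ∘ᵍ proj₁ h ,
      ≡.trans (act-∘ _ _ u) (≡.trans (cong (act (proj₁ h)) (≡.trans (proj₂ g u) scaled)) (proj₂ h))
      where
      g : Σ G λ g → ∀ x → act g x ≡ reflect u (l - 1#) x
      g = homology Nu l norm
      h : Σ G λ h → act h (l ∙ u) ≡ w
      h = step (l ∙ u) w (trans (N-∙ l u) (trans (*-cong norm Nu) (*-identityˡ 1#))) Nw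
            (λ e → l≉1 (trans (sym (*-identityʳ l)) (trans (*-congˡ (sym uw)) (trans (sym (form-∙ l u w)) e))))
      scaled : reflect u (l - 1#) u ≡ l ∙ u
      scaled = separated λ z → trans (form-reflect u _ u z) (trans (+-congˡ (*-congʳ (*-congˡ Nu)))
        (trans (solve 2 (λ f l → f :+ ((l :- one) :* one) :* f := l :* f) refl (form u z) l) (sym (form-∙ l u z))))

    abstract
      transitive : ∀ u w → N u ≈ 1# → N w ≈ 1# → Σ G λ g → act g u ≡ w
      transitive u w Nu Nw with form u w ≟ 1#
      ... | no ≉1 = step u w Nu Nw ≉1
      ... | yes e = transitive-via (proj₁ (proj₂ nontrivial-norm-1)) (proj₂ (proj₂ nontrivial-norm-1)) u w Nu Nw e

    stabiliser? : ∀ w g → Dec (act g w ≡ w)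
    stabiliser? w g = act g w Fin.≟ w

    stabiliser≡transporter : ∀ w₀ w → N w₀ ≈ 1# → N w ≈ 1# →
                             count (stabiliser? w) ≡ count (λ g → act g w₀ Fin.≟ w)
    stabiliser≡transporter w₀ w Nw₀ Nw with transitive w₀ w Nw₀ Nw
    ... | h , ≡.refl = count-bij (stabiliser? w) (λ g → act g w₀ Fin.≟ w) (h ∘ᵍ_) (inv h ∘ᵍ_)
      (λ g e → ≡.trans (act-∘ h g w₀) e)
      (λ g e → ≡.trans (act-∘ (inv h) g w) (≡.trans (cong (act g) (≡.trans (act-inv h w) (act⁻-act h w₀))) e))
      (λ g _ → ∘-invˡ h g) (λ g _ → ∘-inv'ˡ h g)

    -- A division-free orbit count: each stabiliser is as large as the set of isometries taking `w₀`
    -- to w, and every isometry takes `w₀` to exactly one vector, of norm 1.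
    sum-stabilisers : ∀ w₀ → N w₀ ≈ 1# → sum (λ w → ⟦ N w ≟ 1# ⟧ ℤ.* count (stabiliser? w)) ≡ ℤ.+ order
    sum-stabilisers w₀ Nw₀ = begin
      sum (λ w → ⟦ N w ≟ 1# ⟧ ℤ.* count (stabiliser? w))
        ≡⟨ sum-cong (λ w → ≡.trans (⟦⟧*-cong (N w ≟ 1#) (stabiliser≡transporter w₀ w Nw₀)) (*-distribˡ-sum ⟦ N w ≟ 1# ⟧ _)) ⟩
      sum (λ w → sum (λ g → ⟦ N w ≟ 1# ⟧ ℤ.* ⟦ act g w₀ Fin.≟ w ⟧))
        ≡⟨ sum-comm _ ⟩
      sum (λ g → sum (λ w → ⟦ N w ≟ 1# ⟧ ℤ.* ⟦ act g w₀ Fin.≟ w ⟧))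
        ≡⟨ sum-cong (λ g → ≡.trans (sum-cong (λ w → ≡.trans (ℤP.*-comm ⟦ N w ≟ 1# ⟧ _)
              (cong (ℤ._* ⟦ N w ≟ 1# ⟧) (⟦cong⟧ (act g w₀ Fin.≟ w) (w Fin.≟ act g w₀) ≡.sym ≡.sym)))) (sum-δ (act g w₀) _)) ⟩
      sum (λ g → ⟦ N (act g w₀) ≟ 1# ⟧)
        ≡⟨ sum-cong (λ g → ⟦yes⟧ (N (act g w₀) ≟ 1#) (trans (isometry g w₀ w₀) Nw₀)) ⟩
      sum {order} (λ g → 1ℤ)
        ≡⟨ sum-const order 1ℤ ⟩
      ℤ.+ order ℤ.* 1ℤ
        ≡⟨ ℤP.*-identityʳ _ ⟩
      ℤ.+ order ∎
      where open ≡-Reasoning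

  -- How often a vector of norm 1 is orthogonal to Fix g.

  module Perpendicularity (S : Space) where
    open Space S
    open Geometry S
    open Counting S
    open Isometries S
    open Reflections S

    norm-1? : ∀ i → Dec (scalar i * σ (scalar i) ≈ 1#)
    norm-1? i = (scalar i * σ (scalar i)) ≟ 1#

    module _ {r : V} (Nr : N r ≈ 1#) where

      -- The homology with multiplier scalar i; junk (the trivial one) unless scalar i has norm 1.
      homologyᵢ : Fin card → G
      homologyᵢ i with norm-1? i
      ... | yes norm = proj₁ (homology Nr (scalar i) norm)
      ... | no _ = proj₁ (homology Nr 1# (trans (*-congˡ σ-1) (*-identityˡ 1#)))

      act-homologyᵢ : ∀ i → scalar i * σ (scalar i) ≈ 1# → ∀ x → act (homologyᵢ i) x ≡ reflect r (scalar i - 1#) x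
      act-homologyᵢ i norm x with norm-1? i
      ... | yes norm' = proj₂ (homology Nr (scalar i) norm') x
      ... | no ¬norm = ⊥-elim (¬norm norm)

      module _ (g : G) where

        Moving : Fin card → Set _
        Moving i = (scalar i * σ (scalar i) ≈ 1#) × ¬ r ⊥ Fix (g ∘ᵍ homologyᵢ i)

        moving? : ∀ i → Dec (Moving i)
        moving? i = norm-1? i ×-dec ¬? (r ⊥? Fix (g ∘ᵍ homologyᵢ i))

        -- A fixed vector x of g ∘ᵍ homologyᵢ i with form x r ≈ 1 comes from y = act g x with
        -- x = y + (1 - u) r, where u = form y r is the inverse of the multiplier.
        record Witness (i : Fin card) : Set (c ⊔ ℓ) where
          field
            x       : V
            inverse-multiplier : scalar i * form (act g x) r ≈ 1#
            form-x  : ∀ z → form x z ≈ form (act g x) z + (1# - form (act g x) r) * form r z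

        witness : ∀ i → Moving i → Witness i
        witness i (norm , ¬⊥) with ¬⊥⇒ (Fix (g ∘ᵍ homologyᵢ i)) r ¬⊥ 1#
        ... | x , fixed , rx = record { x = x ; inverse-multiplier = lu ; form-x = λ z → trans (form-x' z) (+-congˡ (*-congʳ coefficient)) }
          where
          y = act g x
          l = scalar i
          form-x' : ∀ z → form x z ≈ form y z + ((l - 1#) * form y r) * form r z
          form-x' z = trans (form-≡ (≡.trans (≡.sym fixed) (≡.trans (act-∘ g _ x) (act-homologyᵢ i norm y))) ≡.refl) (form-reflect r _ y z)
          lu : l * form y r ≈ 1#
          lu = begin
            l * form y r                            ≈⟨ solve 2 (λ l u → l :* u := u :+ ((l :- one) :* u) :* one) refl l (form y r) ⟩
            form y r + ((l - 1#) * form y r) * 1#   ≈⟨ +-congˡ (*-congˡ Nr) ⟨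
            form y r + ((l - 1#) * form y r) * N r  ≈⟨ form-x' r ⟨
            form x r                                ≈⟨ form-σ r x ⟩
            σ (form r x)                            ≈⟨ trans (σ-cong rx) σ-1 ⟩
            1#                                      ∎
            where open ≈-Reasoning
          coefficient : (l - 1#) * form y r ≈ 1# - form y r
          coefficient = trans (solve 2 (λ l u → (l :- one) :* u := l :* u :- u) refl l (form y r)) (+-congʳ lu)

        -- Let x, x' be the fixed vectors of the two witnesses, y, y' their images under g, and u =
        -- form y r, u' = form y' r. Comparing form x x' with form y y' gives u σ(u') = 1. The
        -- multipliers are 1/u and 1/u', and norm 1 turns the second into σ(u'), so they agree.
        moving-unique : ∀ i j → Moving i → Moving j → i ≡ j
        moving-unique i j mi mj = scalar-injective (*-cancelˡ-≉0 u≉0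
            (trans (*-comm u (scalar i)) (trans wi.inverse-multiplier (sym (trans (*-congˡ l'≈σu') uσu')))))
          where
          open ≈-Reasoning
          module wi = Witness (witness i mi)
          module wj = Witness (witness j mj)
          y = act g wi.x
          y' = act g wj.x
          u = form y r
          u' = form y' r
          l' = scalar j
          form-zx' : ∀ z → form z wj.x ≈ form z y' + (1# - σ u') * form z r
          form-zx' z = begin
            form z wj.x                                 ≈⟨ form-σ wj.x z ⟩
            σ (form wj.x z)                             ≈⟨ σ-cong (wj.form-x z) ⟩
            σ (form y' z + (1# - u') * form r z)        ≈⟨ trans (σ-+ _ _) (+-congˡ (σ-* _ _)) ⟩
            σ (form y' z) + σ (1# - u') * σ (form r z)  ≈⟨ +-cong (sym (form-σ y' z)) (*-cong (trans (σ-+ _ _) (+-cong σ-1 (σ-neg u'))) (sym (form-σ r z))) ⟩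
            form z y' + (1# - σ u') * form z r          ∎
          expansion : form wi.x wj.x ≈ form y y' + (1# - u * σ u')
          expansion = begin
            form wi.x wj.x
              ≈⟨ wi.form-x wj.x ⟩
            form y wj.x + (1# - u) * form r wj.x
              ≈⟨ +-cong (form-zx' y) (*-congˡ (form-zx' r)) ⟩
            (form y y' + (1# - σ u') * u) + (1# - u) * (form r y' + (1# - σ u') * N r)
              ≈⟨ +-congˡ (*-congˡ (+-cong (form-σ y' r) (*-congˡ Nr))) ⟩
            (form y y' + (1# - σ u') * u) + (1# - u) * (σ u' + (1# - σ u') * 1#)
              ≈⟨ solve 3 (λ f u v → (f :+ (one :- v) :* u) :+ (one :- u) :* (v :+ (one :- v) :* one) := f :+ (one :- u :* v)) refl _ u (σ u') ⟩
            form y y' + (1# - u * σ u') ∎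
          uσu' : u * σ u' ≈ 1#
          uσu' = sym (-≈0 (begin
            1# - u * σ u'                              ≈⟨ solve 2 (λ f k → k := (f :+ k) :- f) refl (form y y') _ ⟩
            (form y y' + (1# - u * σ u')) - form y y'  ≈⟨ ≈⇒-≈0 (trans (sym expansion) (sym (isometry g wi.x wj.x))) ⟩
            0#                                         ∎))
          u≉0 : ¬ u ≈ 0#
          u≉0 e = 1≉0 (trans (sym uσu') (trans (*-congʳ e) (zeroˡ _)))
          l'≈σu' : l' ≈ σ u'
          l'≈σu' = begin
            l'                  ≈⟨ *-identityʳ l' ⟨
            l' * 1#             ≈⟨ *-congˡ (trans (sym (σ-* l' u')) (trans (σ-cong wj.inverse-multiplier) σ-1)) ⟨
            l' * (σ l' * σ u')  ≈⟨ *-assoc _ _ _ ⟨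
            (l' * σ l') * σ u'  ≈⟨ trans (*-congʳ (proj₁ mj)) (*-identityˡ _) ⟩
            σ u'                ∎

        -- If r is not orthogonal to Fix g, the multiplier 1 works. Otherwise r = x - g x for some
        -- x, and a homology is chosen that takes g x back to x.
        moving : Σ (Fin card) Moving
        moving with r ⊥? Fix g
        ... | no ¬p = i , norm , λ p → ¬p (λ y gy → p y (≡.trans (act-∘ g _ y) (≡.trans (cong (act (homologyᵢ i)) gy) (trivial y))))
          where
          i = scalar-index 1#
          i≈1 = scalar-scalar-index 1#
          norm : scalar i * σ (scalar i) ≈ 1#
          norm = trans (*-cong i≈1 (trans (σ-cong i≈1) σ-1)) (*-identityˡ 1#)
          trivial : ∀ y → act (homologyᵢ i) y ≡ y
          trivial y = ≡.trans (act-homologyᵢ i norm y) (separated λ z → trans (form-reflect r _ y z)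
            (trans (+-congˡ (trans (*-congʳ (trans (*-congʳ (≈⇒-≈0 i≈1)) (zeroˡ _))) (zeroˡ _))) (+-identityʳ _)))
        ... | yes p with ⊥⇒displaced g r p
        ... | x , disp = i , norm , λ ⊥Fix → σa≉0 (trans (sym (form-σ x r)) (⊥Fix x fixed))
          where
          open ≈-Reasoning
          a = form x r
          y = act g x
          form-y : ∀ z → form y z ≈ form x z - form r z
          form-y z = trans (solve 2 (λ x y → y := x :- (x :- y)) refl (form x z) (form y z))
            (+-congˡ (-‿cong (trans (sym (form-displacement g x z)) (form-≡ disp ≡.refl))))
          yr : form y r ≈ a - 1#
          yr = trans (form-y r) (+-congˡ (-‿cong Nr))
          xy : form x y ≈ N x - a
          xy = trans (form-σ y x) (trans (σ-cong (form-y x)) (trans (σ-+ _ _) (+-cong (σN x) (trans (σ-neg _) (-‿cong (sym (form-σ r x)))))))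
          ry : form r y ≈ σ a - 1#
          ry = trans (form-σ y r) (trans (σ-cong yr) (trans (σ-+ _ _) (+-congˡ (trans (σ-neg 1#) (-‿cong σ-1)))))
          -- Expand N (g x) = N (x - r) and compare with N x, using N r = 1.
          a+σa : a + σ a ≈ 1#
          a+σa = -≈0 (begin
            (a + σ a) - 1#                  ≈⟨ solve 3 (λ n a b → (a :+ b) :- one := n :- ((n :- a) :- (b :- one))) refl (N x) a (σ a) ⟩
            N x - ((N x - a) - (σ a - 1#))  ≈⟨ ≈⇒-≈0 (trans (sym (isometry g x x)) (trans (form-y y) (+-cong xy (-‿cong ry)))) ⟩
            0#                              ∎)
          σa≉0 : ¬ σ a ≈ 0#
          σa≉0 e = 1≉0 (trans (sym a+σa) (trans (+-cong (trans (sym (σσ a)) (trans (σ-cong e) σ-0)) e) (+-identityˡ 0#)))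
          b = proj₁ (inverse (σ a) σa≉0)
          σab : σ a * b ≈ 1#
          σab = proj₂ (inverse (σ a) σa≉0)
          aσb : a * σ b ≈ 1#
          aσb = trans (*-congʳ (sym (σσ a))) (trans (sym (σ-* _ _)) (trans (σ-cong σab) σ-1))
          -- The multiplier is -a / σ a. With form y r = a - 1 = -σ a it satisfies (l - 1) form y r
          -- = a + σ a = 1, so the homology adds r to y = x - r. Its norm is visibly 1.
          i = scalar-index (- (a * b))
          l = scalar i
          l≈ : l ≈ - (a * b)
          l≈ = scalar-scalar-index _
          norm : l * σ l ≈ 1#
          norm = begin
            l * σ l                    ≈⟨ *-cong l≈ (trans (σ-cong l≈) (trans (σ-neg _) (-‿cong (σ-* a b)))) ⟩
            - (a * b) * - (σ a * σ b)  ≈⟨ solve 4 (λ a b a' b' → (:- (a :* b)) :* (:- (a' :* b')) := (a' :* b) :* (a :* b')) refl a b (σ a) (σ b) ⟩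
            (σ a * b) * (a * σ b)      ≈⟨ *-cong σab aσb ⟩
            1# * 1#                    ≈⟨ *-identityˡ 1# ⟩
            1#                         ∎
          coefficient : (l - 1#) * form y r ≈ 1#
          coefficient = begin
            (l - 1#) * form y r                 ≈⟨ *-cong (+-congʳ l≈) (trans yr (+-congˡ (-‿cong (sym a+σa)))) ⟩
            (- (a * b) - 1#) * (a - (a + σ a))  ≈⟨ solve 3 (λ a b a' → (:- (a :* b) :- one) :* (a :- (a :+ a')) := a :* (a' :* b) :+ a') refl a b (σ a) ⟩
            a * (σ a * b) + σ a                 ≈⟨ +-congʳ (trans (*-congˡ σab) (*-identityʳ a)) ⟩
            a + σ a                             ≈⟨ a+σa ⟩
            1#                                  ∎
          fixed : act (g ∘ᵍ homologyᵢ i) x ≡ x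
          fixed = ≡.trans (act-∘ g _ x) (≡.trans (act-homologyᵢ i norm y) (separated λ z → trans (form-reflect r _ y z)
            (trans (+-cong (form-y z) (trans (*-congʳ coefficient) (*-identityˡ _)))
              (solve 2 (λ x r → (x :- r) :+ r := x) refl _ _))))

      -- Right translation by each of the q + 1 homologies preserves the sum over g; after
      -- exchanging the summations, each g contributes exactly one homology.
      #⊥Fix : ℤ.+ suc q ℤ.* sum (λ g → 1ℤ ℤ.- ⟦ r ⊥? Fix g ⟧) ≡ ℤ.+ order
      #⊥Fix = begin
        ℤ.+ suc q ℤ.* M
          ≡⟨ cong (ℤ._* M) (norm-fibre 1# σ-1 1≉0) ⟨
        count norm-1? ℤ.* M
          ≡⟨ *-distribʳ-sum M _ ⟩
        sum (λ i → ⟦ norm-1? i ⟧ ℤ.* M)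
          ≡⟨ sum-cong (λ i → cong (⟦ norm-1? i ⟧ ℤ.*_)
               (≡.sym (sum-bij (_∘ᵍ homologyᵢ i) (_∘ᵍ inv (homologyᵢ i)) (λ g → ∘-invʳ g _) (λ g → ∘-inv'ʳ g _) (λ g → 1ℤ ℤ.- ⟦ r ⊥? Fix g ⟧)))) ⟩
        sum (λ i → ⟦ norm-1? i ⟧ ℤ.* sum (λ g → 1ℤ ℤ.- ⟦ r ⊥? Fix (g ∘ᵍ homologyᵢ i) ⟧))
          ≡⟨ sum-cong (λ i → *-distribˡ-sum ⟦ norm-1? i ⟧ _) ⟩
        sum (λ i → sum (λ g → ⟦ norm-1? i ⟧ ℤ.* (1ℤ ℤ.- ⟦ r ⊥? Fix (g ∘ᵍ homologyᵢ i) ⟧)))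
          ≡⟨ sum-comm _ ⟩
        sum (λ g → sum (λ i → ⟦ norm-1? i ⟧ ℤ.* (1ℤ ℤ.- ⟦ r ⊥? Fix (g ∘ᵍ homologyᵢ i) ⟧)))
          ≡⟨ sum-cong once ⟩
        sum {order} (λ g → 1ℤ)
          ≡⟨ ≡.trans (sum-const order 1ℤ) (ℤP.*-identityʳ _) ⟩
        ℤ.+ order ∎
        where
        open ≡-Reasoning
        M = sum (λ g → 1ℤ ℤ.- ⟦ r ⊥? Fix g ⟧)
        once : ∀ g → sum (λ i → ⟦ norm-1? i ⟧ ℤ.* (1ℤ ℤ.- ⟦ r ⊥? Fix (g ∘ᵍ homologyᵢ i) ⟧)) ≡ 1ℤ
        once g with moving g
        ... | i₀ , m₀ = ≡.trans (sum-cong (λ i →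
            ≡.trans (cong (⟦ norm-1? i ⟧ ℤ.*_) (≡.sym (⟦¬⟧ (r ⊥? Fix (g ∘ᵍ homologyᵢ i)))))
              (≡.trans (≡.sym (⟦×⟧ (norm-1? i) (¬? (r ⊥? Fix (g ∘ᵍ homologyᵢ i)))))
                (≡.trans (⟦cong⟧ (moving? g i) (i Fin.≟ i₀) (λ m → moving-unique g i i₀ m m₀) (λ { ≡.refl → m₀ }))
                  (≡.sym (ℤP.*-identityʳ _)))))) (sum-δ i₀ (λ _ → 1ℤ))

  -- The complement of a vector of norm 1 as a space of its own.

  module Complement (S : Space) {w : Space.V S} (Nw : Space.form S w w ≈ 1#) where
    open Space S
    open Geometry S
    open Subspace
    open Counting S
    open Duality S
    open Isometries S
    open Reflections S

    private
      module W = Enumeration (enumerate (λ x → form x w ≟ 0#))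
      module H = Enumeration (enumerate (stabiliser? w))

    V′ : Set
    V′ = Fin W.size

    G′ : Set
    G′ = Fin H.size

    along : V → Carrier → V
    along x k = x ⊕ (k ∙ w)

    form-along : ∀ x k z → form (along x k) z ≈ form x z + k * form w z
    form-along x k z = trans (form-⊕ x _ z) (+-congˡ (form-∙ k w z))

    form-along-w : ∀ x k → form (along x k) w ≈ form x w + k
    form-along-w x k = trans (form-along x k w) (+-congˡ (trans (*-congˡ Nw) (*-identityʳ k)))

    project : V → V
    project z = along z (- form z w)

    project⊥ : ∀ z → form (project z) w ≈ 0#
    project⊥ z = trans (form-along-w z _) (-‿inverseʳ _)

    proj′ : V → V′
    proj′ z = W.idx (project z) (project⊥ z)

    emb-proj′ : ∀ z → W.emb (proj′ z) ≡ project z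
    emb-proj′ z = W.emb-idx _ _

    along-along : ∀ x k l → along (along x k) l ≡ along x (k + l)
    along-along x k l = separated λ z → trans (form-along _ l z) (trans (+-congʳ (form-along x k z))
      (trans (solve 4 (λ f k l g → (f :+ k :* g) :+ l :* g := f :+ (k :+ l) :* g) refl _ _ _ _) (sym (form-along x _ z))))

    along-cong : ∀ x {k l} → k ≈ l → along x k ≡ along x l
    along-cong x e = separated λ z → trans (form-along x _ z) (trans (+-congˡ (*-congʳ e)) (sym (form-along x _ z)))

    along-0 : ∀ x {k} → k ≈ 0# → along x k ≡ x
    along-0 x e = separated λ z → trans (form-along x _ z) (trans (+-congˡ (trans (*-congʳ e) (zeroˡ _))) (+-identityʳ _))

    decompose : ∀ z → along (project z) (form z w) ≡ z
    decompose z = ≡.trans (along-along z _ _) (along-0 z (-‿inverseˡ _))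

    project-along : ∀ x k → form x w ≈ 0# → project (along x k) ≡ x
    project-along x k p = ≡.trans (along-along x k _) (along-0 x
      (trans (+-congˡ (-‿cong (trans (form-along-w x k) (trans (+-congʳ p) (+-identityˡ k))))) (-‿inverseʳ k)))

    ⊥w : ∀ y → form (W.emb y) w ≈ 0#
    ⊥w = W.emb∈

    w⊥ : ∀ {x} → form x w ≈ 0# → form w x ≈ 0#
    w⊥ {x} p = trans (form-σ x w) (trans (σ-cong p) σ-0)

    form-along-along : ∀ {x y} → form x w ≈ 0# → form y w ≈ 0# → ∀ k l → form (along x k) (along y l) ≈ form x y + k * σ l
    form-along-along {x} {y} px py k l = begin
      form (along x k) (along y l)                 ≈⟨ form-along x k _ ⟩
      form x (along y l) + k * form w (along y l)  ≈⟨ +-cong (right x) (*-congˡ (right w)) ⟩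
      (form x y + σ l * form x w) + k * (form w y + σ l * N w)
        ≈⟨ +-cong (+-congˡ (*-congˡ px)) (*-congˡ (+-cong (w⊥ py) (*-congˡ Nw))) ⟩
      (form x y + σ l * 0#) + k * (0# + σ l * 1#)
        ≈⟨ solve 3 (λ f k l → (f :+ l :* con (0 , 0)) :+ k :* (con (0 , 0) :+ l :* one) := f :+ k :* l) refl _ k (σ l) ⟩
      form x y + k * σ l                           ∎
      where
      open ≈-Reasoning
      right : ∀ z → form z (along y l) ≈ form z y + σ l * form z w
      right z = trans (form-⊕ʳ z y _) (+-congˡ (form-∙ʳ l z w))

    form-⊥-project : ∀ {x} → form x w ≈ 0# → ∀ z → form x (project z) ≈ form x z
    form-⊥-project {x} p z = trans (form-⊕ʳ x z _) (trans (+-congˡ (trans (form-∙ʳ _ x w) (trans (*-congˡ p) (zeroʳ _)))) (+-identityʳ _))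

    act⊥ : ∀ {g x} → act g w ≡ w → form x w ≈ 0# → form (act g x) w ≈ 0#
    act⊥ {g} gw p = trans (form-≡ ≡.refl (≡.sym gw)) (trans (isometry g _ w) p)

    act⁻⊥ : ∀ {g x} → act g w ≡ w → form x w ≈ 0# → form (act⁻ g x) w ≈ 0#
    act⁻⊥ {g} {x} gw p = trans (sym (isometry g _ w)) (trans (form-≡ (act-act⁻ g x) gw) p)

    -- Extends an isometry of the complement by the identity on the line of w. Hence restriction
    -- from the stabiliser of w reaches every isometry of the complement, as `full` demands.
    module Extension (φ ψ : V′ → V′) (ψφ : ∀ x → ψ (φ x) ≡ x) (φψ : ∀ x → φ (ψ x) ≡ x)
                     (iso : ∀ x y → form (W.emb (φ x)) (W.emb (φ y)) ≈ form (W.emb x) (W.emb y)) where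

      extend : (V′ → V′) → V → V
      extend θ z = along (W.emb (θ (proj′ z))) (form z w)

      form-extend-w : ∀ θ z → form (extend θ z) w ≈ form z w
      form-extend-w θ z = trans (form-along-w _ _) (trans (+-congʳ (⊥w _)) (+-identityˡ _))

      proj′-extend : ∀ θ z → proj′ (extend θ z) ≡ θ (proj′ z)
      proj′-extend θ z = W.emb-inj (≡.trans (emb-proj′ _) (project-along _ _ (⊥w _)))

      extend-extend : ∀ θ η → (∀ x → θ (η x) ≡ x) → ∀ z → extend θ (extend η z) ≡ z
      extend-extend θ η θη z = ≡.trans (along-cong _ (form-extend-w η z))
        (≡.trans (cong (λ y → along y (form z w)) (≡.trans (cong W.emb (≡.trans (cong θ (proj′-extend η z)) (θη _))) (emb-proj′ z)))
          (decompose z))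

      extend-isometry : ∀ x y → form (extend φ x) (extend φ y) ≈ form x y
      extend-isometry x y = begin
        form (extend φ x) (extend φ y)
          ≈⟨ form-along-along (⊥w _) (⊥w _) _ _ ⟩
        form (W.emb (φ (proj′ x))) (W.emb (φ (proj′ y))) + form x w * σ (form y w)
          ≈⟨ +-congʳ (trans (iso _ _) (form-≡ (emb-proj′ x) (emb-proj′ y))) ⟩
        form (project x) (project y) + form x w * σ (form y w)
          ≈⟨ form-along-along (project⊥ x) (project⊥ y) _ _ ⟨
        form (along (project x) (form x w)) (along (project y) (form y w))
          ≈⟨ form-≡ (decompose x) (decompose y) ⟩
        form x y ∎
        where open ≈-Reasoning

      element : Σ G λ g → ∀ z → act g z ≡ extend φ z
      element = full (extend φ) (extend ψ) (extend-extend ψ φ ψφ) (extend-extend φ ψ φψ) extend-isometry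

      stabilises : act (proj₁ element) w ≡ w
      -- Tested against every z, written as the image of `extend ψ z`; this avoids computing the
      -- value of φ at 0.
      stabilises = ≡.trans (proj₂ element w) (separated λ z → begin
        form (extend φ w) z                        ≈⟨ form-≡ ≡.refl (≡.sym (extend-extend φ ψ φψ z)) ⟩
        form (extend φ w) (extend φ (extend ψ z))  ≈⟨ extend-isometry w _ ⟩
        form w (extend ψ z)                        ≈⟨ form-σ _ w ⟩
        σ (form (extend ψ z) w)                    ≈⟨ σ-cong (form-extend-w ψ z) ⟩
        σ (form z w)                               ≈⟨ form-σ z w ⟨
        form w z                                   ∎)
        where open ≈-Reasoning

      restriction : ∀ x → act (proj₁ element) (W.emb x) ≡ W.emb (φ x)
      restriction x = ≡.trans (proj₂ element (W.emb x)) (≡.trans (along-0 _ (⊥w x))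
        (cong (W.emb ∘ φ) (W.emb-inj (≡.trans (emb-proj′ _) (along-0 _ (trans (-‿cong (⊥w x)) (trans (sym (+-identityˡ _)) (-‿inverseʳ 0#))))))))

    act′ act⁻′ : G′ → V′ → V′
    act′ g x = W.idx (act (H.emb g) (W.emb x)) (act⊥ (H.emb∈ g) (⊥w x))
    act⁻′ g x = W.idx (act⁻ (H.emb g) (W.emb x)) (act⁻⊥ (H.emb∈ g) (⊥w x))

    emb-act′ : ∀ g x → W.emb (act′ g x) ≡ act (H.emb g) (W.emb x)
    emb-act′ g x = W.emb-idx _ _

    emb-act⁻′ : ∀ g x → W.emb (act⁻′ g x) ≡ act⁻ (H.emb g) (W.emb x)
    emb-act⁻′ g x = W.emb-idx _ _

    full′ : ∀ (φ ψ : V′ → V′) → (∀ x → ψ (φ x) ≡ x) → (∀ x → φ (ψ x) ≡ x) →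
            (∀ x y → form (W.emb (φ x)) (W.emb (φ y)) ≈ form (W.emb x) (W.emb y)) →
            Σ G′ λ g → ∀ x → act′ g x ≡ φ x
    full′ φ ψ ψφ φψ iso = H.idx _ X.stabilises , λ x → W.emb-inj (≡.trans (emb-act′ _ x)
      (≡.trans (cong (λ g → act g (W.emb x)) (H.emb-idx _ X.stabilises)) (X.restriction x)))
      where module X = Extension φ ψ ψφ φψ iso

    -- An element of the stabiliser is determined by its restriction, since z is its projection plus
    -- a multiple of the fixed vector w.
    faithful′ : ∀ {g h : G′} → (∀ x → act′ g x ≡ act′ h x) → g ≡ h
    faithful′ {g} {h} e = H.emb-inj (faithful λ z → ≡.trans (split g z) (≡.trans
        (cong₂ _⊕_ (≡.trans (≡.sym (emb-act′ g _)) (≡.trans (cong W.emb (e (proj′ z))) (emb-act′ h _))) ≡.refl)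
        (≡.sym (split h z))))
      where
      split : ∀ g z → act (H.emb g) z ≡ along (act (H.emb g) (W.emb (proj′ z))) (form z w)
      split g z = ≡.trans (cong (act (H.emb g)) (≡.sym (≡.trans (cong (λ x → along x (form z w)) (emb-proj′ z)) (decompose z))))
        (≡.trans (act-⊕ (H.emb g) _ _) (cong (act (H.emb g) (W.emb (proj′ z)) ⊕_)
          (≡.trans (act-∙ (H.emb g) _ w) (cong (form z w ∙_) (H.emb∈ g)))))

    complement : Space
    complement = record
      { size = W.size
      ; _⊕_  = λ x y → W.idx (W.emb x ⊕ W.emb y) (trans (form-⊕ _ _ w) (trans (+-cong (⊥w x) (⊥w y)) (+-identityˡ 0#)))
      ; _∙_  = λ k x → W.idx (k ∙ W.emb x) (trans (form-∙ k _ w) (trans (*-congˡ (⊥w x)) (zeroʳ k)))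
      ; 0v   = W.idx 0v (form-0 w)
      ; form = λ x y → form (W.emb x) (W.emb y)
      ; form-⊕ = λ x y z → trans (form-≡ (W.emb-idx _ _) ≡.refl) (form-⊕ _ _ _)
      ; form-∙ = λ k x z → trans (form-≡ (W.emb-idx _ _) ≡.refl) (form-∙ k _ _)
      ; form-0 = λ z → trans (form-≡ (W.emb-idx _ _) ≡.refl) (form-0 _)
      ; form-σ = λ x y → form-σ _ _
      ; separated = λ {x} {y} e → W.emb-inj (separated λ z →
          trans (sym (form-⊥-project (⊥w x) z)) (trans (form-≡ ≡.refl (≡.sym (emb-proj′ z)))
            (trans (e (proj′ z)) (trans (form-≡ ≡.refl (emb-proj′ z)) (form-⊥-project (⊥w y) z)))))
      ; order = H.size
      ; act  = act′
      ; act⁻ = act⁻′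
      ; act⁻-act = λ g x → W.emb-inj (≡.trans (emb-act⁻′ g _) (≡.trans (cong (act⁻ (H.emb g)) (emb-act′ g x)) (act⁻-act _ _)))
      ; act-act⁻ = λ g x → W.emb-inj (≡.trans (emb-act′ g _) (≡.trans (cong (act (H.emb g)) (emb-act⁻′ g x)) (act-act⁻ _ _)))
      ; isometry = λ g x y → trans (form-≡ (emb-act′ g x) (emb-act′ g y)) (isometry _ _ _)
      ; faithful = faithful′
      ; full = full′
      }

    order′≡ : ℤ.+ H.size ≡ count (stabiliser? w)
    order′≡ = ≡.trans (≡.sym (≡.trans (sum-const H.size 1ℤ) (ℤP.*-identityʳ _)))
      (≡.trans (H.sum-emb (λ _ → 1ℤ)) (sum-cong (λ g → ℤP.*-identityʳ _)))

    -- V is cut into layers by the value of form x w, and each layer is a translate of the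
    -- complement along w.
    sum-decompose : ∀ (f : V → ℤ) → sum f ≡ sum (λ i → sum (λ y → f (along (W.emb y) (scalar i))))
    sum-decompose f = begin
      sum f
        ≡⟨ sum-cong (λ x → sum-δ (scalar-index (form x w)) (λ _ → f x)) ⟨
      sum (λ x → sum (λ i → ⟦ i Fin.≟ scalar-index (form x w) ⟧ ℤ.* f x))
        ≡⟨ sum-comm _ ⟩
      sum (λ i → sum (λ x → ⟦ i Fin.≟ scalar-index (form x w) ⟧ ℤ.* f x))
        ≡⟨ sum-cong (λ i → sum-cong (λ x → cong (ℤ._* f x) (⟦cong⟧ (i Fin.≟ scalar-index (form x w)) (form x w ≟ scalar i)
             (λ { ≡.refl → sym (scalar-scalar-index _) })
             (λ e → scalar-injective (trans (sym e) (sym (scalar-scalar-index _))))))) ⟩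
      sum (λ i → sum (λ x → ⟦ form x w ≟ scalar i ⟧ ℤ.* f x))
        ≡⟨ sum-cong layer ⟩
      sum (λ i → sum (λ y → f (along (W.emb y) (scalar i)))) ∎
      where
      open ≡-Reasoning
      layer : ∀ i → sum (λ x → ⟦ form x w ≟ scalar i ⟧ ℤ.* f x) ≡ sum (λ y → f (along (W.emb y) (scalar i)))
      layer i = ≡.sym (≡.trans (W.sum-emb (λ y → f (along y (scalar i))))
        (sum-reindex (λ x → form x w ≟ 0#) (λ x → form x w ≟ scalar i) (λ x → along x (scalar i)) (λ x → along x (- scalar i))
          (λ x p → trans (form-along-w x _) (trans (+-congʳ p) (+-identityˡ _)))
          (λ x p → trans (form-along-w x _) (≈⇒-≈0 p))
          (λ x _ → ≡.trans (along-along x _ _) (along-0 x (-‿inverseʳ _)))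
          (λ x _ → ≡.trans (along-along x _ _) (along-0 x (-‿inverseˡ _))) f))

    size≡ : ℤ.+ size ≡ ℤ.+ card ℤ.* ℤ.+ W.size
    size≡ = begin
      ℤ.+ size                              ≡⟨ ℤP.*-identityʳ _ ⟨
      ℤ.+ size ℤ.* 1ℤ                       ≡⟨ sum-const size 1ℤ ⟨
      sum {size} (λ _ → 1ℤ)                 ≡⟨ sum-decompose (λ _ → 1ℤ) ⟩
      sum {card} (λ _ → sum {W.size} (λ _ → 1ℤ)) ≡⟨ sum-const card _ ⟩
      ℤ.+ card ℤ.* sum {W.size} (λ _ → 1ℤ)  ≡⟨ cong (ℤ.+ card ℤ.*_) (≡.trans (sum-const W.size 1ℤ) (ℤP.*-identityʳ _)) ⟩
      ℤ.+ card ℤ.* ℤ.+ W.size               ∎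
      where open ≡-Reasoning

    private
      module C′ = Counting complement
      module D′ = Duality complement
      module I′ = Isometries complement

    -- One formula for both cases: the norm takes the value 0 once and every nonzero fixed value q +
    -- 1 times.
    #norms : ∀ b → σ b ≈ b → count (λ i → (scalar i * σ (scalar i)) ≟ b) ≡ 1ℤ ℤ.+ ℤ.+ q ℤ.* (1ℤ ℤ.- ⟦ b ≟ 0# ⟧)
    #norms b σb with b ≟ 0#
    ... | no nz = ≡.trans (norm-fibre b σb nz) (unit (ℤ.+ q))
      where
      unit : ∀ r → 1ℤ ℤ.+ r ≡ 1ℤ ℤ.+ r ℤ.* 1ℤ
      unit = solve-∀
    ... | yes b0 = ≡.trans (≡.trans (sum-cong (λ i → ≡.trans (⟦cong⟧ ((scalar i * σ (scalar i)) ≟ b) (i Fin.≟ scalar-index 0#)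
            (λ e → scalar-injective (trans (zero-norm i (trans e b0)) (sym (scalar-scalar-index 0#))))
            (λ { ≡.refl → trans (*-congʳ (scalar-scalar-index 0#)) (trans (zeroˡ _) (sym b0)) }))
          (≡.sym (ℤP.*-identityʳ _)))) (sum-δ (scalar-index 0#) (λ _ → 1ℤ))) (unit (ℤ.+ q))
      where
      unit : ∀ r → 1ℤ ≡ 1ℤ ℤ.+ r ℤ.* 0ℤ
      unit = solve-∀
      zero-norm : ∀ i → scalar i * σ (scalar i) ≈ 0# → scalar i ≈ 0#
      zero-norm i e with scalar i ≟ 0#
      ... | yes z = z
      ... | no nz = ⊥-elim (*-≉0 nz (σ-≉0 nz) e)

    -- Adding the multiples of w to a vector of norm b compares the frequencies of the scalar norms
    -- -b and 1 - b, whose difference is -q χ(b). So each dimension contributes a factor -q.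
    signed-norms-complement : signed-norms whole ≡ (ℤ.- (ℤ.+ q)) ℤ.* D′.signed-norms C′.whole
    signed-norms-complement = begin
      signed-norms whole
        ≡⟨ sum-cong (λ x → ℤP.*-identityˡ _) ⟩
      sum (λ x → χ (N x))
        ≡⟨ sum-decompose (λ x → χ (N x)) ⟩
      sum (λ i → sum (λ y → χ (N (along (W.emb y) (scalar i)))))
        ≡⟨ sum-comm _ ⟩
      sum (λ y → sum (λ i → χ (N (along (W.emb y) (scalar i)))))
        ≡⟨ sum-cong line ⟩
      sum (λ y → (ℤ.- (ℤ.+ q)) ℤ.* (1ℤ ℤ.* χ (N (W.emb y))))
        ≡⟨ *-distribˡ-sum (ℤ.- (ℤ.+ q)) _ ⟨
      (ℤ.- (ℤ.+ q)) ℤ.* D′.signed-norms C′.whole ∎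
      where
      open ≡-Reasoning
      algebra : ∀ r z u → (1ℤ ℤ.+ r ℤ.* (1ℤ ℤ.- z)) ℤ.- (1ℤ ℤ.+ r ℤ.* (1ℤ ℤ.- u)) ≡ (ℤ.- r) ℤ.* (1ℤ ℤ.* (z ℤ.- u))
      algebra = solve-∀
      line : ∀ y → sum (λ i → χ (N (along (W.emb y) (scalar i)))) ≡ (ℤ.- (ℤ.+ q)) ℤ.* (1ℤ ℤ.* χ (N (W.emb y)))
      line y = begin
        sum (λ i → χ (N (along (W.emb y) (scalar i))))
          ≡⟨ sum-cong (λ i → ≡.trans (χ-cong (form-along-along (⊥w y) (⊥w y) _ _)) (≡.sym (ℤP.*-identityˡ _))) ⟩
        sum (λ i → 1ℤ ℤ.* χ (b + scalar i * σ (scalar i)))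
          ≡⟨ sum-χ (λ _ → 1ℤ) (λ i → b + scalar i * σ (scalar i)) ⟩
        sum (λ i → 1ℤ ℤ.* ⟦ (b + scalar i * σ (scalar i)) ≟ 0# ⟧) ℤ.- sum (λ i → 1ℤ ℤ.* ⟦ (b + scalar i * σ (scalar i)) ≟ 1# ⟧)
          ≡⟨ cong₂ ℤ._-_ (sum-cong (solutions 0#)) (sum-cong (solutions 1#)) ⟩
        count (λ i → (scalar i * σ (scalar i)) ≟ (0# - b)) ℤ.- count (λ i → (scalar i * σ (scalar i)) ≟ (1# - b))
          ≡⟨ cong₂ ℤ._-_ (#norms (0# - b) (σ-c-b σ-0)) (#norms (1# - b) (σ-c-b σ-1)) ⟩
        (1ℤ ℤ.+ ℤ.+ q ℤ.* (1ℤ ℤ.- ⟦ (0# - b) ≟ 0# ⟧)) ℤ.- (1ℤ ℤ.+ ℤ.+ q ℤ.* (1ℤ ℤ.- ⟦ (1# - b) ≟ 0# ⟧))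
          ≡⟨ cong₂ (λ z u → (1ℤ ℤ.+ ℤ.+ q ℤ.* (1ℤ ℤ.- z)) ℤ.- (1ℤ ℤ.+ ℤ.+ q ℤ.* (1ℤ ℤ.- u)))
               (⟦cong⟧ ((0# - b) ≟ 0#) (b ≟ 0#) (sym ∘ -≈0) (≈⇒-≈0 ∘ sym)) (⟦cong⟧ ((1# - b) ≟ 0#) (b ≟ 1#) (sym ∘ -≈0) (≈⇒-≈0 ∘ sym)) ⟩
        (1ℤ ℤ.+ ℤ.+ q ℤ.* (1ℤ ℤ.- ⟦ b ≟ 0# ⟧)) ℤ.- (1ℤ ℤ.+ ℤ.+ q ℤ.* (1ℤ ℤ.- ⟦ b ≟ 1# ⟧))
          ≡⟨ algebra (ℤ.+ q) ⟦ b ≟ 0# ⟧ ⟦ b ≟ 1# ⟧ ⟩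
        (ℤ.- (ℤ.+ q)) ℤ.* (1ℤ ℤ.* χ b) ∎
        where
        b = N (W.emb y)
        solutions : ∀ c i → 1ℤ ℤ.* ⟦ (b + scalar i * σ (scalar i)) ≟ c ⟧ ≡ ⟦ (scalar i * σ (scalar i)) ≟ (c - b) ⟧
        solutions c i = ≡.trans (ℤP.*-identityˡ _) (⟦cong⟧ ((b + scalar i * σ (scalar i)) ≟ c) ((scalar i * σ (scalar i)) ≟ (c - b))
          (λ e → trans (solve 2 (λ b n → n := (b :+ n) :- b) refl b _) (+-congʳ e))
          (λ e → trans (+-congˡ e) (solve 2 (λ b c → b :+ (c :- b) := c) refl b c)))
        σ-c-b : ∀ {c} → σ c ≈ c → σ (c - b) ≈ c - b
        σ-c-b σc = trans (σ-+ _ _) (+-cong σc (trans (σ-neg b) (-‿cong (σN _))))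

    -- As g fixes w, a vector orthogonal to Fix g is already orthogonal to w, and the projection of
    -- a fixed vector is fixed. So testing against the fixed vectors in the complement is enough.
    #Fix^⊥-complement : ∀ g → C′.# (I′.Fix g C′.^⊥) ≡ # (Fix (H.emb g) ^⊥)
    #Fix^⊥-complement g = begin
      sum (λ y → ⟦ y C′.⊥? I′.Fix g ⟧)                          ≡⟨ sum-cong (λ y → ⟦cong⟧ (y C′.⊥? I′.Fix g) (W.emb y ⊥? Fix (H.emb g)) (extend⊥ y) (restrict⊥ y)) ⟩
      sum (λ y → ⟦ W.emb y ⊥? Fix (H.emb g) ⟧)                  ≡⟨ W.sum-emb (λ x → ⟦ x ⊥? Fix (H.emb g) ⟧) ⟩
      sum (λ x → ⟦ form x w ≟ 0# ⟧ ℤ.* ⟦ x ⊥? Fix (H.emb g) ⟧)  ≡⟨ sum-cong absorb ⟩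
      sum (λ x → ⟦ x ⊥? Fix (H.emb g) ⟧)                        ∎
      where
      open ≡-Reasoning
      absorb : ∀ x → ⟦ form x w ≟ 0# ⟧ ℤ.* ⟦ x ⊥? Fix (H.emb g) ⟧ ≡ ⟦ x ⊥? Fix (H.emb g) ⟧
      absorb x with x ⊥? Fix (H.emb g)
      ... | yes p = ≡.trans (ℤP.*-identityʳ _) (⟦yes⟧ (form x w ≟ 0#) (p w (H.emb∈ g)))
      ... | no _ = ℤP.*-zeroʳ ⟦ form x w ≟ 0# ⟧
      extend⊥ : ∀ y → y C′.⊥ I′.Fix g → W.emb y ⊥ Fix (H.emb g)
      extend⊥ y p z gz = trans (sym (form-⊥-project (⊥w y) z)) (trans (form-≡ ≡.refl (≡.sym (emb-proj′ z)))
        (p (proj′ z) (W.emb-inj (≡.trans (emb-act′ g _) (≡.trans (cong (act (H.emb g)) (emb-proj′ z))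
          (≡.trans (⊕-closed (Fix (H.emb g)) gz (∙-closed (Fix (H.emb g)) _ (H.emb∈ g))) (≡.sym (emb-proj′ z))))))))
      restrict⊥ : ∀ y → W.emb y ⊥ Fix (H.emb g) → y C′.⊥ I′.Fix g
      restrict⊥ y p z gz = p (W.emb z) (≡.trans (≡.sym (emb-act′ g z)) (cong W.emb gz))

    total-complement : sum (λ g → C′.# (I′.Fix g C′.^⊥)) ≡ sum (λ g → ⟦ stabiliser? w g ⟧ ℤ.* # (Fix g ^⊥))
    total-complement = ≡.trans (sum-cong #Fix^⊥-complement) (H.sum-emb (λ g → # (Fix g ^⊥)))

  -- The three relations between T, X and Y.

  module MomentRecursion (S : Space) where
    open Space S
    open Geometry S
    open Counting S
    open Duality S
    open Isometries S
    open Reflections S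
    open Perpendicularity S

    total : ℤ
    total = sum (λ g → # (Fix g ^⊥))

    -- The quantities of `eliminate`, with `total` as T. `W` is the Poisson factor, evaluated as
    -- (-q)^m in `signed-norms-whole`.
    s n C W X Y : ℤ
    s = ℤ.+ size
    n = ℤ.+ order
    C = #norm whole 1#
    W = signed-norms whole
    X = sum (λ g → #norm (Fix g ^⊥) 1#)
    Y = sum (λ g → #norm (Fix g) 1# ℤ.* # (Fix g ^⊥))

    -- The weight |Fix g ^⊥| is what makes the summation over g possible: |Fix g| occurs only in the
    -- product |Fix g| |Fix g ^⊥| = s.
    duality-Fix : ∀ g → s ℤ.* (# (Fix g ^⊥) ℤ.- ℤ.+ q ℤ.* #norm (Fix g ^⊥) 1#) ≡ W ℤ.* (s ℤ.- ℤ.+ q ℤ.* (#norm (Fix g) 1# ℤ.* # (Fix g ^⊥)))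
    duality-Fix g = begin
      s ℤ.* (I ℤ.- ℤ.+ q ℤ.* #norm (Fix g ^⊥) 1#)
        ≡⟨ cong₂ ℤ._*_ (#*#^⊥ (Fix g)) (signed-norms≡ (Fix g ^⊥)) ⟨
      (F ℤ.* I) ℤ.* signed-norms (Fix g ^⊥)
        ≡⟨ shuffle F I _ ⟩
      I ℤ.* (F ℤ.* signed-norms (Fix g ^⊥))
        ≡⟨ cong (I ℤ.*_) (≡.trans (duality (Fix g)) (cong (W ℤ.*_) (signed-norms≡ (Fix g)))) ⟩
      I ℤ.* (W ℤ.* (F ℤ.- ℤ.+ q ℤ.* #norm (Fix g) 1#))
        ≡⟨ expand I W F (ℤ.+ q) (#norm (Fix g) 1#) ⟩
      W ℤ.* (F ℤ.* I ℤ.- ℤ.+ q ℤ.* (#norm (Fix g) 1# ℤ.* I))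
        ≡⟨ cong (λ z → W ℤ.* (z ℤ.- ℤ.+ q ℤ.* (#norm (Fix g) 1# ℤ.* I))) (#*#^⊥ (Fix g)) ⟩
      W ℤ.* (s ℤ.- ℤ.+ q ℤ.* (#norm (Fix g) 1# ℤ.* I)) ∎
      where
      open ≡-Reasoning
      I = # (Fix g ^⊥)
      F = # (Fix g)
      shuffle : ∀ f i z → (f ℤ.* i) ℤ.* z ≡ i ℤ.* (f ℤ.* z)
      shuffle = solve-∀
      expand : ∀ i w f r z → i ℤ.* (w ℤ.* (f ℤ.- r ℤ.* z)) ≡ w ℤ.* (f ℤ.* i ℤ.- r ℤ.* (z ℤ.* i))
      expand = solve-∀

    sum-linear : ∀ {k} a b (f h : Fin k → ℤ) → sum (λ i → a ℤ.* (f i ℤ.- b ℤ.* h i)) ≡ a ℤ.* (sum f ℤ.- b ℤ.* sum h)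
    sum-linear a b f h = ≡.trans (≡.sym (*-distribˡ-sum a _)) (cong (a ℤ.*_)
      (≡.trans (sum-minus f _) (cong (λ z → sum f ℤ.- z) (≡.sym (*-distribˡ-sum b h)))))

    duality-total : s ℤ.* (total ℤ.- ℤ.+ q ℤ.* X) ≡ W ℤ.* (n ℤ.* s ℤ.- ℤ.+ q ℤ.* Y)
    duality-total = begin
      s ℤ.* (total ℤ.- ℤ.+ q ℤ.* X)
        ≡⟨ sum-linear s (ℤ.+ q) _ _ ⟨
      sum (λ g → s ℤ.* (# (Fix g ^⊥) ℤ.- ℤ.+ q ℤ.* #norm (Fix g ^⊥) 1#))
        ≡⟨ sum-cong duality-Fix ⟩
      sum (λ g → W ℤ.* (s ℤ.- ℤ.+ q ℤ.* (#norm (Fix g) 1# ℤ.* # (Fix g ^⊥))))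
        ≡⟨ sum-linear W (ℤ.+ q) _ _ ⟩
      W ℤ.* (sum {order} (λ g → s) ℤ.- ℤ.+ q ℤ.* Y)
        ≡⟨ cong (λ z → W ℤ.* (z ℤ.- ℤ.+ q ℤ.* Y)) (sum-const order s) ⟩
      W ℤ.* (n ℤ.* s ℤ.- ℤ.+ q ℤ.* Y) ∎
      where open ≡-Reasoning

    #perpendicular : ∀ r → N r ≈ 1# → (1ℤ ℤ.+ ℤ.+ q) ℤ.* sum (λ g → ⟦ r ⊥? Fix g ⟧) ≡ ℤ.+ q ℤ.* n
    #perpendicular r Nr = begin
      (1ℤ ℤ.+ ℤ.+ q) ℤ.* P                                               ≡⟨ split (ℤ.+ q) n P ⟩
      (1ℤ ℤ.+ ℤ.+ q) ℤ.* n ℤ.- (1ℤ ℤ.+ ℤ.+ q) ℤ.* (n ℤ.- P)              ≡⟨ cong (λ z → (1ℤ ℤ.+ ℤ.+ q) ℤ.* n ℤ.- (1ℤ ℤ.+ ℤ.+ q) ℤ.* (z ℤ.- P)) (≡.trans (sum-const order 1ℤ) (ℤP.*-identityʳ n)) ⟨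
      (1ℤ ℤ.+ ℤ.+ q) ℤ.* n ℤ.- (1ℤ ℤ.+ ℤ.+ q) ℤ.* (sum {order} (λ g → 1ℤ) ℤ.- P)  ≡⟨ cong (λ z → (1ℤ ℤ.+ ℤ.+ q) ℤ.* n ℤ.- (1ℤ ℤ.+ ℤ.+ q) ℤ.* z) (sum-minus _ _) ⟨
      (1ℤ ℤ.+ ℤ.+ q) ℤ.* n ℤ.- ℤ.+ suc q ℤ.* sum (λ g → 1ℤ ℤ.- ⟦ r ⊥? Fix g ⟧)  ≡⟨ cong (λ z → (1ℤ ℤ.+ ℤ.+ q) ℤ.* n ℤ.- z) (#⊥Fix Nr) ⟩
      (1ℤ ℤ.+ ℤ.+ q) ℤ.* n ℤ.- n                                         ≡⟨ collect (ℤ.+ q) n ⟩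
      ℤ.+ q ℤ.* n                                                        ∎
      where
      open ≡-Reasoning
      P = sum (λ g → ⟦ r ⊥? Fix g ⟧)
      split : ∀ r n p → (1ℤ ℤ.+ r) ℤ.* p ≡ (1ℤ ℤ.+ r) ℤ.* n ℤ.- (1ℤ ℤ.+ r) ℤ.* (n ℤ.- p)
      split = solve-∀
      collect : ∀ r n → (1ℤ ℤ.+ r) ℤ.* n ℤ.- n ≡ r ℤ.* n
      collect = solve-∀

    #perpendicular-total : (1ℤ ℤ.+ ℤ.+ q) ℤ.* X ≡ C ℤ.* (ℤ.+ q ℤ.* n)
    #perpendicular-total = begin
      (1ℤ ℤ.+ ℤ.+ q) ℤ.* X
        ≡⟨ cong ((1ℤ ℤ.+ ℤ.+ q) ℤ.*_) (≡.trans (sum-comm _) (sum-cong (λ r →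
             ≡.trans (sum-cong (λ g → ℤP.*-comm ⟦ r ⊥? Fix g ⟧ ⟦ N r ≟ 1# ⟧)) (≡.sym (*-distribˡ-sum ⟦ N r ≟ 1# ⟧ _))))) ⟩
      (1ℤ ℤ.+ ℤ.+ q) ℤ.* sum (λ r → ⟦ N r ≟ 1# ⟧ ℤ.* sum (λ g → ⟦ r ⊥? Fix g ⟧))
        ≡⟨ *-distribˡ-sum (1ℤ ℤ.+ ℤ.+ q) _ ⟩
      sum (λ r → (1ℤ ℤ.+ ℤ.+ q) ℤ.* (⟦ N r ≟ 1# ⟧ ℤ.* sum (λ g → ⟦ r ⊥? Fix g ⟧)))
        ≡⟨ sum-cong (λ r → ≡.trans (swap (1ℤ ℤ.+ ℤ.+ q) ⟦ N r ≟ 1# ⟧ _) (⟦⟧*-cong (N r ≟ 1#) (#perpendicular r))) ⟩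
      sum (λ r → ⟦ N r ≟ 1# ⟧ ℤ.* (ℤ.+ q ℤ.* n))
        ≡⟨ *-distribʳ-sum (ℤ.+ q ℤ.* n) _ ⟨
      sum (λ r → ⟦ N r ≟ 1# ⟧) ℤ.* (ℤ.+ q ℤ.* n)
        ≡⟨ cong (ℤ._* (ℤ.+ q ℤ.* n)) (sum-cong (λ r → ℤP.*-identityˡ ⟦ N r ≟ 1# ⟧)) ⟨
      C ℤ.* (ℤ.+ q ℤ.* n) ∎
      where
      open ≡-Reasoning
      swap : ∀ a b z → a ℤ.* (b ℤ.* z) ≡ b ℤ.* (a ℤ.* z)
      swap = solve-∀

    -- A pair of an isometry and a fixed unit vector w is read as a member of the stabiliser of w,
    -- where the induction hypothesis applies.
    Y-by-vectors : Y ≡ sum (λ w → ⟦ N w ≟ 1# ⟧ ℤ.* sum (λ g → ⟦ stabiliser? w g ⟧ ℤ.* # (Fix g ^⊥)))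
    Y-by-vectors = begin
      Y
        ≡⟨ sum-cong (λ g → *-distribʳ-sum (# (Fix g ^⊥)) _) ⟩
      sum (λ g → sum (λ w → ⟦ stabiliser? w g ⟧ ℤ.* ⟦ N w ≟ 1# ⟧ ℤ.* # (Fix g ^⊥)))
        ≡⟨ sum-comm _ ⟩
      sum (λ w → sum (λ g → ⟦ stabiliser? w g ⟧ ℤ.* ⟦ N w ≟ 1# ⟧ ℤ.* # (Fix g ^⊥)))
        ≡⟨ sum-cong (λ w → ≡.trans (sum-cong (λ g → swap ⟦ stabiliser? w g ⟧ ⟦ N w ≟ 1# ⟧ _)) (≡.sym (*-distribˡ-sum ⟦ N w ≟ 1# ⟧ _))) ⟩
      sum (λ w → ⟦ N w ≟ 1# ⟧ ℤ.* sum (λ g → ⟦ stabiliser? w g ⟧ ℤ.* # (Fix g ^⊥))) ∎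
      where
      open ≡-Reasoning
      swap : ∀ a b z → a ℤ.* b ℤ.* z ≡ b ℤ.* (a ℤ.* z)
      swap = solve-∀

    module _ (size≢1 : ¬ size ≡ 1) where

      nonzero-vector : Σ V λ x → ¬ x ≡ 0v
      nonzero-vector with FinP.any? (λ x → ¬? (x Fin.≟ 0v))
      ... | yes e = e
      ... | no none = ⊥-elim (size≢1 (ℤP.+-injective (≡.trans (≡.sym #whole)
          (≡.trans (sum-cong (λ x → ≡.sym (≡.trans (ℤP.*-identityʳ _) (⟦yes⟧ (x Fin.≟ 0v) (all-0 x))))) (sum-δ 0v (λ _ → 1ℤ))))))
        where
        all-0 : ∀ x → x ≡ 0v
        all-0 x with x Fin.≟ 0v
        ... | yes e = e
        ... | no ne = ⊥-elim (none (x , ne))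

      trace-τ : Σ V λ x → Σ V λ y → form x y ≈ τ
      trace-τ = proj₁ nonzero-vector , ≢0⇒ _ (proj₂ nonzero-vector) τ

      -- Polarisation: if every norm vanished, so would the trace of every form x y, but some form x
      -- y equals `τ`, which has trace 1.
      nonisotropic-vector : Σ V λ x → ¬ N x ≈ 0#
      nonisotropic-vector with FinP.any? (λ x → ¬? (N x ≟ 0#))
      ... | yes e = e
      ... | no none = ⊥-elim (1≉0 (trans (sym τ+στ) (begin
          τ + σ τ                  ≈⟨ +-cong xy (σ-cong xy) ⟨
          form x y + σ (form x y)  ≈⟨ solve 3 (λ a t b → t := (((a :+ t) :+ b) :- a) :- b) refl (N x) _ (N y) ⟩
          (N x + (form x y + σ (form x y)) + N y - N x) - N y
            ≈⟨ +-cong (+-cong (trans (sym (N-⊕ x y)) (all-0 (x ⊕ y))) (-‿cong (all-0 x))) (-‿cong (all-0 y)) ⟩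
          (0# - 0#) - 0#           ≈⟨ solve 0 ((con (0 , 0) :- con (0 , 0)) :- con (0 , 0) := con (0 , 0)) refl ⟩
          0#                       ∎)))
        where
        open ≈-Reasoning
        all-0 : ∀ x → N x ≈ 0#
        all-0 x with N x ≟ 0#
        ... | yes e = e
        ... | no ne = ⊥-elim (none (x , ne))
        x = proj₁ trace-τ
        y = proj₁ (proj₂ trace-τ)
        xy : form x y ≈ τ
        xy = proj₂ (proj₂ trace-τ)

      abstract
        unit-vector : Σ V λ w → N w ≈ 1#
        unit-vector = proj₁ k ∙ x , trans (N-∙ _ x) (trans (*-congʳ (proj₂ k)) (trans (*-comm b _) inv-b))
          where
          x : V
          x = proj₁ nonisotropic-vector
          b : Carrier
          b = proj₁ (inverse (N x) (proj₂ nonisotropic-vector))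
          inv-b : N x * b ≈ 1#
          inv-b = proj₂ (inverse (N x) (proj₂ nonisotropic-vector))
          k : Σ Carrier λ k → k * σ k ≈ b
          k = norm-surjective b (σ-inverse (σN x) inv-b) (λ e → 1≉0 (trans (sym inv-b) (trans (*-congˡ e) (zeroʳ _))))

  open MomentRecursion using (total; unit-vector; duality-total; #perpendicular-total; Y-by-vectors)

  -- Induction on the dimension.

  r : ℤ
  r = ℤ.+ q

  -- In the step to dimension m + 1 the power E′ is multiplied by -q and by W = (-q)^(m + 1), hence
  -- the summand 2 + m.
  exponent : ℕ → ℕ
  exponent zero    = 0
  exponent (suc m) = exponent m ℕ.+ (2 ℕ.+ m)

  Fin-1 : ∀ n → n ≡ 1 → (i j : Fin n) → i ≡ j
  Fin-1 _ ≡.refl zero zero = ≡.refl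

  q≢1 : ¬ q ≡ 1
  q≢1 q≡1 = 1≉0 (trans (sym (scalar-scalar-index 1#)) (trans (reflexive (cong scalar
      (Fin-1 card (≡.trans card≡ (cong₂ ℕ._*_ q≡1 q≡1)) (scalar-index 1#) (scalar-index 0#)))) (scalar-scalar-index 0#)))

  size≢1-suc : (S : Space) → ∀ m → ℤ.+ Space.size S ≡ (r ℤ.* r) ℤ.^ suc m → ¬ Space.size S ≡ 1
  size≢1-suc S m e size≡1 = q≢1 (ℕP.m*n≡1⇒m≡1 q (q ℕ.* ℤ.∣ (r ℤ.* r) ℤ.^ m ∣) (begin
    q ℕ.* (q ℕ.* ℤ.∣ (r ℤ.* r) ℤ.^ m ∣)      ≡⟨ ℕP.*-assoc q q _ ⟨
    q ℕ.* q ℕ.* ℤ.∣ (r ℤ.* r) ℤ.^ m ∣        ≡⟨ cong (ℕ._* ℤ.∣ (r ℤ.* r) ℤ.^ m ∣) (ℤP.abs-* r r) ⟨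
    ℤ.∣ r ℤ.* r ∣ ℕ.* ℤ.∣ (r ℤ.* r) ℤ.^ m ∣  ≡⟨ ℤP.abs-* (r ℤ.* r) ((r ℤ.* r) ℤ.^ m) ⟨
    ℤ.∣ (r ℤ.* r) ℤ.^ suc m ∣                ≡⟨ cong ℤ.∣_∣ (≡.trans (≡.sym e) (cong ℤ.+_ size≡1)) ⟩
    1                                        ∎))
    where open ≡-Reasoning

  size-complement : (S : Space) (w : Space.V S) (Nw : Space.form S w w ≈ 1#) → ∀ m →
                    ℤ.+ Space.size S ≡ (r ℤ.* r) ℤ.^ suc m →
                    ℤ.+ Space.size (Complement.complement S Nw) ≡ (r ℤ.* r) ℤ.^ m
  size-complement S w Nw m e = ℤP.*-cancelˡ-≡ (r ℤ.* r) _ _ {{ℤ.≢-nonZero q²≢0}}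
    (≡.trans (cong (ℤ._* ℤ.+ Space.size (Complement.complement S Nw)) (≡.sym (≡.trans (cong ℤ.+_ card≡) (ℤP.pos-* q q)))) (≡.trans (≡.sym (Complement.size≡ S Nw)) e))
    where
    q²≢0 : ¬ r ℤ.* r ≡ 0ℤ
    q²≢0 rr≡0 = FinP.¬Fin0 (subst Fin (≡.trans card≡ (ℤP.+-injective (≡.trans (ℤP.pos-* q q) rr≡0))) (scalar-index 0#))

  signed-norms-whole : ∀ m (S : Space) → ℤ.+ Space.size S ≡ (r ℤ.* r) ℤ.^ m →
                       Duality.signed-norms S (Counting.whole S) ≡ (ℤ.- r) ℤ.^ m
  signed-norms-whole zero S e = ≡.trans (sum-cong (λ x → ≡.trans (ℤP.*-identityˡ _)
      (≡.trans (χ-cong (trans (form-≡ (Fin-1 size (ℤP.+-injective e) x 0v) ≡.refl) (form-0 x))) χ0))) (≡.trans #whole e)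
    where
    open Space S
    open Geometry S
    open Counting S
  signed-norms-whole (suc m) S e = ≡.trans (Complement.signed-norms-complement S Nw)
    (cong ((ℤ.- r) ℤ.*_) (signed-norms-whole m (Complement.complement S Nw) (size-complement S w Nw m e)))
    where
    w : Space.V S
    w = proj₁ (unit-vector S (size≢1-suc S m e))
    Nw : Space.form S w w ≈ 1#
    Nw = proj₂ (unit-vector S (size≢1-suc S m e))

  -q^2m : ∀ m → (ℤ.- r) ℤ.^ m ℤ.* (ℤ.- r) ℤ.^ m ≡ (r ℤ.* r) ℤ.^ m
  -q^2m zero    = ≡.refl
  -q^2m (suc m) = ≡.trans (shuffle r ((ℤ.- r) ℤ.^ m)) (cong (r ℤ.* r ℤ.*_) (-q^2m m))
    where
    shuffle : ∀ r x → (ℤ.- r) ℤ.* x ℤ.* ((ℤ.- r) ℤ.* x) ≡ r ℤ.* r ℤ.* (x ℤ.* x)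
    shuffle = solve-∀

  -- With E = (-q)^(exponent m), this says that the average of |I| / |V| over the group is (1 + qE)
  -- / ((1 + q)E).
  TotalFormula : ℕ → Space → Set
  TotalFormula m S = total S ℤ.* (1ℤ ℤ.+ r) ℤ.* (ℤ.- r) ℤ.^ exponent m
                   ≡ ℤ.+ Space.order S ℤ.* ℤ.+ Space.size S ℤ.* (1ℤ ℤ.+ r ℤ.* (ℤ.- r) ℤ.^ exponent m)

  total-base : (S : Space) → ℤ.+ Space.size S ≡ 1ℤ → TotalFormula 0 S
  total-base S e = begin
    total S ℤ.* (1ℤ ℤ.+ r) ℤ.* 1ℤ         ≡⟨ cong (λ z → z ℤ.* (1ℤ ℤ.+ r) ℤ.* 1ℤ) total≡ ⟩
    n ℤ.* 1ℤ ℤ.* (1ℤ ℤ.+ r) ℤ.* 1ℤ        ≡⟨ rearrange n r ⟩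
    n ℤ.* 1ℤ ℤ.* (1ℤ ℤ.+ r ℤ.* 1ℤ)        ≡⟨ cong (λ z → n ℤ.* z ℤ.* (1ℤ ℤ.+ r ℤ.* 1ℤ)) e ⟨
    n ℤ.* ℤ.+ size ℤ.* (1ℤ ℤ.+ r ℤ.* 1ℤ)  ∎
    where
    open ≡-Reasoning
    open Space S
    open Counting S
    open Geometry.Subspace
    open Isometries S
    n = ℤ.+ order
    rearrange : ∀ n r → n ℤ.* 1ℤ ℤ.* (1ℤ ℤ.+ r) ℤ.* 1ℤ ≡ n ℤ.* 1ℤ ℤ.* (1ℤ ℤ.+ r ℤ.* 1ℤ)
    rearrange = solve-∀
    total≡ : total S ≡ n ℤ.* 1ℤ
    total≡ = ≡.trans (sum-cong (λ g → ≡.trans (sum-cong (λ x → ⟦yes⟧ (x ⊥? Fix g)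
        (subst (_⊥ Fix g) (Fin-1 size (ℤP.+-injective e) 0v x) (0-closed (Fix g ^⊥))))) (≡.trans #whole e)))
      (sum-const order 1ℤ)

  total-formula : ∀ m (S : Space) → ℤ.+ Space.size S ≡ (r ℤ.* r) ℤ.^ m → TotalFormula m S
  total-formula zero S e = total-base S e
  total-formula (suc m) S e = Elimination.eliminate r (ℤ.+ size) s′ (ℤ.+ order) C W X Y (total S) E′ _
      (ℤ.≢-nonZero λ s≡0 → FinP.¬Fin0 (subst Fin (ℤP.+-injective s≡0) 0v))
      (duality-total S) (#perpendicular-total S) byvec
      e
      (≡.trans (Duality.signed-norms≡ S whole) (cong (ℤ._- r ℤ.* C) #whole))
      (≡.trans (cong (λ z → z ℤ.* z) W≡) (≡.trans (-q^2m (suc m)) (≡.sym e)))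
      (≡.trans (ℤP.^-distribˡ-+-* (ℤ.- r) (exponent m) (2 ℕ.+ m)) (cong (λ z → E′ ℤ.* ((ℤ.- r) ℤ.* z)) (≡.sym W≡)))
    where
    open Space S
    open Counting S
    open Geometry S using (N)
    open Isometries S using (Fix)
    open Reflections S using (stabiliser?; sum-stabilisers)
    open MomentRecursion S using (C; W; X; Y)
    E′ s′ : ℤ
    E′ = (ℤ.- r) ℤ.^ exponent m
    s′ = (r ℤ.* r) ℤ.^ m
    W≡ : W ≡ (ℤ.- r) ℤ.^ suc m
    W≡ = signed-norms-whole (suc m) S e
    w₀ : V
    w₀ = proj₁ (unit-vector S (size≢1-suc S m e))
    Nw₀ : N w₀ ≈ 1#
    Nw₀ = proj₂ (unit-vector S (size≢1-suc S m e))
    Tw : V → ℤ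
    Tw w = sum (λ g → ⟦ stabiliser? w g ⟧ ℤ.* # (Fix g ^⊥))
    d : ℤ
    d = 1ℤ ℤ.+ r ℤ.* E′
    -- The induction hypothesis on the complement of w, read as a statement about the stabiliser of
    -- w.
    at : ∀ w → N w ≈ 1# → Tw w ℤ.* (1ℤ ℤ.+ r) ℤ.* E′ ≡ count (stabiliser? w) ℤ.* s′ ℤ.* d
    at w Nw = ≡.trans (cong (λ z → z ℤ.* (1ℤ ℤ.+ r) ℤ.* E′) (≡.sym (Complement.total-complement S Nw)))
      (≡.trans (total-formula m (Complement.complement S Nw) (size-complement S w Nw m e))
        (cong₂ (λ a b → a ℤ.* b ℤ.* d) (Complement.order′≡ S Nw) (size-complement S w Nw m e)))
    -- The factor s′ d is the same for every w, so only the orders of the stabilisers are summed,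
    -- and they add up to the order of the group.
    byvec : Y ℤ.* (1ℤ ℤ.+ r) ℤ.* E′ ≡ ℤ.+ order ℤ.* s′ ℤ.* d
    byvec = begin
      Y ℤ.* (1ℤ ℤ.+ r) ℤ.* E′
        ≡⟨ ≡.trans (cong (λ z → z ℤ.* (1ℤ ℤ.+ r) ℤ.* E′) (Y-by-vectors S)) (ℤP.*-assoc (sum (λ w → ⟦ N w ≟ 1# ⟧ ℤ.* Tw w)) (1ℤ ℤ.+ r) E′) ⟩
      sum (λ w → ⟦ N w ≟ 1# ⟧ ℤ.* Tw w) ℤ.* ((1ℤ ℤ.+ r) ℤ.* E′)
        ≡⟨ *-distribʳ-sum ((1ℤ ℤ.+ r) ℤ.* E′) _ ⟩
      sum (λ w → ⟦ N w ≟ 1# ⟧ ℤ.* Tw w ℤ.* ((1ℤ ℤ.+ r) ℤ.* E′))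
        ≡⟨ sum-cong (λ w → ≡.trans (shuffle ⟦ N w ≟ 1# ⟧ (Tw w) (1ℤ ℤ.+ r) E′) (≡.trans (⟦⟧*-cong (N w ≟ 1#) (at w))
             (shuffle′ ⟦ N w ≟ 1# ⟧ (count (stabiliser? w)) s′ d))) ⟩
      sum (λ w → ⟦ N w ≟ 1# ⟧ ℤ.* count (stabiliser? w) ℤ.* (s′ ℤ.* d))
        ≡⟨ *-distribʳ-sum (s′ ℤ.* d) _ ⟨
      sum (λ w → ⟦ N w ≟ 1# ⟧ ℤ.* count (stabiliser? w)) ℤ.* (s′ ℤ.* d)
        ≡⟨ cong (ℤ._* (s′ ℤ.* d)) (sum-stabilisers w₀ Nw₀) ⟩
      ℤ.+ order ℤ.* (s′ ℤ.* d)
        ≡⟨ ℤP.*-assoc (ℤ.+ order) s′ d ⟨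
      ℤ.+ order ℤ.* s′ ℤ.* d ∎
      where
      open ≡-Reasoning
      shuffle : ∀ a b d e → a ℤ.* b ℤ.* (d ℤ.* e) ≡ a ℤ.* (b ℤ.* d ℤ.* e)
      shuffle = solve-∀
      shuffle′ : ∀ a b d e → a ℤ.* (b ℤ.* d ℤ.* e) ≡ a ℤ.* b ℤ.* (d ℤ.* e)
      shuffle′ = solve-∀

-- The concrete unitary group as an instance of `Space`.

module HermitianMatrices {c ℓ : Level} (K : FiniteField c ℓ) (q : ℕ) (conj : FieldArithmetic.Conjugation K q)
                         (σ≡ : ∀ x → FieldArithmetic.Conjugation.σ conj x ≡ FiniteField.pow K x q) where

  open IntegerSums
  open ListCounting
  open FiniteField K hiding (zero)
  open RingNormalisation cring
  open FieldArithmetic K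
  open Unitary K q hiding (σ) renaming (_⊕_ to _+ᵛ_)
  open Conjugation conj
  import Algebra.Properties.Semiring.Sum semiring as Add

  Σ-cong : ∀ {m} (f g : Vec m) → (∀ i → f i ≈ g i) → Σᵢ f ≈ Σᵢ g
  Σ-cong f g e = Add.sum-cong-≋ {x = f} {y = g} e

  Σ-+ : ∀ {m} (f g : Vec m) → Σᵢ (λ i → f i + g i) ≈ Σᵢ f + Σᵢ g
  Σ-+ = Add.∑-distrib-+

  Σ-* : ∀ {m} a (f : Vec m) → a * Σᵢ f ≈ Σᵢ (λ i → a * f i)
  Σ-* a f = Add.*-distribˡ-sum a f

  Σ-*ʳ : ∀ {m} a (f : Vec m) → Σᵢ f * a ≈ Σᵢ (λ i → f i * a)
  Σ-*ʳ a f = Add.*-distribʳ-sum a f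

  Σ-swap : ∀ {m n} (f : Fin m → Fin n → Carrier) → Σᵢ (λ i → Σᵢ (λ j → f i j)) ≈ Σᵢ (λ j → Σᵢ (λ i → f i j))
  Σ-swap f = Add.∑-comm f

  Σ-σ : ∀ {m} (f : Vec m) → σ (Σᵢ f) ≈ Σᵢ (λ i → σ (f i))
  Σ-σ {zero} f = σ-0
  Σ-σ {suc m} f = trans (σ-+ _ _) (+-congˡ (Σ-σ (f ∘ suc)))

  Σ-0 : ∀ {m} (f : Vec m) → (∀ i → f i ≈ 0#) → Σᵢ f ≈ 0#
  Σ-0 {zero} f e = refl
  Σ-0 {suc m} f e = trans (+-cong (e zero) (Σ-0 (f ∘ suc) (e ∘ suc))) (+-identityˡ 0#)

  I-suc : ∀ {m} (i j : Fin m) → I (suc i) (suc j) ≡ I i j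
  I-suc i j with i Fin.≟ j
  ... | yes _ = ≡.refl
  ... | no _ = ≡.refl

  Σ-I : ∀ {m} (f : Vec m) j → Σᵢ (λ i → f i * I i j) ≈ f j
  Σ-I {suc m} f zero = trans (+-cong (*-identityʳ _) (Σ-0 (λ i → f (suc i) * I (suc i) zero) (λ i → zeroʳ _))) (+-identityʳ _)
  Σ-I {suc m} f (suc j) = trans (+-cong (zeroʳ _) (Σ-cong (λ i → f (suc i) * I (suc i) (suc j)) (λ i → f (suc i) * I i j) (λ i → *-congˡ (reflexive (I-suc i j)))))
    (trans (+-identityˡ _) (Σ-I (f ∘ suc) j))

  Σ-I′ : ∀ {m} (f : Vec m) i → Σᵢ (λ j → I i j * f j) ≈ f i
  Σ-I′ {suc m} f zero = trans (+-cong (*-identityˡ _) (Σ-0 (λ j → I zero (suc j) * f (suc j)) (λ j → zeroˡ _))) (+-identityʳ _)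
  Σ-I′ {suc m} f (suc i) = trans (+-cong (zeroˡ _) (Σ-cong (λ j → I (suc i) (suc j) * f (suc j)) (λ j → I i j * f (suc j)) (λ j → *-congʳ (reflexive (I-suc i j)))))
    (trans (+-identityˡ _) (Σ-I′ (f ∘ suc) i))

  _≋_ : ∀ {m} → Vec m → Vec m → Set ℓ
  u ≋ w = ∀ i → u i ≈ w i

  _≋ᵐ_ : ∀ {m} → Mat m → Mat m → Set ℓ
  A ≋ᵐ B = ∀ i → A i ≋ B i

  ·-cong : ∀ {m} {u u' : Vec m} {A A' : Mat m} → u ≋ u' → A ≋ᵐ A' → (u · A) ≋ (u' · A')
  ·-cong {u = u} {u'} {A} {A'} e f j = Σ-cong (λ i → u i * A i j) (λ i → u' i * A' i j) (λ i → *-cong (e i) (f i j))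

  ·-I : ∀ {m} (u : Vec m) → (u · I) ≋ u
  ·-I u j = Σ-I u j

  I-· : ∀ {m} (A : Mat m) i → (I i · A) ≋ A i
  I-· A i j = Σ-I′ (λ k → A k j) i

  ·-⊗ : ∀ {m} (u : Vec m) (A B : Mat m) → ((u · A) · B) ≋ (u · (A ⊗ B))
  ·-⊗ u A B k = begin
    Σᵢ (λ j → Σᵢ (λ i → u i * A i j) * B j k)  ≈⟨ Σ-cong (λ j → Σᵢ (λ i → u i * A i j) * B j k) (λ j → Σᵢ (λ i → u i * A i j * B j k)) (λ j → Σ-*ʳ (B j k) (λ i → u i * A i j)) ⟩
    Σᵢ (λ j → Σᵢ (λ i → u i * A i j * B j k))  ≈⟨ Σ-swap (λ j i → u i * A i j * B j k) ⟩
    Σᵢ (λ i → Σᵢ (λ j → u i * A i j * B j k))  ≈⟨ Σ-cong (λ i → Σᵢ (λ j → u i * A i j * B j k)) (λ i → u i * Σᵢ (λ j → A i j * B j k)) (λ i →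
        trans (Σ-cong (λ j → u i * A i j * B j k) (λ j → u i * (A i j * B j k)) (λ j → *-assoc _ _ _)) (sym (Σ-* (u i) (λ j → A i j * B j k)))) ⟩
    Σᵢ (λ i → u i * Σᵢ (λ j → A i j * B j k))  ∎
    where open ≈-Reasoning

  module _ {m : ℕ} (H : Mat m) where

    row : Fin m → Vec m → Carrier
    row i w = Σᵢ (λ j → H i j * σ (w j))

    form-row : ∀ u w → form H u w ≈ Σᵢ (λ i → u i * row i w)
    form-row u w = Σ-cong (λ i → Σᵢ (λ j → u i * (H i j * pow (w j) q))) (λ i → u i * row i w) (λ i →
      trans (Σ-cong (λ j → u i * (H i j * pow (w j) q)) (λ j → u i * (H i j * σ (w j))) (λ j → *-congˡ (*-congˡ (reflexive (≡.sym (σ≡ (w j)))))))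
        (sym (Σ-* (u i) (λ j → H i j * σ (w j)))))

    row-cong : ∀ i {w w'} → w ≋ w' → row i w ≈ row i w'
    row-cong i {w} {w'} e = Σ-cong (λ j → H i j * σ (w j)) (λ j → H i j * σ (w' j)) (λ j → *-congˡ (σ-cong (e j)))

    form-cong : ∀ {u u' w w'} → u ≋ u' → w ≋ w' → form H u w ≈ form H u' w'
    form-cong {u} {u'} {w} {w'} e f = trans (form-row u w) (trans
      (Σ-cong (λ i → u i * row i w) (λ i → u' i * row i w') (λ i → *-cong (e i) (row-cong i f))) (sym (form-row u' w')))

    form-+ˡ : ∀ u v w → form H (λ i → u i + v i) w ≈ form H u w + form H v w
    form-+ˡ u v w = trans (form-row _ w) (trans (Σ-cong (λ i → (u i + v i) * row i w) (λ i → u i * row i w + v i * row i w) (λ i → distribʳ _ _ _))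
      (trans (Σ-+ (λ i → u i * row i w) (λ i → v i * row i w)) (sym (+-cong (form-row u w) (form-row v w)))))

    form-*ˡ : ∀ a u w → form H (λ i → a * u i) w ≈ a * form H u w
    form-*ˡ a u w = trans (form-row _ w) (trans (Σ-cong (λ i → (a * u i) * row i w) (λ i → a * (u i * row i w)) (λ i → *-assoc _ _ _))
      (trans (sym (Σ-* a (λ i → u i * row i w))) (*-congˡ (sym (form-row u w)))))

    form-0ˡ : ∀ w → form H (λ _ → 0#) w ≈ 0#
    form-0ˡ w = trans (form-row _ w) (Σ-0 (λ i → 0# * row i w) (λ i → zeroˡ _))

    form-· : ∀ u (A : Mat m) w → form H (u · A) w ≈ Σᵢ (λ i → u i * form H (A i) w)
    form-· u A w = begin
      form H (u · A) w                             ≈⟨ form-row (u · A) w ⟩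
      Σᵢ (λ j → Σᵢ (λ i → u i * A i j) * row j w)  ≈⟨ Σ-cong (λ j → Σᵢ (λ i → u i * A i j) * row j w) (λ j → Σᵢ (λ i → u i * A i j * row j w)) (λ j → Σ-*ʳ (row j w) (λ i → u i * A i j)) ⟩
      Σᵢ (λ j → Σᵢ (λ i → u i * A i j * row j w))  ≈⟨ Σ-swap (λ j i → u i * A i j * row j w) ⟩
      Σᵢ (λ i → Σᵢ (λ j → u i * A i j * row j w))  ≈⟨ Σ-cong (λ i → Σᵢ (λ j → u i * A i j * row j w)) (λ i → u i * form H (A i) w) (λ i →
          trans (Σ-cong (λ j → u i * A i j * row j w) (λ j → u i * (A i j * row j w)) (λ j → *-assoc _ _ _))
            (trans (sym (Σ-* (u i) (λ j → A i j * row j w))) (*-congˡ (sym (form-row (A i) w))))) ⟩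
      Σᵢ (λ i → u i * form H (A i) w)              ∎
      where open ≈-Reasoning

    form-hermitian : Hermitian H → ∀ u w → form H w u ≈ σ (form H u w)
    form-hermitian herm u w = begin
      form H w u                                     ≈⟨ form-row w u ⟩
      Σᵢ (λ i → w i * row i u)                       ≈⟨ Σ-cong (λ i → w i * row i u) (λ i → Σᵢ (λ j → w i * (H i j * σ (u j)))) (λ i → Σ-* (w i) (λ j → H i j * σ (u j))) ⟩
      Σᵢ (λ i → Σᵢ (λ j → w i * (H i j * σ (u j))))  ≈⟨ Σ-swap (λ i j → w i * (H i j * σ (u j))) ⟩
      Σᵢ (λ j → Σᵢ (λ i → w i * (H i j * σ (u j))))  ≈⟨ Σ-cong (λ j → Σᵢ (λ i → w i * (H i j * σ (u j)))) (λ j → σ (u j * row j w)) flip ⟩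
      Σᵢ (λ j → σ (u j * row j w))                   ≈⟨ Σ-σ (λ j → u j * row j w) ⟨
      σ (Σᵢ (λ j → u j * row j w))                   ≈⟨ σ-cong (form-row u w) ⟨
      σ (form H u w)                                 ∎
      where
      open ≈-Reasoning
      entry : ∀ i j → w i * (H i j * σ (u j)) ≈ σ (u j) * σ (H j i * σ (w i))
      entry i j = trans (*-congˡ (*-congʳ (trans (herm j i) (reflexive (≡.sym (σ≡ (H j i)))))))
        (trans (solve 3 (λ w h u → w :* (h :* u) := u :* (h :* w)) refl (w i) (σ (H j i)) (σ (u j)))
          (*-congˡ (sym (trans (σ-* _ _) (*-congˡ (σσ (w i)))))))
      flip : ∀ j → Σᵢ (λ i → w i * (H i j * σ (u j))) ≈ σ (u j * row j w)
      flip j = trans (Σ-cong (λ i → w i * (H i j * σ (u j))) (λ i → σ (u j) * σ (H j i * σ (w i))) (λ i → entry i j))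
        (trans (sym (Σ-* (σ (u j)) (λ i → σ (H j i * σ (w i))))) (trans (*-congˡ (sym (Σ-σ (λ i → H j i * σ (w i))))) (sym (σ-* _ _))))

  ≋-sym : ∀ {n} {u w : Vec n} → u ≋ w → w ≋ u
  ≋-sym e i = sym (e i)

  ≋-trans : ∀ {n} {u v w : Vec n} → u ≋ v → v ≋ w → u ≋ w
  ≋-trans e f i = trans (e i) (f i)

  module _ {m : ℕ} (H : Mat m) (herm : Hermitian H) (nondeg : NonDegenerate H) where

    open HermitianSpaces K conj
    open MomentRecursion using (total)

    complete-vecs : ∀ (u : Vec m) → Any (u ≋_) (allVecs m)
    complete-vecs = allFuns-complete complete m

    complete-mats : ∀ (A : Mat m) → Any (A ≋ᵐ_) (allMats m)
    complete-mats = allFuns-complete complete-vecs m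

    V : Set
    V = Fin (length (allVecs m))

    abstract
      vec : V → Vec m
      vec = lookup (allVecs m)

      -- The way back from the opaque `vec` to the list, for the places where the lists of the
      -- theorem are counted.
      vec≡ : ∀ x → vec x ≡ lookup (allVecs m) x
      vec≡ x = ≡.refl

      ix : Vec m → V
      ix u = index (complete-vecs u)

      vec-ix : ∀ u → vec (ix u) ≋ u
      vec-ix u i = sym (AnyP.lookup-index (complete-vecs u) i)

      vec-injective : ∀ {x y} → vec x ≋ vec y → x ≡ y
      vec-injective {x} {y} = lookup-injective {_~_ = _≋_} ≋-sym (allFuns-distinct distinct m) x y

    record IsUnitary (A : Mat m) : Set (c ⊔ ℓ) where
      field
        B   : Mat m
        A⊗B : (A ⊗ B) ≋ᵐ I
        B⊗A : (B ⊗ A) ≋ᵐ I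
        preserves : ∀ u w → form H (u · A) (w · A) ≈ form H u w

    isUnitaryᵇ : Mat m → Bool
    isUnitaryᵇ A = isInvertibleᵇ A ∧ isIsometryᵇ H A

    matEqᵇ⇒ : ∀ (A B : Mat m) → matEqᵇ A B ≡ true → A ≋ᵐ B
    matEqᵇ⇒ A B e i j = does⇒ (A i j ≟ B i j) (foldr-∧⇒ (λ j → eqᵇ (A i j) (B i j)) (foldr-∧⇒ (λ i → vecEqᵇ (A i) (B i)) e i) j)

    ⇒matEqᵇ : ∀ (A B : Mat m) → A ≋ᵐ B → matEqᵇ A B ≡ true
    ⇒matEqᵇ A B e = ⇒foldr-∧ (λ i → vecEqᵇ (A i) (B i)) (λ i → ⇒foldr-∧ (λ j → eqᵇ (A i j) (B i j)) (λ j → ⇒does (A i j ≟ B i j) (e i j)))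

    isUnitaryᵇ⇒ : ∀ A → isUnitaryᵇ A ≡ true → IsUnitary A
    isUnitaryᵇ⇒ A e = record
      { B = proj₁ inv
      ; A⊗B = matEqᵇ⇒ _ _ (proj₁ (∧⇒ (proj₂ inv)))
      ; B⊗A = matEqᵇ⇒ _ _ (proj₂ (∧⇒ {matEqᵇ (A ⊗ proj₁ inv) I} (proj₂ inv)))
      ; preserves = λ u w → trans (form-cong H (·-cong (to-vec u) (λ _ _ → refl)) (·-cong (to-vec w) (λ _ _ → refl)))
          (trans (does⇒ (form H (rep u · A) (rep w · A) ≟ form H (rep u) (rep w))
            (at (λ w → eqᵇ (form H (rep u · A) (w · A)) (form H (rep u) w))
              (at (λ u → allᵇ (λ w → eqᵇ (form H (u · A) (w · A)) (form H u w)) (allVecs m)) (proj₂ (∧⇒ {isInvertibleᵇ A} e)) u) w))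
            (form-cong H (≋-sym (to-vec u)) (≋-sym (to-vec w))))
      }
      where
      inv : ∃ λ B → matEqᵇ (A ⊗ B) I ∧ matEqᵇ (B ⊗ A) I ≡ true
      inv = anyᵇ⇒ _ (allMats m) (proj₁ (∧⇒ e))
      -- The Boolean test ranges over listed vectors only; an arbitrary vector is replaced by the
      -- listed one that is pointwise equal to it.
      rep : Vec m → Vec m
      rep u = lookup (allVecs m) (index (complete-vecs u))
      to-vec : ∀ u → u ≋ rep u
      to-vec u = AnyP.lookup-index (complete-vecs u)
      at : ∀ p → allᵇ p (allVecs m) ≡ true → ∀ u → p (rep u) ≡ true
      at p h u = All.lookup (allᵇ⇒ p (allVecs m) h) (∈-lookup (index (complete-vecs u)))

    ⊗-congʳ : ∀ (A : Mat m) {B B' : Mat m} → B ≋ᵐ B' → (A ⊗ B) ≋ᵐ (A ⊗ B')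
    ⊗-congʳ A e i = ·-cong {u = A i} (λ _ → refl) e

    ⊗-congˡ : ∀ {A A' : Mat m} (B : Mat m) → A ≋ᵐ A' → (A ⊗ B) ≋ᵐ (A' ⊗ B)
    ⊗-congˡ B e i = ·-cong (e i) (λ _ _ → refl)

    ⇒isUnitaryᵇ : ∀ A → IsUnitary A → isUnitaryᵇ A ≡ true
    ⇒isUnitaryᵇ A U = ⇒∧
      (⇒anyᵇ (λ B → matEqᵇ (A ⊗ B) I ∧ matEqᵇ (B ⊗ A) I) (allMats m) (Any.map (λ {B'} e → ⇒∧
         (⇒matEqᵇ (A ⊗ B') I (λ i → ≋-trans (⊗-congʳ A (λ i → ≋-sym (e i)) i) (A⊗B i)))
         (⇒matEqᵇ (B' ⊗ A) I (λ i → ≋-trans (⊗-congˡ A (λ i → ≋-sym (e i)) i) (B⊗A i)))) (complete-mats B)))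
      (⇒allᵇ (λ u → allᵇ (λ w → eqᵇ (form H (u · A) (w · A)) (form H u w)) (allVecs m)) (allVecs m) (λ u →
         ⇒allᵇ (λ w → eqᵇ (form H (u · A) (w · A)) (form H u w)) (allVecs m) (λ w → ⇒does (form H (u · A) (w · A) ≟ form H u w) (preserves u w))))
      where open IsUnitary U

    IsUnitary-cong : ∀ {A A'} → A ≋ᵐ A' → IsUnitary A → IsUnitary A'
    IsUnitary-cong {A} {A'} e U = record
      { B = B
      ; A⊗B = λ i → ≋-trans (⊗-congˡ B (λ i → ≋-sym (e i)) i) (A⊗B i)
      ; B⊗A = λ i → ≋-trans (⊗-congʳ B (λ i → ≋-sym (e i)) i) (B⊗A i)
      ; preserves = λ u w → trans (form-cong H (·-cong {u = u} (λ _ → refl) (λ i → ≋-sym (e i))) (·-cong {u = w} (λ _ → refl) (λ i → ≋-sym (e i)))) (preserves u w)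
      }
      where open IsUnitary U

    G : Set
    G = Fin (length (unitaryGroup H))

    abstract
      mat : G → Mat m
      mat = lookup (unitaryGroup H)

      mat≡ : ∀ g → mat g ≡ lookup (unitaryGroup H) g
      mat≡ g = ≡.refl

      mat-unitary : ∀ g → IsUnitary (mat g)
      mat-unitary g = isUnitaryᵇ⇒ _ (All.lookup (filterᵇ-true isUnitaryᵇ (allMats m)) (∈-lookup {xs = unitaryGroup H} g))

      mat-injective : ∀ {g h} → mat g ≋ᵐ mat h → g ≡ h
      mat-injective {g} {h} = lookup-injective {_~_ = _≋ᵐ_} (λ e i → ≋-sym (e i))
        (filterᵇ-pairs isUnitaryᵇ (allMats m) (allFuns-distinct (allFuns-distinct distinct m) m)) g h

      mat-surjective : ∀ A → IsUnitary A → Σ G λ g → A ≋ᵐ mat g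
      mat-surjective A U = index found , AnyP.lookup-index found
        where
        found : Any (A ≋ᵐ_) (unitaryGroup H)
        found = filterᵇ-any isUnitaryᵇ (allMats m) (λ A' e → ⇒isUnitaryᵇ A' (IsUnitary-cong e U)) (complete-mats A)

    formᵛ : V → V → Carrier
    formᵛ x y = form H (vec x) (vec y)

    formᵛ-ix : ∀ u y → formᵛ (ix u) y ≈ form H u (vec y)
    formᵛ-ix u y = form-cong H (vec-ix u) (λ _ → refl)

    -- The difference of the two vectors is orthogonal to everything, hence zero by nondegeneracy.
    formᵛ-separated : ∀ {x y} → (∀ z → formᵛ x z ≈ formᵛ y z) → x ≡ y
    formᵛ-separated {x} {y} e = vec-injective λ i → -≈0 (trans (+-congˡ (solve 1 (λ a → :- a := (:- one) :* a) refl _)) (nondeg d vanishes i))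
      where
      open ≈-Reasoning
      d : Vec m
      d i = vec x i + (- 1#) * vec y i
      vanishes : ∀ w → form H d w ≈ 0#
      vanishes w = begin
        form H d w                                    ≈⟨ trans (form-+ˡ H (vec x) (λ i → (- 1#) * vec y i) w) (+-congˡ (form-*ˡ H (- 1#) (vec y) w)) ⟩
        form H (vec x) w + (- 1#) * form H (vec y) w  ≈⟨ +-cong at-x (*-congˡ (sym at-y)) ⟩
        formᵛ x (ix w) + (- 1#) * formᵛ y (ix w)      ≈⟨ +-congʳ (e (ix w)) ⟩
        formᵛ y (ix w) + (- 1#) * formᵛ y (ix w)      ≈⟨ solve 1 (λ a → a :+ (:- one) :* a := con (0 , 0)) refl _ ⟩
        0#                                            ∎
        where
        at-x : form H (vec x) w ≈ formᵛ x (ix w)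
        at-x = form-cong H (λ _ → refl) (≋-sym (vec-ix w))
        at-y : formᵛ y (ix w) ≈ form H (vec y) w
        at-y = form-cong H (λ _ → refl) (vec-ix w)

    actᵐ : Mat m → V → V
    actᵐ A x = ix (vec x · A)

    vec-actᵐ : ∀ A x → vec (actᵐ A x) ≋ (vec x · A)
    vec-actᵐ A x = vec-ix _

    actᵐ-⊗ : ∀ A B → (A ⊗ B) ≋ᵐ I → ∀ x → actᵐ B (actᵐ A x) ≡ x
    actᵐ-⊗ A B e x = vec-injective (≋-trans (vec-actᵐ B _) (≋-trans (·-cong (vec-actᵐ A x) (λ _ _ → refl))
      (≋-trans (·-⊗ (vec x) A B) (≋-trans (·-cong {u = vec x} (λ _ → refl) e) (·-I (vec x))))))

    basis : Fin m → V
    basis i = ix (I i)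

    -- The matrix of φ. Only the form is used: φ preserves it and is surjective, hence is linear.
    module Matrix (φ ψ : V → V) (φψ : ∀ x → φ (ψ x) ≡ x) (iso : ∀ x y → formᵛ (φ x) (φ y) ≈ formᵛ x y) where

      matrix : Mat m
      matrix i = vec (φ (basis i))

      represents : ∀ x → actᵐ matrix x ≡ φ x
      represents x = formᵛ-separated λ z → begin
        formᵛ (actᵐ matrix x) z                        ≈⟨ form-cong H (vec-actᵐ matrix x) (λ _ → refl) ⟩
        form H (vec x · matrix) (vec z)                ≈⟨ form-· H (vec x) matrix (vec z) ⟩
        Σᵢ (λ i → vec x i * formᵛ (φ (basis i)) z)     ≈⟨ Σ-cong (λ i → vec x i * formᵛ (φ (basis i)) z) (λ i → vec x i * form H (I i) (vec (ψ z))) (λ i → *-congˡ (at i z)) ⟩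
        Σᵢ (λ i → vec x i * form H (I i) (vec (ψ z)))  ≈⟨ form-· H (vec x) I (vec (ψ z)) ⟨
        form H (vec x · I) (vec (ψ z))                 ≈⟨ form-cong H (·-I (vec x)) (λ _ → refl) ⟩
        formᵛ x (ψ z)                                  ≈⟨ iso x (ψ z) ⟨
        formᵛ (φ x) (φ (ψ z))                          ≡⟨ cong (formᵛ (φ x)) (φψ z) ⟩
        formᵛ (φ x) z                                  ∎
        where
        open ≈-Reasoning
        at : ∀ i z → formᵛ (φ (basis i)) z ≈ form H (I i) (vec (ψ z))
        at i z = trans (reflexive (cong (formᵛ (φ (basis i))) (≡.sym (φψ z)))) (trans (iso _ _) (formᵛ-ix (I i) (ψ z)))

      vec-represents : ∀ x → (vec x · matrix) ≋ vec (φ x)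
      vec-represents x = ≋-trans (≋-sym (vec-actᵐ matrix x)) (λ i → reflexive (cong (λ y → vec y i) (represents x)))

    module _ (φ ψ : V → V) (ψφ : ∀ x → ψ (φ x) ≡ x) (φψ : ∀ x → φ (ψ x) ≡ x) (iso : ∀ x y → formᵛ (φ x) (φ y) ≈ formᵛ x y) where

      private
        module Φ = Matrix φ ψ φψ iso
        module Ψ = Matrix ψ φ ψφ (λ x y → trans (sym (iso (ψ x) (ψ y))) (reflexive (cong₂ formᵛ (φψ x) (φψ y))))

        inverse-rows : ∀ {θ η : V → V} {B : Mat m} → (∀ x → (vec x · B) ≋ vec (θ x)) → (∀ x → θ (η x) ≡ x) →
                       ∀ i → (vec (η (basis i)) · B) ≋ I i
        inverse-rows {θ} {η} rep θη i = ≋-trans (rep _) (≋-trans (λ j → reflexive (cong (λ y → vec y j) (θη (basis i)))) (vec-ix (I i)))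

      -- The inverse matrix is the matrix of `ψ`, and the products are compared with the identity
      -- row by row, on basis vectors.
      matrix-unitary : IsUnitary Φ.matrix
      matrix-unitary = record
        { B = Ψ.matrix
        ; A⊗B = inverse-rows {ψ} {φ} Ψ.vec-represents ψφ
        ; B⊗A = inverse-rows {φ} {ψ} Φ.vec-represents φψ
        ; preserves = λ u w → trans (form-cong H (image u) (image w)) (trans (iso (ix u) (ix w)) (form-cong H (vec-ix u) (vec-ix w)))
        }
        where
        image : ∀ u → (u · Φ.matrix) ≋ vec (φ (ix u))
        image u = ≋-trans (·-cong (≋-sym (vec-ix u)) (λ _ _ → refl)) (Φ.vec-represents (ix u))

      matrix-full : Σ G λ g → ∀ x → actᵐ (mat g) x ≡ φ x
      matrix-full = proj₁ found , λ x → ≡.trans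
          (vec-injective (≋-trans (vec-actᵐ _ x) (≋-trans (·-cong {u = vec x} (λ _ → refl) (λ i → ≋-sym (proj₂ found i))) (≋-sym (vec-actᵐ _ x)))))
          (Φ.represents x)
        where
        found : Σ G λ g → Φ.matrix ≋ᵐ mat g
        found = mat-surjective Φ.matrix matrix-unitary

    actᵐ-faithful : ∀ {g h : G} → (∀ x → actᵐ (mat g) x ≡ actᵐ (mat h) x) → g ≡ h
    actᵐ-faithful {g} {h} e = mat-injective λ i → ≋-trans (≋-sym (row-of g i)) (≋-trans (λ j → reflexive (cong (λ y → vec y j) (e (basis i)))) (row-of h i))
      where
      row-of : ∀ g i → vec (actᵐ (mat g) (basis i)) ≋ mat g i
      row-of g i = ≋-trans (vec-actᵐ (mat g) (basis i)) (≋-trans (·-cong (vec-ix (I i)) (λ _ _ → refl)) (I-· (mat g) i))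

    matrixSpace : Space
    matrixSpace = record
      { size = length (allVecs m)
      ; _⊕_ = λ x y → ix (vec x +ᵛ vec y)
      ; _∙_ = λ a x → ix (λ i → a * vec x i)
      ; 0v = ix (λ _ → 0#)
      ; form = formᵛ
      ; form-⊕ = λ x y z → trans (formᵛ-ix _ z) (form-+ˡ H (vec x) (vec y) (vec z))
      ; form-∙ = λ a x z → trans (formᵛ-ix _ z) (form-*ˡ H a (vec x) (vec z))
      ; form-0 = λ z → trans (formᵛ-ix _ z) (form-0ˡ H (vec z))
      ; form-σ = λ x y → form-hermitian H herm (vec x) (vec y)
      ; separated = formᵛ-separated
      ; order = length (unitaryGroup H)
      ; act = λ g → actᵐ (mat g)
      ; act⁻ = λ g → actᵐ (IsUnitary.B (mat-unitary g))
      ; act⁻-act = λ g → actᵐ-⊗ _ _ (IsUnitary.A⊗B (mat-unitary g))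
      ; act-act⁻ = λ g → actᵐ-⊗ _ _ (IsUnitary.B⊗A (mat-unitary g))
      ; isometry = λ g x y → trans (form-cong H (vec-actᵐ _ x) (vec-actᵐ _ y)) (IsUnitary.preserves (mat-unitary g) _ _)
      ; faithful = actᵐ-faithful
      ; full = matrix-full
      }

    open Space matrixSpace using (_⊕_; act)
    open Geometry matrixSpace using (⊖_)
    open Counting matrixSpace using (#_; _^⊥; #whole)
    open Isometries matrixSpace using (Fix; displacement; Displaced; displaced?; #displaced≡)

    vec-displacement : ∀ g x i → vec (displacement g x) i ≈ vec x i - (vec x · mat g) i
    vec-displacement g x i = trans (vec-ix _ i) (+-congˡ (trans (vec-ix _ i) (trans (*-congˡ (vec-actᵐ (mat g) x i))
      (solve 1 (λ a → (:- one) :* a := :- a) refl _))))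

    fixed-point⇒displaced : ∀ g v u → ((u · mat g) +ᵛ vec v) ≋ u → Displaced g v
    fixed-point⇒displaced g v u e = ix u , vec-injective λ i → trans (vec-displacement g (ix u) i)
      (trans (+-cong (vec-ix u i) (-‿cong (·-cong {A = mat g} (vec-ix u) (λ _ _ → refl) i)))
        (trans (+-congʳ (sym (e i))) (solve 2 (λ a b → (a :+ b) :- a := b) refl _ _)))

    displaced⇒fixed-point : ∀ g v x → displacement g x ≡ v → ((vec x · mat g) +ᵛ vec v) ≋ vec x
    displaced⇒fixed-point g v x ≡.refl i = trans (+-congˡ (vec-displacement g x i)) (solve 2 (λ a x → a :+ (x :- a) := x) refl _ _)

    derangement-count : ∀ g v → (if isDerangementᵇ (mat g , vec v) then 1ℤ else 0ℤ) ≡ 1ℤ ℤ.- ⟦ displaced? g v ⟧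
    derangement-count g v with displaced? g v | isDerangementᵇ (mat g , vec v) in eq
    ... | no _ | true = ≡.refl
    ... | yes _ | false = ≡.refl
    ... | yes (x , d) | true = ⊥-elim (true≢false (≡.trans (≡.sym (All.lookup (allᵇ⇒ (λ u → not (vecEqᵇ ((u · mat g) +ᵛ vec v) u)) (allVecs m) eq) (∈-lookup {xs = allVecs m} x)))
          (cong not (⇒foldr-∧ (λ i → eqᵇ (((lookup (allVecs m) x · mat g) +ᵛ vec v) i) (lookup (allVecs m) x i)) (λ i →
            ⇒does (((lookup (allVecs m) x · mat g) +ᵛ vec v) i ≟ lookup (allVecs m) x i)
              (subst (λ u → ((u · mat g) +ᵛ vec v) ≋ u) (vec≡ x) (displaced⇒fixed-point g v x d) i))))))
    ... | no none | false = ⊥-elim (true≢false (≡.trans (≡.sym (⇒allᵇ (λ u → not (vecEqᵇ ((u · mat g) +ᵛ vec v) u)) (allVecs m) moved)) eq))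
      where
      moved : ∀ u → not (vecEqᵇ ((u · mat g) +ᵛ vec v) u) ≡ true
      moved u with vecEqᵇ ((u · mat g) +ᵛ vec v) u in fixed
      ... | false = ≡.refl
      ... | true = ⊥-elim (none (fixed-point⇒displaced g v u (λ i →
              does⇒ (((u · mat g) +ᵛ vec v) i ≟ u i) (foldr-∧⇒ (λ i → eqᵇ (((u · mat g) +ᵛ vec v) i) (u i)) fixed i))))

    N : ℤ
    N = ℤ.+ length (unitaryGroup H) ℤ.* ℤ.+ length (allVecs m)

    #derangements : ℤ.+ length (derangements H) ≡ N ℤ.- total matrixSpace
    #derangements = begin
      ℤ.+ length (derangements H)
        ≡⟨ length-filterᵇ isDerangementᵇ (affineGroup H) ⟩
      sumList indicator (affineGroup H)
        ≡⟨ sumList-concatMap indicator _ (unitaryGroup H) ⟩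
      sumList (λ A → sumList indicator (map (λ v → A , v) (allVecs m))) (unitaryGroup H)
        ≡⟨ sumList≡sum _ (unitaryGroup H) ⟩
      sum (λ g → sumList indicator (map (λ v → lookup (unitaryGroup H) g , v) (allVecs m)))
        ≡⟨ sum-cong (λ g → ≡.trans (sumList-map indicator (λ v → lookup (unitaryGroup H) g , v) (allVecs m)) (sumList≡sum _ (allVecs m))) ⟩
      sum (λ g → sum (λ v → indicator (lookup (unitaryGroup H) g , lookup (allVecs m) v)))
        ≡⟨ sum-cong (λ g → sum-cong (λ v → ≡.trans (cong indicator (≡.sym (cong₂ _,_ (mat≡ g) (vec≡ v)))) (derangement-count g v))) ⟩
      sum (λ g → sum (λ v → 1ℤ ℤ.- ⟦ displaced? g v ⟧))
        ≡⟨ sum-cong (λ g → ≡.trans (sum-minus _ _) (cong₂ ℤ._-_ (≡.trans (sum-const (length (allVecs m)) 1ℤ) (ℤP.*-identityʳ s)) (#displaced≡ g))) ⟩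
      sum (λ g → s ℤ.- # (Fix g ^⊥))
        ≡⟨ sum-minus _ _ ⟩
      sum {length (unitaryGroup H)} (λ g → s) ℤ.- total matrixSpace
        ≡⟨ cong (ℤ._- total matrixSpace) (sum-const (length (unitaryGroup H)) s) ⟩
      N ℤ.- total matrixSpace ∎
      where
      open ≡-Reasoning
      s = ℤ.+ length (allVecs m)
      indicator : Mat m × Vec m → ℤ
      indicator Av = if isDerangementᵇ Av then 1ℤ else 0ℤ

    #affineGroup : ℤ.+ length (affineGroup H) ≡ N
    #affineGroup = ≡.trans (cong ℤ.+_ (length-concatMap _ (length (allVecs m)) (unitaryGroup H) (λ A → ListP.length-map _ (allVecs m))))
      (ℤP.pos-* (length (unitaryGroup H)) (length (allVecs m)))

    size≡ : ℤ.+ length (allVecs m) ≡ (r ℤ.* r) ℤ.^ m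
    size≡ = ≡.trans (cong ℤ.+_ (≡.trans (length-allFuns elements m) (cong (ℕ._^ m) card≡))) (pos-^ m)
      where
      pos-^ : ∀ n → ℤ.+ ((q ℕ.* q) ℕ.^ n) ≡ (r ℤ.* r) ℤ.^ n
      pos-^ zero = ≡.refl
      pos-^ (suc n) = ≡.trans (ℤP.pos-* (q ℕ.* q) ((q ℕ.* q) ℕ.^ n)) (cong₂ ℤ._*_ (ℤP.pos-* q q) (pos-^ n))

    -- The truncated division is exact, since m(m + 3) is twice `exponent m`.
    exponent≡ : ∀ m → (m ℕ.* (m ℕ.+ 3)) ℕ./ 2 ≡ exponent m
    exponent≡ m = ≡.trans (cong (ℕ._/ 2) (≡.sym (doubled m))) (m*n/n≡m (exponent m) 2)
      where
      step : ∀ m → m ℕ.* (m ℕ.+ 3) ℕ.+ (2 ℕ.+ m) ℕ.* 2 ≡ suc m ℕ.* (suc m ℕ.+ 3)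
      step = ℕSolver.solve-∀
      doubled : ∀ m → exponent m ℕ.* 2 ≡ m ℕ.* (m ℕ.+ 3)
      doubled zero = ≡.refl
      doubled (suc m) = ≡.trans (ℕP.*-distribʳ-+ 2 (exponent m) (2 ℕ.+ m)) (≡.trans (cong (ℕ._+ (2 ℕ.+ m) ℕ.* 2) (doubled m)) (step m))

    derangement-formula : ℤ.+ length (derangements H) ℤ.* ℤ.+ (q ℕ.+ 1) ℤ.* (ℤ.- ℤ.+ q) ℤ.^ ((m ℕ.* (m ℕ.+ 3)) ℕ./ 2)
                        ≡ ℤ.+ length (affineGroup H) ℤ.* ((ℤ.- ℤ.+ q) ℤ.^ ((m ℕ.* (m ℕ.+ 3)) ℕ./ 2) ℤ.- 1ℤ)
    derangement-formula = begin
      D ℤ.* ℤ.+ (q ℕ.+ 1) ℤ.* (ℤ.- r) ℤ.^ ((m ℕ.* (m ℕ.+ 3)) ℕ./ 2)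
        ≡⟨ cong₂ (λ a b → a ℤ.* b ℤ.* (ℤ.- r) ℤ.^ ((m ℕ.* (m ℕ.+ 3)) ℕ./ 2)) #derangements (cong ℤ.+_ (ℕP.+-comm q 1)) ⟩
      (N ℤ.- T) ℤ.* (1ℤ ℤ.+ r) ℤ.* (ℤ.- r) ℤ.^ ((m ℕ.* (m ℕ.+ 3)) ℕ./ 2)
        ≡⟨ cong (λ e → (N ℤ.- T) ℤ.* (1ℤ ℤ.+ r) ℤ.* (ℤ.- r) ℤ.^ e) (exponent≡ m) ⟩
      (N ℤ.- T) ℤ.* (1ℤ ℤ.+ r) ℤ.* E
        -- Passing to the complementary count N - T turns 1 + qE into (1 + q)E - (1 + qE) = E - 1.
        ≡⟨ expand N T r E ⟩
      N ℤ.* (1ℤ ℤ.+ r) ℤ.* E ℤ.- T ℤ.* (1ℤ ℤ.+ r) ℤ.* E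
        ≡⟨ cong (λ z → N ℤ.* (1ℤ ℤ.+ r) ℤ.* E ℤ.- z) (total-formula m matrixSpace size≡) ⟩
      N ℤ.* (1ℤ ℤ.+ r) ℤ.* E ℤ.- N ℤ.* (1ℤ ℤ.+ r ℤ.* E)
        ≡⟨ collect N r E ⟩
      N ℤ.* (E ℤ.- 1ℤ)
        ≡⟨ cong₂ (λ a e → a ℤ.* ((ℤ.- r) ℤ.^ e ℤ.- 1ℤ)) #affineGroup (exponent≡ m) ⟨
      ℤ.+ length (affineGroup H) ℤ.* ((ℤ.- r) ℤ.^ ((m ℕ.* (m ℕ.+ 3)) ℕ./ 2) ℤ.- 1ℤ) ∎
      where
      open ≡-Reasoning
      D T E : ℤ
      D = ℤ.+ length (derangements H)
      T = total matrixSpace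
      E = (ℤ.- r) ℤ.^ exponent m
      expand : ∀ n t r e → (n ℤ.- t) ℤ.* (1ℤ ℤ.+ r) ℤ.* e ≡ n ℤ.* (1ℤ ℤ.+ r) ℤ.* e ℤ.- t ℤ.* (1ℤ ℤ.+ r) ℤ.* e
      expand = solve-∀
      collect : ∀ n r e → n ℤ.* (1ℤ ℤ.+ r) ℤ.* e ℤ.- n ℤ.* (1ℤ ℤ.+ r ℤ.* e) ≡ n ℤ.* (e ℤ.- 1ℤ)
      collect = solve-∀

open import Data.Nat using (_^_; _*_; _+_; _/_)
open import Data.Integer using (+_; -_) renaming (_*_ to _*ℤ_; _-_ to _-ℤ_; _^_ to _^ℤ_)

theorem1p1 : ∀ {c ℓ : Level} (p k q m : ℕ) → Prime p → k ≥ 1 → q ≡ p ^ k → m ≥ 1 →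
    (K : FiniteField c ℓ) → FiniteField.card K ≡ q ^ 2 →
    (H : Unitary.Mat K q m) → Unitary.Hermitian K q H → Unitary.NonDegenerate K q H →
    let e = (m * (m + 3)) / 2
        D = length (Unitary.derangements K q H)
        N = length (Unitary.affineGroup K q H)
    in (+ D) *ℤ (+ (q + 1)) *ℤ ((- (+ q)) ^ℤ e)
       ≡ (+ N) *ℤ (((- (+ q)) ^ℤ e) -ℤ (+ 1))
theorem1p1 p k q m isPrime k≥1 q≡pᵏ m≥1 K card≡q² H herm nondeg =
  HermitianMatrices.derangement-formula K q (proj₁ conj) (proj₂ conj) H herm nondeg
  where
  conj : Σ (FieldArithmetic.Conjugation K q) λ conj → ∀ x → FieldArithmetic.Conjugation.σ conj x ≡ FiniteField.pow K x q
  conj = FiniteFields.frobenius-conjugation K p k q isPrime k≥1 q≡pᵏ card≡q²
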